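{- Let $q$ be a power of an odd prime, let $d\geq 3$ be odd, and let $E,F\subset \mathbb F_q^d$ be nonempty. Then $$ |\Delta(E,F)|\geq \begin{cases} \min \left\{ \frac{q}{2}, \frac{|E||F|}{8q^{d-1}}\right\} &\text{if } 1\leq |E|< q^{\frac{d-1}{2}},\\[2pt] \min \left\{ \frac{q}{2}, \frac{|F|}{8q^{\frac{d-1}{2}}}\right\} &\text{if } q^{\frac{d-1}{2}}\leq |E|< q^{\frac{d+1}{2}},\\[2pt] \min \left\{ \frac{q}{2}, \frac{|E||F|}{2q^{d}}\right\} &\text{if } q^{\frac{d+1}{2}} \leq |E|\leq q^{d}. \end{cases}$$
   Context: $\mathbb F_q$ is the finite field with $q$ elements, of characteristic greater than two. For $m=(m_1,\dots,m_d)\in\mathbb F_q^d$ put $\|m\|=m_1^2+\dots+m_d^2\in\mathbb F_q$. For $E,F\subset\mathbb F_q^d$ the distance set is $\Delta(E,F)=\{\|x-y\|\in\mathbb F_q: x\in E,\ y\in F\}$. -}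

module Defs where

open import Algebra.Core using (Op₁; Op₂)
open import Algebra.Structures using (IsCommutativeRing)
open import Data.Fin using (Fin)
open import Data.Fin.Properties using (nonZeroIndex; inj⇒≟)
open import Data.Integer using (+_)
open import Data.List using (List; []; _∷_; length; filter; tabulate; cartesianProductWith)
open import Data.List.Membership.Propositional using (_∈_; find; lose)
open import Data.List.Membership.Propositional.Properties using (∈-tabulate⁺; ∈-cartesianProductWith⁺)
open import Data.List.Relation.Unary.All using ([])
open import Data.List.Relation.Unary.AllPairs using ([]; _∷_)
open import Data.List.Relation.Unary.Any using (here; any?)
open import Data.List.Relation.Unary.Unique.Propositional using (Unique)
open import Data.List.Relation.Unary.Unique.Propositional.Properties using (tabulate⁺; cartesianProductWith⁺)
open import Data.Nat as ℕ using (ℕ; zero; suc; NonZero)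
open import Data.Nat.Properties using (m*n≢0; m^n≢0)
open import Data.Product using (∃; _×_; _,_)
open import Data.Rational as ℚ using (ℚ)
open import Data.Vec as Vec using (Vec; []; _∷_)
open import Data.Vec.Properties using (∷-injective)
open import Function.Bundles using (_↔_; Inverse)
open import Function.Properties.Inverse using (↔-sym; Inverse⇒Injection)
open import Level using (Level; _⊔_) renaming (suc to lsuc)
open import Relation.Binary.Definitions using (DecidableEquality)
open import Relation.Binary.PropositionalEquality using (_≡_; _≢_; refl; sym; trans; cong; subst)
open import Relation.Nullary.Decidable using (Dec; map′; _×-dec_)
open import Relation.Unary using (Pred; Decidable)

private variable
  a p ℓ ℓ₁ ℓ₂ : Level
  A : Set a

record Enumeration (A : Set a) : Set a where
  field
    elements : List A
    complete : ∀ x → x ∈ elements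
    unique   : Unique elements

  -- Subsets are decidable predicates, so that they have a cardinality constructively.
  ∣_∣ : {P : Pred A p} → Decidable P → ℕ
  ∣ P? ∣ = length (filter P? elements)

  ∃? : {P : Pred A p} → Decidable P → Dec (∃ P)
  ∃? P? = map′ (λ h → let x , _ , px = find h in x , px)
               (λ (x , px) → lose (complete x) px)
               (any? P? elements)

enumVec : Enumeration A → ∀ n → Enumeration (Vec A n)
enumVec {A = A} en n = record
  { elements = vecs n ; complete = vecs-complete ; unique = vecs-unique n }
  where
  open Enumeration en

  vecs : ∀ n → List (Vec A n)
  vecs zero    = [] ∷ []
  vecs (suc n) = cartesianProductWith _∷_ elements (vecs n)

  vecs-complete : ∀ {n} (v : Vec A n) → v ∈ vecs n
  vecs-complete []      = here refl
  vecs-complete (x ∷ v) = ∈-cartesianProductWith⁺ _∷_ (complete x) (vecs-complete v)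

  vecs-unique : ∀ n → Unique (vecs n)
  vecs-unique zero    = [] ∷ []
  vecs-unique (suc n) = cartesianProductWith⁺ _∷_ ∷-injective unique (vecs-unique n)

-- A field with exactly q elements. Propositional equality loses no generality:
-- a finite field has decidable equality, so it can be carried by Fin q.
record FiniteField (a : Level) (q : ℕ) : Set (lsuc a) where
  infixl 7 _*_
  infixl 6 _+_
  infix  8 -_
  field
    Carrier           : Set a
    _+_ _*_           : Op₂ Carrier
    -_                : Op₁ Carrier
    0# 1#             : Carrier
    isCommutativeRing : IsCommutativeRing _≡_ _+_ _*_ -_ 0# 1#
    0≢1               : 0# ≢ 1#
    inverse           : ∀ x → x ≢ 0# → ∃ λ y → x * y ≡ 1#
    enumeration       : Fin q ↔ Carrier

  q-nonZero : NonZero q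
  q-nonZero = nonZeroIndex (Inverse.from enumeration 0#)

  _≟_ : DecidableEquality Carrier
  _≟_ = inj⇒≟ (Inverse⇒Injection (↔-sym enumeration))

  scalars : Enumeration Carrier
  scalars = record
    { elements = tabulate to
    ; complete = λ x → subst (_∈ tabulate to) (strictlyInverseˡ x) (∈-tabulate⁺ (from x))
    ; unique   = tabulate⁺ λ {i} {j} eq →
        trans (sym (strictlyInverseʳ i)) (trans (cong from eq) (strictlyInverseʳ j))
    }
    where open Inverse enumeration

  points : ∀ d → Enumeration (Vec Carrier d)
  points = enumVec scalars

module DistanceSets {a : Level} {q : ℕ} (𝔽 : FiniteField a q) where
  open FiniteField 𝔽

  infixl 6 _-_

  Space : ℕ → Set a
  Space d = Vec Carrier d

  _-_ : ∀ {d} → Op₂ (Space d)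
  _-_ = Vec.zipWith λ s t → s + (- t)

  ‖_‖ : ∀ {d} → Space d → Carrier
  ‖ m ‖ = Vec.foldr′ _+_ 0# (Vec.map (λ s → s * s) m)

  Δ : ∀ {d} → Pred (Space d) ℓ₁ → Pred (Space d) ℓ₂ →
      Pred Carrier (a ⊔ ℓ₁ ⊔ ℓ₂)
  Δ E F t = ∃ λ x → ∃ λ y → E x × F y × t ≡ ‖ x - y ‖

  Δ? : ∀ {d} {E : Pred (Space d) ℓ₁} {F : Pred (Space d) ℓ₂} →
       Decidable E → Decidable F → Decidable (Δ E F)
  Δ? {d = d} E? F? t =
    ∃? λ x → ∃? λ y → E? x ×-dec F? y ×-dec (t ≟ ‖ x - y ‖)
    where open Enumeration (points d)

  #pts : ∀ {d} {E : Pred (Space d) ℓ} → Decidable E → ℕ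
  #pts {d = d} = Enumeration.∣_∣ (points d)

  #Δ : ∀ {d} {E : Pred (Space d) ℓ₁} {F : Pred (Space d) ℓ₂} →
       Decidable E → Decidable F → ℕ
  #Δ E? F? = Enumeration.∣_∣ scalars (Δ? E? F?)

  _/[_·q^_] : ℕ → (c : ℕ) → ℕ → .{{NonZero c}} → ℚ
  _/[_·q^_] n c k {{c≢0}} =
    ℚ._/_ (+ n) (c ℕ.* q ℕ.^ k) {{m*n≢0 c (q ℕ.^ k) {{c≢0}} {{m^n≢0 q k {{q-nonZero}}}}}}

{-# OPTIONS --safe #-}
module Submission where

-- Write ν(t) for the number of pairs (x , y) ∈ E × F with ‖x - y‖ = t. By Cauchy–Schwarz
-- |E|²|F|² ≤ |Δ(E,F)| ∑ ν², so it suffices to bound V = q ∑ ν² - |E|²|F|² from above; with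
-- c = q ν - |E||F| one has ∑ c = 0, V = ∑ c ν and ∑ c² = q V.
--
-- For large E, view ∑ ν² as the number of incidences ‖x - y‖ - ‖x′ - y′‖ = 0 between the
-- pairs (x , x′) and (y , y′). Differences of squared distances to y are affine in y, so the
-- events attached to distinct pairs are independent and a second-moment argument gives
-- V ≤ q^(d+1) |E||F|.
--
-- For small and medium E, V = ∑_{y ∈ F} ∑_{x ∈ E} c ‖x - y‖, so V² is at most |F| times the sum
-- over x , x′ ∈ E of the correlations ∑_y c ‖x - y‖ c ‖x′ - y‖. For d = 2m + 1 the form ‖_‖ is
-- isometric to u · v ± t² with u , v ∈ 𝔽^m. Since ∑ c = 0, for x ≠ x′ everything cancels except a
-- contribution of a plane, which reduces to the number of representations by a binary form
-- κ s² - τ l²; this number is constant off 0 and deviates by ± q at 0. The correlation is thus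
-- at most 2 q^m ∑ c² for x ≠ x′, and trivially at most 2 q^(2m) ∑ c² for x = x′.

-- The customary tools for such sums are additive characters and Gauss sums. Integer counting does
-- both of their jobs here: subtracting the mean replaces removing the trivial character, and exact
-- representation counts of binary forms replace Gauss sums. The factor q in c keeps every quantity
-- integral.
--
-- Since ∑ c² = q V, a bound M ∑ c² for the sum of correlations over x , x′ ∈ E yields V² ≤ |F| M q
-- V, and a factor V cancels. Here M = 2 q^(2m) |E| + 2 q^m |E|², the first summand coming from x =
-- x′. The summands balance at |E| = q^m, the border of the first two regimes. The bound for large E
-- corresponds to M = q^d |E|, which has the order of 2 q^m |E|² at |E| = q^(m+1), the border of the
-- last two.
--
-- The minimum with q/2 arises because the mean term |E|²|F|² can be absorbed only while 2 |Δ(E,F)|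
-- ≤ q. This absorption costs a factor 2. The constant 8 has two further factors 2: squaring is
-- two-to-one, and M has two summands. The regime of large E pays only the first.

open import Algebra.Bundles using (CommutativeRing)
import Algebra.Properties.AbelianGroup as AbelianGroupProperties
import Algebra.Properties.Ring as RingProperties
import Algebra.Properties.Semiring.Mult.TCOptimised as Multiples
import Algebra.Solver.Ring as RingSolver
open import Algebra.Solver.Ring.AlmostCommutativeRing using (fromCommutativeRing; _-Raw-AlmostCommutative⟶_)
import Data.Integer as ℤ
import Data.Integer.Properties as ℤₚ
import Data.Maybe as Maybe
open import Data.Nat as ℕ using (ℕ; zero; suc)
open import Relation.Nullary.Decidable using (dec⇒maybe)
open import Relation.Binary.PropositionalEquality using (cong)

-- Over an abstract ring the solver's own coefficients do not compute, so terms cancel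
-- only if the coefficients are integers.
module IntegerRingSolver {c ℓ} (R : CommutativeRing c ℓ) where

  open CommutativeRing R renaming (zero to *-zero)
  open AbelianGroupProperties +-abelianGroup using (⁻¹-∙-comm; ⁻¹-involutive; ε⁻¹≈ε)
  open RingProperties ring using (-‿distribˡ-*)
  open Multiples semiring using (_×_; 1+×; ×-homo-+)
  open import Relation.Binary.Reasoning.Setoid setoid

  private
    ⟦_⟧ : ℤ.ℤ → Carrier
    ⟦ ℤ.+ n ⟧      = n × 1#
    ⟦ ℤ.-[1+ n ] ⟧ = - (suc n × 1#)

    x-0≈x : ∀ x → x - 0# ≈ x
    x-0≈x x = trans (+-congˡ ε⁻¹≈ε) (+-identityʳ x)

    cancel-one : ∀ x y → (1# + x) - (1# + y) ≈ x - y
    cancel-one x y = begin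
      (1# + x) - (1# + y)         ≈⟨ +-cong (+-comm 1# x) (sym (⁻¹-∙-comm 1# y)) ⟩
      (x + 1#) + (- 1# + - y)     ≈⟨ +-assoc x 1# _ ⟩
      x + (1# + (- 1# + - y))     ≈⟨ +-congˡ (sym (+-assoc 1# (- 1#) (- y))) ⟩
      x + ((1# + - 1#) + - y)     ≈⟨ +-congˡ (+-congʳ (-‿inverseʳ 1#)) ⟩
      x + (0# + - y)              ≈⟨ +-congˡ (+-identityˡ (- y)) ⟩
      x - y                       ∎

    ⊖-homo : ∀ m n → ⟦ m ℤ.⊖ n ⟧ ≈ m × 1# - n × 1#
    ⊖-homo zero    zero    = sym (x-0≈x 0#)
    ⊖-homo zero    (suc n) = sym (+-identityˡ _)
    ⊖-homo (suc m) zero    = sym (x-0≈x _)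
    ⊖-homo (suc m) (suc n) = begin
      ⟦ suc m ℤ.⊖ suc n ⟧               ≡⟨ cong ⟦_⟧ (ℤₚ.[1+m]⊖[1+n]≡m⊖n m n) ⟩
      ⟦ m ℤ.⊖ n ⟧                       ≈⟨ ⊖-homo m n ⟩
      m × 1# - n × 1#                   ≈⟨ sym (cancel-one _ _) ⟩
      (1# + m × 1#) - (1# + n × 1#)     ≈⟨ +-cong (sym (1+× m 1#)) (-‿cong (sym (1+× n 1#))) ⟩
      suc m × 1# - suc n × 1#           ∎

    neg-homo : ∀ i → ⟦ ℤ.- i ⟧ ≈ - ⟦ i ⟧
    neg-homo (ℤ.+ zero)    = sym ε⁻¹≈ε
    neg-homo (ℤ.+ suc n)   = refl
    neg-homo ℤ.-[1+ n ]    = sym (⁻¹-involutive _)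

    +-homo : ∀ i j → ⟦ i ℤ.+ j ⟧ ≈ ⟦ i ⟧ + ⟦ j ⟧
    +-homo (ℤ.+ m)    (ℤ.+ n)    = ×-homo-+ 1# m n
    +-homo (ℤ.+ m)    ℤ.-[1+ n ] = ⊖-homo m (suc n)
    +-homo ℤ.-[1+ m ] (ℤ.+ n)    = trans (⊖-homo n (suc m)) (+-comm _ _)
    +-homo ℤ.-[1+ m ] ℤ.-[1+ n ] = begin
      ⟦ ℤ.-[1+ m ] ℤ.+ ℤ.-[1+ n ] ⟧            ≡⟨ cong ⟦_⟧ (ℤₚ.neg-distrib-+ (ℤ.+ suc m) (ℤ.+ suc n)) ⟨
      ⟦ ℤ.- (ℤ.+ suc m ℤ.+ ℤ.+ suc n) ⟧        ≈⟨ neg-homo (ℤ.+ suc m ℤ.+ ℤ.+ suc n) ⟩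
      - ⟦ ℤ.+ suc m ℤ.+ ℤ.+ suc n ⟧            ≈⟨ -‿cong (×-homo-+ 1# (suc m) (suc n)) ⟩
      - (suc m × 1# + suc n × 1#)              ≈⟨ ⁻¹-∙-comm _ _ ⟨
      - (suc m × 1#) + - (suc n × 1#)          ∎

    *-homo⁺ : ∀ m j → ⟦ ℤ.+ m ℤ.* j ⟧ ≈ m × 1# * ⟦ j ⟧
    *-homo⁺ zero    j = sym (zeroˡ ⟦ j ⟧)
    *-homo⁺ (suc m) j = begin
      ⟦ ℤ.+ suc m ℤ.* j ⟧              ≡⟨ cong ⟦_⟧ (ℤₚ.suc-* (ℤ.+ m) j) ⟩
      ⟦ j ℤ.+ ℤ.+ m ℤ.* j ⟧            ≈⟨ +-homo j (ℤ.+ m ℤ.* j) ⟩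
      ⟦ j ⟧ + ⟦ ℤ.+ m ℤ.* j ⟧          ≈⟨ +-cong (sym (*-identityˡ ⟦ j ⟧)) (*-homo⁺ m j) ⟩
      1# * ⟦ j ⟧ + m × 1# * ⟦ j ⟧      ≈⟨ distribʳ ⟦ j ⟧ 1# (m × 1#) ⟨
      (1# + m × 1#) * ⟦ j ⟧            ≈⟨ *-congʳ (1+× m 1#) ⟨
      suc m × 1# * ⟦ j ⟧               ∎

    *-homo : ∀ i j → ⟦ i ℤ.* j ⟧ ≈ ⟦ i ⟧ * ⟦ j ⟧
    *-homo (ℤ.+ m)    j = *-homo⁺ m j
    *-homo ℤ.-[1+ m ] j = begin
      ⟦ ℤ.-[1+ m ] ℤ.* j ⟧             ≡⟨ cong ⟦_⟧ (ℤₚ.neg-distribˡ-* (ℤ.+ suc m) j) ⟨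
      ⟦ ℤ.- (ℤ.+ suc m ℤ.* j) ⟧        ≈⟨ neg-homo (ℤ.+ suc m ℤ.* j) ⟩
      - ⟦ ℤ.+ suc m ℤ.* j ⟧            ≈⟨ -‿cong (*-homo⁺ (suc m) j) ⟩
      - (suc m × 1# * ⟦ j ⟧)           ≈⟨ -‿distribˡ-* (suc m × 1#) ⟦ j ⟧ ⟩
      - (suc m × 1#) * ⟦ j ⟧           ∎

    morphism : ℤ.+-*-rawRing -Raw-AlmostCommutative⟶ fromCommutativeRing R
    morphism = record
      { ⟦_⟧ = ⟦_⟧ ; +-homo = +-homo ; *-homo = *-homo ; -‿homo = neg-homo ; 0-homo = refl ; 1-homo = refl }

  open RingSolver ℤ.+-*-rawRing (fromCommutativeRing R) morphism
    (λ i j → Maybe.map (λ eq → reflexive (cong ⟦_⟧ eq)) (dec⇒maybe (i ℤ.≟ j))) public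
    using (solve; _:=_; _:+_; _:*_; :-_; _:-_; con)

open import Defs
open import Data.Empty using (⊥-elim)
open import Data.Fin using (toℕ)
import Data.Fin.Properties as Finₚ
import Data.Nat.Properties as ℕₚ
open import Data.Nat.Divisibility using (_∣_; divides; ∣1⇒≡1)
open import Data.Product using (∃; ∃₂; _×_; _,_; proj₁; proj₂)
open import Data.Product.Properties using () renaming (≡-dec to ×-≡-dec)
open import Data.Sum using (_⊎_; inj₁; inj₂; map₂)
open import Data.Vec using (Vec; []; _∷_)
open import Function using (_∘_)
open import Function.Bundles using (Inverse; mk⇔)
open import Level using (Level)
open import Relation.Binary.Definitions using (DecidableEquality; tri<; tri≈; tri>)
open import Relation.Binary.PropositionalEquality using (_≡_; _≢_; refl; sym; trans; cong₂; subst; subst₂; module ≡-Reasoning)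
open import Relation.Nullary using (¬_; Dec; yes; no)
open import Relation.Unary using (Pred; Decidable; Satisfiable)

-- Integer-valued sums over finite enumerated types

module FiniteSums where

  open import Data.Integer using (ℤ; -[1+_]; 0ℤ; 1ℤ; +≤+; _+_; _*_; _-_; -_; _≤_) renaming (+_ to pos)
  open import Data.Integer.Tactic.RingSolver using (solve-∀)
  open import Data.List using (List; []; _∷_; length; filter; map; _++_; cartesianProductWith; cartesianProduct)
  open import Data.List.Membership.Propositional using (_∈_)
  open import Data.List.Membership.Propositional.Properties using (∈-map⁺; ∈-cartesianProduct⁺)
  open import Data.List.Membership.Propositional.Properties.WithK using (unique∧set⇒bag)
  open import Data.List.Relation.Binary.BagAndSetEquality using (∼bag⇒↭)
  open import Data.List.Relation.Binary.Permutation.Propositional as Perm using (_↭_)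
  open import Data.List.Relation.Unary.All as All using (All)
  open import Data.List.Relation.Unary.AllPairs using (_∷_)
  open import Data.List.Relation.Unary.Any using (here; there)
  open import Data.List.Relation.Unary.Unique.Propositional using (Unique)
  open import Data.List.Relation.Unary.Unique.Propositional.Properties using (map⁺; cartesianProduct⁺)

  private variable
    a b p : Level
    A : Set a
    B : Set b

  0≤i*i : ∀ i → 0ℤ ≤ i * i
  0≤i*i (pos n) = subst (0ℤ ≤_) (ℤₚ.pos-* n n) (+≤+ ℕ.z≤n)
  0≤i*i -[1+ n ] = +≤+ ℕ.z≤n

  *-monoˡ-0≤ : ∀ {i j} k → 0ℤ ≤ k → i ≤ j → k * i ≤ k * j
  *-monoˡ-0≤ (pos n) _ = ℤₚ.*-monoˡ-≤-nonNeg (pos n)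

  *-monoʳ-0≤ : ∀ {i j} k → 0ℤ ≤ k → i ≤ j → i * k ≤ j * k
  *-monoʳ-0≤ (pos n) _ = ℤₚ.*-monoʳ-≤-nonNeg (pos n)

  0≤i*j : ∀ {i j} → 0ℤ ≤ i → 0ℤ ≤ j → 0ℤ ≤ i * j
  0≤i*j {i} {j} 0≤i 0≤j = subst (_≤ i * j) (ℤₚ.*-zeroʳ i) (*-monoˡ-0≤ i 0≤i 0≤j)

  ∑ˡ : List A → (A → ℤ) → ℤ
  ∑ˡ []       f = 0ℤ
  ∑ˡ (x ∷ xs) f = f x + ∑ˡ xs f

  ∑ˡ-cong : ∀ (xs : List A) {f g : A → ℤ} → (∀ x → f x ≡ g x) → ∑ˡ xs f ≡ ∑ˡ xs g
  ∑ˡ-cong []       f≗g = refl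
  ∑ˡ-cong (x ∷ xs) f≗g = cong₂ _+_ (f≗g x) (∑ˡ-cong xs f≗g)

  ∑ˡ-mono : ∀ (xs : List A) {f g : A → ℤ} → (∀ x → f x ≤ g x) → ∑ˡ xs f ≤ ∑ˡ xs g
  ∑ˡ-mono []       f≤g = ℤₚ.≤-refl
  ∑ˡ-mono (x ∷ xs) f≤g = ℤₚ.+-mono-≤ (f≤g x) (∑ˡ-mono xs f≤g)

  ∑ˡ-+ : ∀ (xs : List A) (f g : A → ℤ) → ∑ˡ xs (λ x → f x + g x) ≡ ∑ˡ xs f + ∑ˡ xs g
  ∑ˡ-+ []       f g = refl
  ∑ˡ-+ (x ∷ xs) f g = trans (cong (λ s → f x + g x + s) (∑ˡ-+ xs f g)) (shuffle (f x) (g x) _ _)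
    where
    shuffle : ∀ i j k l → i + j + (k + l) ≡ i + k + (j + l)
    shuffle = solve-∀

  ∑ˡ-*ˡ : ∀ (xs : List A) k (f : A → ℤ) → ∑ˡ xs (λ x → k * f x) ≡ k * ∑ˡ xs f
  ∑ˡ-*ˡ []       k f = sym (ℤₚ.*-zeroʳ k)
  ∑ˡ-*ˡ (x ∷ xs) k f = trans (cong ((k * f x) +_) (∑ˡ-*ˡ xs k f)) (sym (ℤₚ.*-distribˡ-+ k _ _))

  ∑ˡ-zero : ∀ (xs : List A) → ∑ˡ xs (λ _ → 0ℤ) ≡ 0ℤ
  ∑ˡ-zero []       = refl
  ∑ˡ-zero (x ∷ xs) = trans (ℤₚ.+-identityˡ _) (∑ˡ-zero xs)

  ∑ˡ-swap : ∀ (xs : List A) (ys : List B) (f : A → B → ℤ) →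
            ∑ˡ xs (λ x → ∑ˡ ys (f x)) ≡ ∑ˡ ys (λ y → ∑ˡ xs (λ x → f x y))
  ∑ˡ-swap []       ys f = sym (∑ˡ-zero ys)
  ∑ˡ-swap (x ∷ xs) ys f = trans (cong (∑ˡ ys (f x) +_) (∑ˡ-swap xs ys f)) (sym (∑ˡ-+ ys (f x) _))

  ∑ˡ-++ : ∀ (xs ys : List A) (f : A → ℤ) → ∑ˡ (xs ++ ys) f ≡ ∑ˡ xs f + ∑ˡ ys f
  ∑ˡ-++ []       ys f = sym (ℤₚ.+-identityˡ _)
  ∑ˡ-++ (x ∷ xs) ys f = trans (cong (f x +_) (∑ˡ-++ xs ys f)) (sym (ℤₚ.+-assoc (f x) _ _))

  ∑ˡ-map : ∀ (g : A → B) (xs : List A) (f : B → ℤ) → ∑ˡ (map g xs) f ≡ ∑ˡ xs (f ∘ g)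
  ∑ˡ-map g []       f = refl
  ∑ˡ-map g (x ∷ xs) f = cong (f (g x) +_) (∑ˡ-map g xs f)

  ∑ˡ-cartesianProductWith : ∀ {c} {C : Set c} (g : A → B → C) (xs : List A) (ys : List B) (f : C → ℤ) →
    ∑ˡ (cartesianProductWith g xs ys) f ≡ ∑ˡ xs (λ x → ∑ˡ ys (λ y → f (g x y)))
  ∑ˡ-cartesianProductWith g []       ys f = refl
  ∑ˡ-cartesianProductWith g (x ∷ xs) ys f =
    trans (∑ˡ-++ (map (g x) ys) _ f)
          (cong₂ _+_ (∑ˡ-map (g x) ys f) (∑ˡ-cartesianProductWith g xs ys f))

  ∑ˡ-↭ : ∀ {xs ys : List A} (f : A → ℤ) → xs ↭ ys → ∑ˡ xs f ≡ ∑ˡ ys f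
  ∑ˡ-↭ f Perm.refl         = refl
  ∑ˡ-↭ f (Perm.prep x p)   = cong (f x +_) (∑ˡ-↭ f p)
  ∑ˡ-↭ f (Perm.swap x y p) = trans (cong (λ s → f x + (f y + s)) (∑ˡ-↭ f p)) (left-comm (f x) (f y) _)
    where
    left-comm : ∀ i j k → i + (j + k) ≡ j + (i + k)
    left-comm = solve-∀
  ∑ˡ-↭ f (Perm.trans p r)  = trans (∑ˡ-↭ f p) (∑ˡ-↭ f r)

  𝟙 : {P : Set p} → Dec P → ℤ
  𝟙 (yes _) = 1ℤ
  𝟙 (no  _) = 0ℤ

  𝟙-yes : {P : Set p} (P? : Dec P) → P → 𝟙 P? ≡ 1ℤ
  𝟙-yes (yes _) _  = refl
  𝟙-yes (no ¬p) pp = ⊥-elim (¬p pp)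

  𝟙-no : {P : Set p} (P? : Dec P) → ¬ P → 𝟙 P? ≡ 0ℤ
  𝟙-no (yes pp) ¬p = ⊥-elim (¬p pp)
  𝟙-no (no _)   _  = refl

  0≤𝟙 : {P : Set p} (P? : Dec P) → 0ℤ ≤ 𝟙 P?
  0≤𝟙 (yes _) = +≤+ ℕ.z≤n
  0≤𝟙 (no _)  = +≤+ ℕ.z≤n

  𝟙-idem : {P : Set p} (P? : Dec P) → 𝟙 P? * 𝟙 P? ≡ 𝟙 P?
  𝟙-idem (yes _) = refl
  𝟙-idem (no _)  = refl

  𝟙-cong : ∀ {p′} {P : Set p} {Q : Set p′} (P? : Dec P) (Q? : Dec Q) → (P → Q) → (Q → P) → 𝟙 P? ≡ 𝟙 Q?
  𝟙-cong (yes pp) Q? to from = sym (𝟙-yes Q? (to pp))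
  𝟙-cong (no ¬p)  Q? to from = sym (𝟙-no Q? (¬p ∘ from))

  ∑ˡ-𝟙 : ∀ {P : Pred A p} (P? : Decidable P) xs → ∑ˡ xs (λ x → 𝟙 (P? x)) ≡ pos (length (filter P? xs))
  ∑ˡ-𝟙 P? []       = refl
  ∑ˡ-𝟙 P? (x ∷ xs) with P? x
  ... | yes _ = cong (1ℤ +_) (∑ˡ-𝟙 P? xs)
  ... | no  _ = trans (ℤₚ.+-identityˡ _) (∑ˡ-𝟙 P? xs)

  ∑ : Enumeration A → (A → ℤ) → ℤ
  ∑ en = ∑ˡ (Enumeration.elements en)

  size : Enumeration A → ℤ
  size en = ∑ en (λ _ → 1ℤ)

  _×ₑ_ : Enumeration A → Enumeration B → Enumeration (A × B)
  S ×ₑ T = record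
    { elements = cartesianProduct (elements S) (elements T)
    ; complete = λ (x , y) → ∈-cartesianProduct⁺ (complete S x) (complete T y)
    ; unique   = cartesianProduct⁺ (unique S) (unique T)
    }
    where open Enumeration

  module _ (S : Enumeration A) where
    open Enumeration S

    ∑-cong : {f g : A → ℤ} → (∀ x → f x ≡ g x) → ∑ S f ≡ ∑ S g
    ∑-cong = ∑ˡ-cong elements

    ∑-mono : {f g : A → ℤ} → (∀ x → f x ≤ g x) → ∑ S f ≤ ∑ S g
    ∑-mono = ∑ˡ-mono elements

    ∑-+ : (f g : A → ℤ) → ∑ S (λ x → f x + g x) ≡ ∑ S f + ∑ S g
    ∑-+ = ∑ˡ-+ elements

    ∑-*ˡ : ∀ k (f : A → ℤ) → ∑ S (λ x → k * f x) ≡ k * ∑ S f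
    ∑-*ˡ = ∑ˡ-*ˡ elements

    ∑-*ʳ : ∀ k (f : A → ℤ) → ∑ S (λ x → f x * k) ≡ ∑ S f * k
    ∑-*ʳ k f = trans (∑-cong λ x → ℤₚ.*-comm (f x) k) (trans (∑-*ˡ k f) (ℤₚ.*-comm k _))

    ∑-lin₂ : ∀ i (f : A → ℤ) j (g : A → ℤ) → ∑ S (λ x → i * f x + j * g x) ≡ i * ∑ S f + j * ∑ S g
    ∑-lin₂ i f j g = trans (∑-+ (λ x → i * f x) (λ x → j * g x)) (cong₂ _+_ (∑-*ˡ i f) (∑-*ˡ j g))

    ∑-lin₃ : ∀ i (f : A → ℤ) j (g : A → ℤ) k (h : A → ℤ) →
             ∑ S (λ x → i * f x + j * g x + k * h x) ≡ i * ∑ S f + j * ∑ S g + k * ∑ S h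
    ∑-lin₃ i f j g k h = trans (∑-+ (λ x → i * f x + j * g x) (λ x → k * h x))
                               (cong₂ _+_ (∑-lin₂ i f j g) (∑-*ˡ k h))

    ∑-const : ∀ k → ∑ S (λ _ → k) ≡ size S * k
    ∑-const k = trans (∑-cong λ _ → sym (ℤₚ.*-identityˡ k)) (∑-*ʳ k _)

    ∑-zero : {f : A → ℤ} → (∀ x → f x ≡ 0ℤ) → ∑ S f ≡ 0ℤ
    ∑-zero f≗0 = trans (∑-cong f≗0) (∑ˡ-zero elements)

    ∑-nonneg : {f : A → ℤ} → (∀ x → 0ℤ ≤ f x) → 0ℤ ≤ ∑ S f
    ∑-nonneg {f} 0≤f = subst (_≤ ∑ S f) (∑ˡ-zero elements) (∑-mono 0≤f)

    ∑-swap : (T : Enumeration B) (f : A → B → ℤ) → ∑ S (λ x → ∑ T (f x)) ≡ ∑ T (λ y → ∑ S (λ x → f x y))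
    ∑-swap T = ∑ˡ-swap elements (Enumeration.elements T)

    ∑-×ₑ : (T : Enumeration B) (f : A × B → ℤ) → ∑ (S ×ₑ T) f ≡ ∑ S (λ x → ∑ T (λ y → f (x , y)))
    ∑-×ₑ T = ∑ˡ-cartesianProductWith _,_ elements (Enumeration.elements T)

    ∑-𝟙 : {P : Pred A p} (P? : Decidable P) → ∑ S (λ x → 𝟙 (P? x)) ≡ pos (∣_∣ P?)
    ∑-𝟙 P? = ∑ˡ-𝟙 P? elements

    ∑-enumVec : ∀ n (f : Vec A (suc n) → ℤ) → ∑ (enumVec S (suc n)) f ≡ ∑ S (λ x → ∑ (enumVec S n) (λ v → f (x ∷ v)))
    ∑-enumVec n = ∑ˡ-cartesianProductWith _∷_ elements (Enumeration.elements (enumVec S n))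

    -- Duplicate-free lists with the same members are permutations of each other, so the image of
    -- one enumeration under a bijection can replace the other. The substitutions below rest on
    -- this.
    ∑-reindex : (T : Enumeration B) (to : A → B) (from : B → A) →
                (∀ x → from (to x) ≡ x) → (∀ y → to (from y) ≡ y) →
                (f : B → ℤ) → ∑ S (f ∘ to) ≡ ∑ T f
    ∑-reindex T to from from∘to to∘from f = trans (sym (∑ˡ-map to elements f)) (∑ˡ-↭ f perm)
      where
      injective : ∀ {x y} → to x ≡ to y → x ≡ y
      injective {x} {y} eq = trans (sym (from∘to x)) (trans (cong from eq) (from∘to y))
      perm : map to elements ↭ Enumeration.elements T
      perm = ∼bag⇒↭ (unique∧set⇒bag (map⁺ injective unique) (Enumeration.unique T)
        (λ {y} → mk⇔ (λ _ → Enumeration.complete T y)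
          (λ _ → subst (_∈ map to elements) (to∘from y) (∈-map⁺ to (complete (from y))))))

    ∑-square : (f : A → ℤ) → ∑ S f * ∑ S f ≡ ∑ S (λ x → ∑ S (λ y → f x * f y))
    ∑-square f = sym (trans (∑-cong λ x → ∑-*ˡ (f x) f) (∑-*ʳ (∑ S f) f))

    module _ (_≟_ : DecidableEquality A) where

      ∑-δ : ∀ x (f : A → ℤ) → ∑ S (λ y → 𝟙 (x ≟ y) * f y) ≡ f x
      ∑-δ x f = go elements unique (complete x)
        where
        absent : ∀ ys → All (x ≢_) ys → ∑ˡ ys (λ y → 𝟙 (x ≟ y) * f y) ≡ 0ℤ
        absent []       _           = refl
        absent (y ∷ ys) (x≢y All.∷ r) =
          cong₂ _+_ (cong (_* f y) (𝟙-no (x ≟ y) x≢y)) (absent ys r)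
        go : ∀ ys → Unique ys → x ∈ ys → ∑ˡ ys (λ y → 𝟙 (x ≟ y) * f y) ≡ f x
        go (y ∷ ys) (y∉ ∷ u) (here refl) = trans
          (cong₂ _+_ (cong (_* f y) (𝟙-yes (y ≟ y) refl)) (absent ys y∉))
          (trans (ℤₚ.+-identityʳ _) (ℤₚ.*-identityˡ _))
        go (y ∷ ys) (y∉ ∷ u) (there x∈ys) = trans
          (cong₂ _+_ (cong (_* f y) (𝟙-no (x ≟ y) λ x≡y → All.lookup y∉ x∈ys (sym x≡y))) (go ys u x∈ys))
          (ℤₚ.+-identityˡ _)

      ∑-δ1 : ∀ x → ∑ S (λ y → 𝟙 (x ≟ y)) ≡ 1ℤ
      ∑-δ1 x = trans (∑-cong λ y → sym (ℤₚ.*-identityʳ _)) (∑-δ x (λ _ → 1ℤ))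

      ∑-split : ∀ x (f : A → ℤ) → (∀ y → x ≢ y → f y ≡ 0ℤ) → ∑ S f ≡ f x
      ∑-split x f f≡0 = trans (∑-cong pointwise) (∑-δ x f)
        where
        pointwise : ∀ y → f y ≡ 𝟙 (x ≟ y) * f y
        pointwise y with x ≟ y
        ... | yes _   = sym (ℤₚ.*-identityˡ _)
        ... | no x≢y  = f≡0 y x≢y

      -- For summands that follow a generic formula except at one point, usually zero: the point
      -- enters as a discrepancy, so the generic formula can be summed over everything.
      ∑-exceptional : ∀ x (f g : A → ℤ) → (∀ y → x ≢ y → f y ≡ g y) → ∑ S f ≡ ∑ S g + (f x - g x)
      ∑-exceptional x f g f≡g = begin
        ∑ S f                                     ≡⟨ ∑-cong (λ y → add-sub (f y) (g y)) ⟩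
        ∑ S (λ y → g y + (f y - g y))             ≡⟨ ∑-+ g (λ y → f y - g y) ⟩
        ∑ S g + ∑ S (λ y → f y - g y)             ≡⟨ cong (∑ S g +_) (∑-split x (λ y → f y - g y)
                                                       λ y x≢y → trans (cong (_- g y) (f≡g y x≢y)) (ℤₚ.+-inverseʳ (g y))) ⟩
        ∑ S g + (f x - g x)                       ∎
        where
        open ≡-Reasoning
        add-sub : ∀ i j → i ≡ j + (i - j)
        add-sub = solve-∀

    ∑-swap-inner : ∀ {b c} {B : Set b} {C : Set c} (T : Enumeration B) (U : Enumeration C) (f : A → B → C → ℤ) →
      ∑ S (λ x → ∑ T (λ y → ∑ U (f x y))) ≡ ∑ U (λ z → ∑ S (λ x → ∑ T (λ y → f x y z)))
    ∑-swap-inner T U f = trans (∑-cong λ x → ∑ˡ-swap (Enumeration.elements T) (Enumeration.elements U) (f x))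
      (∑-swap U (λ x z → ∑ T (λ y → f x y z)))

    -- Lagrange's identity: twice the defect is the sum of the squares (f x g y - f y g x)².
    cauchy-schwarz : (f g : A → ℤ) →
      ∑ S (λ x → f x * g x) * ∑ S (λ x → f x * g x) ≤
      ∑ S (λ x → f x * f x) * ∑ S (λ x → g x * g x)
    cauchy-schwarz f g = ℤₚ.*-cancelˡ-≤-pos _ _ (pos 2) (ℤₚ.0≤i-j⇒j≤i (subst (0ℤ ≤_) expand nonneg))
      where
      ff gg fg : ℤ
      ff = ∑ S (λ x → f x * f x)
      gg = ∑ S (λ x → g x * g x)
      fg = ∑ S (λ x → f x * g x)
      lagrange : A → A → ℤ
      lagrange x y = (f x * g y - f y * g x) * (f x * g y - f y * g x)
      nonneg : 0ℤ ≤ ∑ S (λ x → ∑ S (lagrange x))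
      nonneg = ∑-nonneg λ x → ∑-nonneg λ y → 0≤i*i (f x * g y - f y * g x)
      expand₁ : ∀ i j k l → (i * l - k * j) * (i * l - k * j) ≡
                i * i * (l * l) + j * j * (k * k) + - pos 2 * (i * j) * (k * l)
      expand₁ = solve-∀
      inner : ∀ x → ∑ S (lagrange x) ≡ gg * (f x * f x) + ff * (g x * g x) + - pos 2 * fg * (f x * g x)
      inner x = trans (∑-cong λ y → expand₁ (f x) (g x) (f y) (g y))
        (trans (∑-lin₃ (f x * f x) (λ y → g y * g y) (g x * g x) (λ y → f y * f y)
                       (- pos 2 * (f x * g x)) (λ y → f y * g y))
               (reorder (f x) (g x) ff gg fg))
        where
        reorder : ∀ i j k l m → i * i * l + j * j * k + - pos 2 * (i * j) * m ≡
                  l * (i * i) + k * (j * j) + - pos 2 * m * (i * j)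
        reorder = solve-∀
      collect : ∀ i j k → j * i + i * j + - pos 2 * k * k ≡ pos 2 * (i * j) - pos 2 * (k * k)
      collect = solve-∀
      expand : ∑ S (λ x → ∑ S (lagrange x)) ≡ pos 2 * (ff * gg) - pos 2 * (fg * fg)
      expand = trans (∑-cong inner) (trans
        (∑-lin₃ gg (λ x → f x * f x) ff (λ x → g x * g x) (- pos 2 * fg) (λ x → f x * g x))
        (collect ff gg fg))

    -- The gaps g - f are nonnegative and each is at most their total, which is zero. This turns one
    -- global count into exact fibre sizes.
    pointwise-≤⇒≡ : DecidableEquality A → (f g : A → ℤ) → (∀ x → f x ≤ g x) → ∑ S f ≡ ∑ S g → ∀ x → f x ≡ g x
    pointwise-≤⇒≡ _≟_ f g f≤g ∑f≡∑g x = ℤₚ.≤-antisym (f≤g x) (ℤₚ.i-j≤0⇒i≤j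
      (subst₂ _≤_ (∑-δ _≟_ x gap) ∑gap≡0 (∑-mono {λ y → 𝟙 (x ≟ y) * gap y} {gap} below)))
      where
      gap : A → ℤ
      gap y = g y - f y
      below : ∀ y → 𝟙 (x ≟ y) * gap y ≤ gap y
      below y with x ≟ y
      ... | yes _ = ℤₚ.≤-reflexive (ℤₚ.*-identityˡ (gap y))
      ... | no  _ = ℤₚ.i≤j⇒0≤j-i (f≤g y)
      minus : ∀ i j → i - j ≡ 1ℤ * i + - 1ℤ * j
      minus = solve-∀
      ∑gap≡0 : ∑ S gap ≡ 0ℤ
      ∑gap≡0 = trans (∑-cong λ y → minus (g y) (f y)) (trans (∑-lin₂ 1ℤ g (- 1ℤ) f)
        (trans (sym (minus (∑ S g) (∑ S f))) (trans (cong (λ s → ∑ S g - s) ∑f≡∑g) (ℤₚ.+-inverseʳ (∑ S g)))))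

  module _ (S : Enumeration A) (T : Enumeration B) (_≟_ : DecidableEquality B) where

    -- Groups the terms by the value of φ. With distances as φ it passes between pairs of points and
    -- ν; with h itself a fibre count it turns a sum of squares into a count of coincidences.
    ∑-weighted-fibres : (w : A → ℤ) (φ : A → B) (h : B → ℤ) →
      ∑ S (λ x → w x * h (φ x)) ≡ ∑ T (λ t → ∑ S (λ x → w x * 𝟙 (φ x ≟ t)) * h t)
    ∑-weighted-fibres w φ h = begin
      ∑ S (λ x → w x * h (φ x))                              ≡⟨ ∑-cong S (λ x → cong (w x *_) (sym (∑-δ T _≟_ (φ x) h))) ⟩
      ∑ S (λ x → w x * ∑ T (λ t → 𝟙 (φ x ≟ t) * h t))        ≡⟨ ∑-cong S (λ x → sym (∑-*ˡ T (w x) (λ t → 𝟙 (φ x ≟ t) * h t))) ⟩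
      ∑ S (λ x → ∑ T (λ t → w x * (𝟙 (φ x ≟ t) * h t)))      ≡⟨ ∑-swap S T (λ x t → w x * (𝟙 (φ x ≟ t) * h t)) ⟩
      ∑ T (λ t → ∑ S (λ x → w x * (𝟙 (φ x ≟ t) * h t)))      ≡⟨ ∑-cong T (λ t → trans
                                                                  (∑-cong S λ x → sym (ℤₚ.*-assoc (w x) (𝟙 (φ x ≟ t)) (h t)))
                                                                  (∑-*ʳ S (h t) (λ x → w x * 𝟙 (φ x ≟ t)))) ⟩
      ∑ T (λ t → ∑ S (λ x → w x * 𝟙 (φ x ≟ t)) * h t)        ∎
      where open ≡-Reasoning

    ∑-fibres : (φ : A → B) (h : B → ℤ) → ∑ S (h ∘ φ) ≡ ∑ T (λ t → ∑ S (λ x → 𝟙 (φ x ≟ t)) * h t)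
    ∑-fibres φ h = trans (∑-cong S λ x → sym (ℤₚ.*-identityˡ (h (φ x)))) (trans (∑-weighted-fibres (λ _ → 1ℤ) φ h)
      (∑-cong T λ t → cong (_* h t) (∑-cong S λ x → ℤₚ.*-identityˡ (𝟙 (φ x ≟ t)))))

    ∑-fibres-≤ : ∀ k (φ : A → B) → (∀ t → ∑ S (λ x → 𝟙 (φ x ≟ t)) ≤ k) →
                 (h : B → ℤ) → (∀ t → 0ℤ ≤ h t) → ∑ S (h ∘ φ) ≤ k * ∑ T h
    ∑-fibres-≤ k φ fibre≤k h 0≤h = subst₂ _≤_ (sym (∑-fibres φ h)) (∑-*ˡ T k h)
      (∑-mono T λ t → *-monoʳ-0≤ (h t) (0≤h t) (fibre≤k t))

  size≡length : (S : Enumeration A) → size S ≡ pos (length (Enumeration.elements S))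
  size≡length S = go (Enumeration.elements S)
    where
    go : (xs : List A) → ∑ˡ xs (λ _ → 1ℤ) ≡ pos (length xs)
    go []       = refl
    go (x ∷ xs) = cong (1ℤ +_) (go xs)

  -- Resolves a bound on v² that contains v again; the case v = 0, where nothing can be cancelled,
  -- falls to 0 ≤ k.
  v*v≤k*v⇒v≤k : ∀ {k v} → 0ℤ ≤ k → 0ℤ ≤ v → v * v ≤ k * v → v ≤ k
  v*v≤k*v⇒v≤k {v = pos zero}    0≤k _ _  = 0≤k
  v*v≤k*v⇒v≤k {k} {pos (suc n)} _   _ le = ℤₚ.*-cancelʳ-≤-pos (pos (suc n)) k (pos (suc n)) le

  v*v≤k*k⇒v≤k : ∀ {k v} → 0ℤ ≤ k → v * v ≤ k * k → v ≤ k
  v*v≤k*k⇒v≤k {k} {v} 0≤k le with ℤₚ.≤-total v k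
  ... | inj₁ v≤k = v≤k
  ... | inj₂ k≤v = v*v≤k*v⇒v≤k 0≤k (ℤₚ.≤-trans 0≤k k≤v) (ℤₚ.≤-trans le (*-monoˡ-0≤ k 0≤k k≤v))

  ∑-×ₑ-* : (S : Enumeration A) (T : Enumeration B) (f : A → ℤ) (g : B → ℤ) →
    ∑ (S ×ₑ T) (λ (x , y) → f x * g y) ≡ ∑ S f * ∑ T g
  ∑-×ₑ-* S T f g = trans (∑-×ₑ S T (λ (x , y) → f x * g y))
    (trans (∑-cong S λ x → ∑-*ˡ T (f x) g) (∑-*ʳ S (∑ T g) f))

  term-≤-∑ : (S : Enumeration A) → DecidableEquality A → (f : A → ℤ) → (∀ x → 0ℤ ≤ f x) → ∀ x → f x ≤ ∑ S f
  term-≤-∑ S _≟_ f 0≤f x = subst (_≤ ∑ S f) (∑-δ S _≟_ x f) (∑-mono S below)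
    where
    below : ∀ y → 𝟙 (x ≟ y) * f y ≤ f y
    below y with x ≟ y
    ... | yes _ = ℤₚ.≤-reflexive (ℤₚ.*-identityˡ (f y))
    ... | no _  = 0≤f y

-- Sums over a finite field

module FieldSums {a : Level} {q : ℕ} (𝔽 : FiniteField a q) where

  open FiniteSums
  open import Data.Integer using (ℤ; 0ℤ; 1ℤ; +≤+; _+_; _*_; _-_; -_; _≤_) renaming (+_ to pos)
  open import Data.Integer.Tactic.RingSolver using (solve-∀)
  open import Data.List.Properties using (length-tabulate)
  open import Data.Vec using (zipWith; map; replicate)
  open import Data.Vec.Properties using (≡-dec)
  open DistanceSets 𝔽 using (Space; ‖_‖; Δ?; #Δ; #pts) renaming (_-_ to _⊟_)

  open FiniteField 𝔽 public using (scalars; 0#; 1#; 0≢1; inverse)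
    renaming (Carrier to K; _≟_ to infix 4 _≟_; _+_ to _⊕_; _*_ to _⊗_; -_ to ⊖_)

  infixl 6 _⊝_
  _⊝_ : K → K → K
  x ⊝ y = x ⊕ ⊖ y

  𝔽-ring : CommutativeRing a a
  𝔽-ring = record { isCommutativeRing = FiniteField.isCommutativeRing 𝔽 }

  open CommutativeRing 𝔽-ring public using (+-identityˡ; +-identityʳ; zeroˡ; zeroʳ; *-identityˡ; *-comm)
  open IntegerRingSolver 𝔽-ring public

  x⊝y≡0⇒x≡y : ∀ x y → x ⊝ y ≡ 0# → x ≡ y
  x⊝y≡0⇒x≡y x y eq = trans (solve 2 (λ x y → x := (x :- y) :+ y) refl x y)
                           (trans (cong (_⊕ y) eq) (+-identityˡ y))

  x≡y⇒x⊝y≡0 : ∀ {x y} → x ≡ y → x ⊝ y ≡ 0#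
  x≡y⇒x⊝y≡0 {x} refl = solve 1 (λ x → x :- x := con 0ℤ) refl x

  ⊖x≡0⇒x≡0 : ∀ x → ⊖ x ≡ 0# → x ≡ 0#
  ⊖x≡0⇒x≡0 x eq = trans (solve 1 (λ x → x := :- (:- x)) refl x)
    (trans (cong ⊖_ eq) (solve 0 (:- con 0ℤ := con 0ℤ) refl))

  integral : ∀ {x y} → x ≢ 0# → x ⊗ y ≡ 0# → y ≡ 0#
  integral {x} {y} x≢0 xy≡0 with inverse x x≢0
  ... | x⁻¹ , xx⁻¹≡1 = begin
    y                ≡⟨ *-identityˡ y ⟨
    1# ⊗ y           ≡⟨ cong (_⊗ y) xx⁻¹≡1 ⟨
    x ⊗ x⁻¹ ⊗ y      ≡⟨ solve 3 (λ x y z → x :* z :* y := z :* (x :* y)) refl x y x⁻¹ ⟩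
    x⁻¹ ⊗ (x ⊗ y)    ≡⟨ cong (x⁻¹ ⊗_) xy≡0 ⟩
    x⁻¹ ⊗ 0#         ≡⟨ zeroʳ x⁻¹ ⟩
    0#               ∎
    where open ≡-Reasoning

  ⊗≢0 : ∀ {x y} → x ≢ 0# → y ≢ 0# → x ⊗ y ≢ 0#
  ⊗≢0 x≢0 y≢0 xy≡0 = y≢0 (integral x≢0 xy≡0)

  ⊖≢0 : ∀ {x} → x ≢ 0# → ⊖ x ≢ 0#
  ⊖≢0 {x} x≢0 = x≢0 ∘ ⊖x≡0⇒x≡0 x

  1≢0 : 1# ≢ 0#
  1≢0 = 0≢1 ∘ sym

  ∑ₖ : (K → ℤ) → ℤ
  ∑ₖ = ∑ scalars

  size-scalars : size scalars ≡ pos q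
  size-scalars = trans (size≡length scalars) (cong pos (length-tabulate (Inverse.to (FiniteField.enumeration 𝔽))))

  ∑ₖ-const : ∀ i → ∑ₖ (λ _ → i) ≡ pos q * i
  ∑ₖ-const i = trans (∑-const scalars i) (cong (_* i) size-scalars)

  ∑-affine : ∀ k b → k ≢ 0# → {φ : K → K} → (∀ x → φ x ≡ k ⊗ x ⊕ b) → (h : K → ℤ) → ∑ₖ (h ∘ φ) ≡ ∑ₖ h
  ∑-affine k b k≢0 {φ} φ-affine h with inverse k k≢0
  ... | k⁻¹ , kk⁻¹≡1 = ∑-reindex scalars scalars φ (λ y → k⁻¹ ⊗ (y ⊝ b)) from∘to to∘from h
    where
    open ≡-Reasoning
    from∘to : ∀ x → k⁻¹ ⊗ (φ x ⊝ b) ≡ x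
    from∘to x = begin
      k⁻¹ ⊗ (φ x ⊝ b)         ≡⟨ cong (λ y → k⁻¹ ⊗ (y ⊝ b)) (φ-affine x) ⟩
      k⁻¹ ⊗ (k ⊗ x ⊕ b ⊝ b)   ≡⟨ solve 4 (λ k l x b → l :* (k :* x :+ b :- b) := k :* l :* x) refl k k⁻¹ x b ⟩
      k ⊗ k⁻¹ ⊗ x             ≡⟨ cong (_⊗ x) kk⁻¹≡1 ⟩
      1# ⊗ x                  ≡⟨ *-identityˡ x ⟩
      x                       ∎
    to∘from : ∀ y → φ (k⁻¹ ⊗ (y ⊝ b)) ≡ y
    to∘from y = begin
      φ (k⁻¹ ⊗ (y ⊝ b))            ≡⟨ φ-affine _ ⟩
      k ⊗ (k⁻¹ ⊗ (y ⊝ b)) ⊕ b      ≡⟨ solve 4 (λ k l y b → k :* (l :* (y :- b)) :+ b := k :* l :* (y :- b) :+ b) refl k k⁻¹ y b ⟩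
      k ⊗ k⁻¹ ⊗ (y ⊝ b) ⊕ b        ≡⟨ cong (λ z → z ⊗ (y ⊝ b) ⊕ b) kk⁻¹≡1 ⟩
      1# ⊗ (y ⊝ b) ⊕ b             ≡⟨ solve 2 (λ y b → con 1ℤ :* (y :- b) :+ b := y) refl y b ⟩
      y                            ∎

  ∑-shift : ∀ b (h : K → ℤ) → ∑ₖ (λ x → h (x ⊕ b)) ≡ ∑ₖ h
  ∑-shift b = ∑-affine 1# b 1≢0 (λ x → cong (_⊕ b) (sym (*-identityˡ x)))

  -- In characteristic two, x ↦ x + 1 would be an involution without fixed points.
  1+1≢0 : ¬ (2 ∣ q) → 1# ⊕ 1# ≢ 0#
  1+1≢0 q-odd 1+1≡0 = q-odd (divides half (ℤₚ.+-injective (begin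
    pos q                                                        ≡⟨ size-scalars ⟨
    ∑ₖ (λ _ → 1ℤ)                                                ≡⟨ ∑-cong scalars comparable ⟩
    ∑ₖ (λ x → 𝟙 (ascends? x) + 𝟙 (ascends? (x ⊕ 1#)))            ≡⟨ ∑-+ scalars (𝟙 ∘ ascends?) (λ x → 𝟙 (ascends? (x ⊕ 1#))) ⟩
    ∑ₖ (𝟙 ∘ ascends?) + ∑ₖ (λ x → 𝟙 (ascends? (x ⊕ 1#)))         ≡⟨ cong (∑ₖ (𝟙 ∘ ascends?) +_) (∑-shift 1# (𝟙 ∘ ascends?)) ⟩
    ∑ₖ (𝟙 ∘ ascends?) + ∑ₖ (𝟙 ∘ ascends?)                        ≡⟨ cong (λ i → i + i) (∑-𝟙 scalars ascends?) ⟩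
    pos half + pos half                                          ≡⟨ cong pos (cong (half ℕ.+_) (sym (ℕₚ.+-identityʳ half))) ⟩
    pos (2 ℕ.* half)                                             ≡⟨ cong pos (ℕₚ.*-comm 2 half) ⟩
    pos (half ℕ.* 2)                                             ∎)))
    where
    open ≡-Reasoning
    open Inverse (FiniteField.enumeration 𝔽) using (from; to; strictlyInverseˡ)
    rank : K → ℕ
    rank = toℕ ∘ from
    rank-injective : ∀ {x y} → rank x ≡ rank y → x ≡ y
    rank-injective {x} {y} eq = trans (sym (strictlyInverseˡ x))
      (trans (cong to (Finₚ.toℕ-injective eq)) (strictlyInverseˡ y))
    ascends? : ∀ x → Dec (rank x ℕ.< rank (x ⊕ 1#))
    ascends? x = rank x ℕ.<? rank (x ⊕ 1#)
    half : ℕ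
    half = Enumeration.∣_∣ scalars ascends?
    involutive : ∀ x → x ⊕ 1# ⊕ 1# ≡ x
    involutive x = trans (solve 1 (λ x → x :+ con 1ℤ :+ con 1ℤ := x :+ (con 1ℤ :+ con 1ℤ)) refl x)
                         (trans (cong (x ⊕_) 1+1≡0) (+-identityʳ x))
    no-fixed-point : ∀ x → rank x ≢ rank (x ⊕ 1#)
    no-fixed-point x eq = 1≢0 (trans (solve 1 (λ x → con 1ℤ := x :+ con 1ℤ :- x) refl x)
                                     (x≡y⇒x⊝y≡0 (sym (rank-injective eq))))
    comparable : ∀ x → 1ℤ ≡ 𝟙 (ascends? x) + 𝟙 (ascends? (x ⊕ 1#))
    comparable x rewrite involutive x with ℕₚ.<-cmp (rank x) (rank (x ⊕ 1#))
    ... | tri< lt _ ¬gt = sym (cong₂ _+_ (𝟙-yes (rank x ℕ.<? rank (x ⊕ 1#)) lt) (𝟙-no (rank (x ⊕ 1#) ℕ.<? rank x) ¬gt))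
    ... | tri≈ _ eq _   = ⊥-elim (no-fixed-point x eq)
    ... | tri> ¬lt _ gt = sym (cong₂ _+_ (𝟙-no (rank x ℕ.<? rank (x ⊕ 1#)) ¬lt) (𝟙-yes (rank (x ⊕ 1#) ℕ.<? rank x) gt))

  -- Squares in odd characteristic

  module OddCharacteristic (2≢0 : 1# ⊕ 1# ≢ 0#) where

    square-roots : ∀ x y → x ⊗ x ≡ y ⊗ y → x ≡ y ⊎ x ≡ ⊖ y
    square-roots x y x²≡y² with x ≟ y
    ... | yes x≡y = inj₁ x≡y
    ... | no x≢y  = inj₂ (x⊝y≡0⇒x≡y x (⊖ y) (integral (x≢y ∘ x⊝y≡0⇒x≡y x y)
      (trans (solve 2 (λ x y → (x :- y) :* (x :- (:- y)) := x :* x :- y :* y) refl x y) (x≡y⇒x⊝y≡0 x²≡y²))))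

    -- One solution x₀ determines the others up to sign, so the indicators of x₀ and - x₀ dominate
    -- the fibre. They coincide at x₀ = 0, which only makes the bound generous.
    fibre-≤2 : {φ : K → K} → (∀ x y → φ x ≡ φ y → x ≡ y ⊎ x ≡ ⊖ y) →
               ∀ t → ∑ₖ (λ x → 𝟙 (φ x ≟ t)) ≤ pos 2
    fibre-≤2 {φ} two-to-one t with Enumeration.∃? scalars (λ x → φ x ≟ t)
    ... | no none = subst (_≤ pos 2) (sym (∑-zero scalars λ x → 𝟙-no (φ x ≟ t) λ eq → none (x , eq))) (+≤+ ℕ.z≤n)
    ... | yes (x₀ , φx₀≡t) = ℤₚ.≤-trans (∑-mono scalars below) (ℤₚ.≤-reflexive
        (trans (∑-+ scalars (λ x → 𝟙 (x₀ ≟ x)) (λ x → 𝟙 (⊖ x₀ ≟ x)))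
               (cong₂ _+_ (∑-δ1 scalars _≟_ x₀) (∑-δ1 scalars _≟_ (⊖ x₀)))))
      where
      below : ∀ x → 𝟙 (φ x ≟ t) ≤ 𝟙 (x₀ ≟ x) + 𝟙 (⊖ x₀ ≟ x)
      below x with φ x ≟ t
      ... | no _ = ℤₚ.+-mono-≤ (0≤𝟙 (x₀ ≟ x)) (0≤𝟙 (⊖ x₀ ≟ x))
      ... | yes φx≡t with two-to-one x x₀ (trans φx≡t (sym φx₀≡t))
      ...   | inj₁ x≡x₀  = ℤₚ.+-mono-≤ (ℤₚ.≤-reflexive (sym (𝟙-yes (x₀ ≟ x) (sym x≡x₀)))) (0≤𝟙 (⊖ x₀ ≟ x))
      ...   | inj₂ x≡-x₀ = ℤₚ.+-mono-≤ (0≤𝟙 (x₀ ≟ x)) (ℤₚ.≤-reflexive (sym (𝟙-yes (⊖ x₀ ≟ x) (sym x≡-x₀))))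

    scaled-square-roots : ∀ k b → k ≢ 0# → ∀ x y → k ⊗ (x ⊗ x) ⊕ b ≡ k ⊗ (y ⊗ y) ⊕ b → x ≡ y ⊎ x ≡ ⊖ y
    scaled-square-roots k b k≢0 x y eq = square-roots x y (x⊝y≡0⇒x≡y _ _ (integral k≢0
      (trans (solve 4 (λ k b x y → k :* (x :* x :- y :* y) := k :* (x :* x) :+ b :- (k :* (y :* y) :+ b)) refl k b x y)
             (x≡y⇒x⊝y≡0 eq))))

    ∑-squares-≤ : ∀ k b → k ≢ 0# → (h : K → ℤ) → (∀ t → 0ℤ ≤ h t) →
                  ∑ₖ (λ x → h (k ⊗ (x ⊗ x) ⊕ b)) ≤ pos 2 * ∑ₖ h
    ∑-squares-≤ k b k≢0 = ∑-fibres-≤ scalars scalars _≟_ (pos 2) (λ x → k ⊗ (x ⊗ x) ⊕ b)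
      (fibre-≤2 (scaled-square-roots k b k≢0))

    -- Every fibre of x ↦ x² and x ↦ n x² together has at most two points, and there are 2q points in all.
    ∑-squares+nonsquares : ∀ n → n ≢ 0# → (∀ g → n ≢ g ⊗ g) → (h : K → ℤ) →
      ∑ₖ (λ x → h (x ⊗ x)) + ∑ₖ (λ x → h (n ⊗ (x ⊗ x))) ≡ pos 2 * ∑ₖ h
    ∑-squares+nonsquares n n≢0 nonsquare h = begin
      ∑ₖ (λ x → h (x ⊗ x)) + ∑ₖ (λ x → h (n ⊗ (x ⊗ x)))
        ≡⟨ cong₂ _+_ (∑-fibres scalars scalars _≟_ (λ x → x ⊗ x) h) (∑-fibres scalars scalars _≟_ (λ x → n ⊗ (x ⊗ x)) h) ⟩
      ∑ₖ (λ t → ρ t * h t) + ∑ₖ (λ t → ρₙ t * h t)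
        ≡⟨ ∑-+ scalars (λ t → ρ t * h t) (λ t → ρₙ t * h t) ⟨
      ∑ₖ (λ t → ρ t * h t + ρₙ t * h t)
        ≡⟨ ∑-cong scalars (λ t → trans (sym (ℤₚ.*-distribʳ-+ (h t) (ρ t) (ρₙ t)))
             (cong (_* h t) (pointwise-≤⇒≡ scalars _≟_ (λ t → ρ t + ρₙ t) (λ _ → pos 2) ρ+ρₙ≤2 total t))) ⟩
      ∑ₖ (λ t → pos 2 * h t)
        ≡⟨ ∑-*ˡ scalars (pos 2) h ⟩
      pos 2 * ∑ₖ h ∎
      where
      open ≡-Reasoning
      ρ ρₙ : K → ℤ
      ρ t  = ∑ₖ (λ x → 𝟙 (x ⊗ x ≟ t))
      ρₙ t = ∑ₖ (λ x → 𝟙 (n ⊗ (x ⊗ x) ≟ t))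
      ρ≤2 : ∀ t → ρ t ≤ pos 2
      ρ≤2 = fibre-≤2 square-roots
      ρₙ≤2 : ∀ t → ρₙ t ≤ pos 2
      ρₙ≤2 = fibre-≤2 λ x y eq → scaled-square-roots n 0# n≢0 x y
        (trans (+-identityʳ _) (trans eq (sym (+-identityʳ _))))
      x²≡0⇒x≡0 : ∀ x → x ⊗ x ≡ 0# → x ≡ 0#
      x²≡0⇒x≡0 x x²≡0 with x ≟ 0#
      ... | yes x≡0 = x≡0
      ... | no x≢0  = integral x≢0 x²≡0
      ρ0≡1 : ρ 0# ≡ 1ℤ
      ρ0≡1 = trans (∑-cong scalars λ x → 𝟙-cong (x ⊗ x ≟ 0#) (0# ≟ x)
        (sym ∘ x²≡0⇒x≡0 x) (λ { refl → zeroˡ 0# })) (∑-δ1 scalars _≟_ 0#)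
      ρₙ0≡1 : ρₙ 0# ≡ 1ℤ
      ρₙ0≡1 = trans (∑-cong scalars λ x → 𝟙-cong (n ⊗ (x ⊗ x) ≟ 0#) (0# ≟ x)
        (sym ∘ x²≡0⇒x≡0 x ∘ integral n≢0) (λ { refl → trans (cong (n ⊗_) (zeroˡ 0#)) (zeroʳ n) })) (∑-δ1 scalars _≟_ 0#)
      -- n x² = y² would exhibit n as the square of y/x.
      disjoint : ∀ {t} x y → t ≢ 0# → y ⊗ y ≡ t → n ⊗ (x ⊗ x) ≢ t
      disjoint {t} x y t≢0 y²≡t nx²≡t with x ≟ 0#
      ... | yes refl = t≢0 (trans (sym nx²≡t) (trans (cong (n ⊗_) (zeroˡ 0#)) (zeroʳ n)))
      ... | no x≢0 with inverse x x≢0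
      ...   | x⁻¹ , xx⁻¹≡1 = nonsquare (y ⊗ x⁻¹) (begin
        n                            ≡⟨ solve 1 (λ n → n := n :* (con 1ℤ :* con 1ℤ)) refl n ⟩
        n ⊗ (1# ⊗ 1#)                ≡⟨ cong (λ i → n ⊗ (i ⊗ i)) xx⁻¹≡1 ⟨
        n ⊗ (x ⊗ x⁻¹ ⊗ (x ⊗ x⁻¹))    ≡⟨ solve 3 (λ n x i → n :* (x :* i :* (x :* i)) := n :* (x :* x) :* (i :* i)) refl n x x⁻¹ ⟩
        n ⊗ (x ⊗ x) ⊗ (x⁻¹ ⊗ x⁻¹)    ≡⟨ cong (_⊗ (x⁻¹ ⊗ x⁻¹)) (trans nx²≡t (sym y²≡t)) ⟩
        y ⊗ y ⊗ (x⁻¹ ⊗ x⁻¹)          ≡⟨ solve 2 (λ y i → y :* y :* (i :* i) := y :* i :* (y :* i)) refl y x⁻¹ ⟩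
        y ⊗ x⁻¹ ⊗ (y ⊗ x⁻¹)          ∎)
      -- At t = 0 each of the two maps has the single solution 0; at t ≠ 0 at most one of them
      -- reaches t.
      ρ+ρₙ≤2 : ∀ t → ρ t + ρₙ t ≤ pos 2
      ρ+ρₙ≤2 t with t ≟ 0# | Enumeration.∃? scalars (λ y → y ⊗ y ≟ t)
      ... | yes refl | _              = ℤₚ.≤-reflexive (cong₂ _+_ ρ0≡1 ρₙ0≡1)
      ... | no t≢0   | yes (y , y²≡t) = subst (_≤ pos 2) (trans (sym (ℤₚ.+-identityʳ (ρ t))) (cong (ρ t +_)
        (sym (∑-zero scalars λ x → 𝟙-no (n ⊗ (x ⊗ x) ≟ t) (disjoint x y t≢0 y²≡t))))) (ρ≤2 t)
      ... | no t≢0   | no none        = subst (_≤ pos 2) (trans (sym (ℤₚ.+-identityˡ (ρₙ t))) (cong (_+ ρₙ t)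
        (sym (∑-zero scalars λ x → 𝟙-no (x ⊗ x ≟ t) λ eq → none (x , eq))))) (ρₙ≤2 t)
      ∑-all-fibres : (φ : K → K) → ∑ₖ (λ t → ∑ₖ (λ x → 𝟙 (φ x ≟ t))) ≡ ∑ₖ (λ _ → 1ℤ)
      ∑-all-fibres φ = trans (∑-swap scalars scalars (λ t x → 𝟙 (φ x ≟ t))) (∑-cong scalars λ x → ∑-δ1 scalars _≟_ (φ x))
      total : ∑ₖ (λ t → ρ t + ρₙ t) ≡ ∑ₖ (λ _ → pos 2)
      total = trans (∑-+ scalars ρ ρₙ) (trans (cong₂ _+_ (∑-all-fibres (λ x → x ⊗ x)) (∑-all-fibres (λ x → n ⊗ (x ⊗ x))))
        (sym (∑-+ scalars (λ _ → 1ℤ) (λ _ → 1ℤ))))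

    -- Binary quadratic forms

    Q : ℤ
    Q = pos q

    ∑∑ : (K → K → ℤ) → ℤ
    ∑∑ f = ∑ₖ (λ x → ∑ₖ (f x))

    -- Put s = u + g l: the form becomes κ u² + 2 κ g u l. For u ≠ 0 this is a bijection in l, and
    -- for u = 0 it is constantly 0.
    split-form : ∀ κ τ g → κ ≢ 0# → g ≢ 0# → τ ≡ κ ⊗ (g ⊗ g) → (h : K → ℤ) →
      ∑∑ (λ s l → h (κ ⊗ (s ⊗ s) ⊝ τ ⊗ (l ⊗ l))) ≡ (Q - 1ℤ) * ∑ₖ h + 1ℤ * (Q * h 0#)
    split-form κ τ g κ≢0 g≢0 refl h = begin
      ∑∑ (λ s l → h (κ ⊗ (s ⊗ s) ⊝ τ ⊗ (l ⊗ l)))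
        ≡⟨ ∑-swap scalars scalars (λ s l → h (κ ⊗ (s ⊗ s) ⊝ τ ⊗ (l ⊗ l))) ⟩
      ∑∑ (λ l s → h (κ ⊗ (s ⊗ s) ⊝ τ ⊗ (l ⊗ l)))
        ≡⟨ ∑-cong scalars (λ l → ∑-shift (g ⊗ l) (λ s → h (κ ⊗ (s ⊗ s) ⊝ τ ⊗ (l ⊗ l)))) ⟨
      ∑∑ (λ l u → h (κ ⊗ ((u ⊕ g ⊗ l) ⊗ (u ⊕ g ⊗ l)) ⊝ τ ⊗ (l ⊗ l)))
        ≡⟨ ∑-swap scalars scalars (λ l u → h (κ ⊗ ((u ⊕ g ⊗ l) ⊗ (u ⊕ g ⊗ l)) ⊝ τ ⊗ (l ⊗ l))) ⟩
      ∑∑ (λ u l → h (κ ⊗ ((u ⊕ g ⊗ l) ⊗ (u ⊕ g ⊗ l)) ⊝ τ ⊗ (l ⊗ l)))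
        ≡⟨ ∑-exceptional scalars _≟_ 0# (λ u → ∑ₖ (λ l → h (κ ⊗ ((u ⊕ g ⊗ l) ⊗ (u ⊕ g ⊗ l)) ⊝ τ ⊗ (l ⊗ l)))) (λ _ → ∑ₖ h)
             (λ u 0≢u → ∑-affine (κ ⊗ u ⊗ ((1# ⊕ 1#) ⊗ g)) (κ ⊗ (u ⊗ u)) (⊗≢0 (⊗≢0 κ≢0 (0≢u ∘ sym)) (⊗≢0 2≢0 g≢0))
               (λ l → solve 4 (λ κ g u l → κ :* ((u :+ g :* l) :* (u :+ g :* l)) :- κ :* (g :* g) :* (l :* l) :=
                  κ :* u :* ((con 1ℤ :+ con 1ℤ) :* g) :* l :+ κ :* (u :* u)) refl κ g u l) h) ⟩
      ∑ₖ (λ _ → ∑ₖ h) + (∑ₖ (λ l → h (κ ⊗ ((0# ⊕ g ⊗ l) ⊗ (0# ⊕ g ⊗ l)) ⊝ τ ⊗ (l ⊗ l))) - ∑ₖ h)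
        ≡⟨ cong₂ (λ i j → i + (j - ∑ₖ h)) (∑ₖ-const (∑ₖ h)) (trans
             (∑-cong scalars λ l → cong h (solve 3 (λ κ g l →
                κ :* ((con 0ℤ :+ g :* l) :* (con 0ℤ :+ g :* l)) :- κ :* (g :* g) :* (l :* l) := con 0ℤ) refl κ g l))
             (∑ₖ-const (h 0#))) ⟩
      Q * ∑ₖ h + (Q * h 0# - ∑ₖ h)
        ≡⟨ collect Q (∑ₖ h) (h 0#) ⟩
      (Q - 1ℤ) * ∑ₖ h + 1ℤ * (Q * h 0#) ∎
      where
      open ≡-Reasoning
      collect : ∀ i j k → i * j + (i * k - j) ≡ (i - 1ℤ) * j + 1ℤ * (i * k)
      collect = solve-∀

    -- Add the split form κ s² - κ l². With n = τ/κ a nonsquare, l² and n l² together take every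
    -- value exactly twice, so the two sums total 2 q ∑ h; subtracting the split count leaves this
    -- one.
    nonsplit-form : ∀ κ τ → κ ≢ 0# → τ ≢ 0# → (∀ g → τ ≢ κ ⊗ (g ⊗ g)) → (h : K → ℤ) →
      ∑∑ (λ s l → h (κ ⊗ (s ⊗ s) ⊝ τ ⊗ (l ⊗ l))) ≡ (Q + 1ℤ) * ∑ₖ h + - 1ℤ * (Q * h 0#)
    nonsplit-form κ τ κ≢0 τ≢0 nonsquare h with inverse κ κ≢0
    ... | κ⁻¹ , κκ⁻¹≡1 = solve-for (∑∑ split) (∑∑ nonsplit) (∑ₖ h) (h 0#)
        (split-form κ κ 1# κ≢0 1≢0 (solve 1 (λ κ → κ := κ :* (con 1ℤ :* con 1ℤ)) refl κ) h) both
      where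
      open ≡-Reasoning
      split nonsplit : K → K → ℤ
      split s l    = h (κ ⊗ (s ⊗ s) ⊝ κ ⊗ (l ⊗ l))
      nonsplit s l = h (κ ⊗ (s ⊗ s) ⊝ τ ⊗ (l ⊗ l))
      n : K
      n = κ⁻¹ ⊗ τ
      κn≡τ : κ ⊗ n ≡ τ
      κn≡τ = trans (solve 3 (λ κ i τ → κ :* (i :* τ) := κ :* i :* τ) refl κ κ⁻¹ τ)
        (trans (cong (_⊗ τ) κκ⁻¹≡1) (*-identityˡ τ))
      n≢0 : n ≢ 0#
      n≢0 n≡0 = τ≢0 (trans (sym κn≡τ) (trans (cong (κ ⊗_) n≡0) (zeroʳ κ)))
      both : ∑∑ split + ∑∑ nonsplit ≡ Q * (pos 2 * ∑ₖ h)
      both = begin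
        ∑∑ split + ∑∑ nonsplit
          ≡⟨ ∑-+ scalars (λ s → ∑ₖ (split s)) (λ s → ∑ₖ (nonsplit s)) ⟨
        ∑ₖ (λ s → ∑ₖ (split s) + ∑ₖ (nonsplit s))
          ≡⟨ ∑-cong scalars (λ s → cong (∑ₖ (split s) +_) (∑-cong scalars λ l → cong (λ x → h (κ ⊗ (s ⊗ s) ⊝ x))
               (trans (cong (_⊗ (l ⊗ l)) (sym κn≡τ)) (solve 3 (λ κ n l → κ :* n :* (l :* l) := κ :* (n :* (l :* l))) refl κ n l)))) ⟩
        ∑ₖ (λ s → ∑ₖ (split s) + ∑ₖ (λ l → h (κ ⊗ (s ⊗ s) ⊝ κ ⊗ (n ⊗ (l ⊗ l)))))
          ≡⟨ ∑-cong scalars (λ s → ∑-squares+nonsquares n n≢0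
               (λ g n≡g² → nonsquare g (trans (sym κn≡τ) (cong (κ ⊗_) n≡g²))) (λ r → h (κ ⊗ (s ⊗ s) ⊝ κ ⊗ r))) ⟩
        ∑ₖ (λ s → pos 2 * ∑ₖ (λ r → h (κ ⊗ (s ⊗ s) ⊝ κ ⊗ r)))
          ≡⟨ ∑-cong scalars (λ s → cong (pos 2 *_) (∑-affine (⊖ κ) (κ ⊗ (s ⊗ s)) (⊖≢0 κ≢0)
               (λ r → solve 3 (λ κ s r → κ :* (s :* s) :- κ :* r := (:- κ) :* r :+ κ :* (s :* s)) refl κ s r) h)) ⟩
        ∑ₖ (λ s → pos 2 * ∑ₖ h)
          ≡⟨ ∑ₖ-const (pos 2 * ∑ₖ h) ⟩
        Q * (pos 2 * ∑ₖ h) ∎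
      solve-for : ∀ i j k l → i ≡ (Q - 1ℤ) * k + 1ℤ * (Q * l) → i + j ≡ Q * (pos 2 * k) →
                  j ≡ (Q + 1ℤ) * k + - 1ℤ * (Q * l)
      solve-for i j k l refl eq = begin
        j                                                 ≡⟨ rearrange₁ Q j k l ⟩
        (Q - 1ℤ) * k + 1ℤ * (Q * l) + j - ((Q - 1ℤ) * k + 1ℤ * (Q * l))  ≡⟨ cong (_- ((Q - 1ℤ) * k + 1ℤ * (Q * l))) eq ⟩
        Q * (pos 2 * k) - ((Q - 1ℤ) * k + 1ℤ * (Q * l))    ≡⟨ rearrange₂ Q k l ⟩
        (Q + 1ℤ) * k + - 1ℤ * (Q * l)                     ∎
        where
        rearrange₁ : ∀ Q j k l → j ≡ (Q - 1ℤ) * k + 1ℤ * (Q * l) + j - ((Q - 1ℤ) * k + 1ℤ * (Q * l))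
        rearrange₁ = solve-∀
        rearrange₂ : ∀ Q k l → Q * (pos 2 * k) - ((Q - 1ℤ) * k + 1ℤ * (Q * l)) ≡ (Q + 1ℤ) * k + - 1ℤ * (Q * l)
        rearrange₂ = solve-∀

    -- The sign ε is the quadratic character of τ/κ. Later only ε² = 1 matters, and N is left
    -- abstract because it will multiply a vanishing sum.
    binary-form : ∀ κ τ → κ ≢ 0# → τ ≢ 0# → ∃₂ λ N ε → ε * ε ≡ 1ℤ ×
      ((h : K → ℤ) → ∑∑ (λ s l → h (κ ⊗ (s ⊗ s) ⊝ τ ⊗ (l ⊗ l))) ≡ N * ∑ₖ h + ε * (Q * h 0#))
    binary-form κ τ κ≢0 τ≢0 with Enumeration.∃? scalars (λ g → τ ≟ κ ⊗ (g ⊗ g))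
    ... | yes (g , τ≡κg²) = Q - 1ℤ , 1ℤ , refl , split-form κ τ g κ≢0 g≢0 τ≡κg²
      where
      g≢0 : g ≢ 0#
      g≢0 refl = τ≢0 (trans τ≡κg² (solve 1 (λ κ → κ :* (con 0ℤ :* con 0ℤ) := con 0ℤ) refl κ))
    ... | no none = Q + 1ℤ , - 1ℤ , refl , nonsplit-form κ τ κ≢0 τ≢0 (λ g eq → none (g , eq))

    -- If - 1 is a square, take β = 0. Otherwise s² + l² is the nonsplit form with κ = 1 and τ = -
    -- 1, and it represents - 1 exactly q + 1 times.
    -1-sum-of-squares : ∃₂ λ α β → α ⊗ α ⊕ β ⊗ β ≡ ⊖ 1#
    -1-sum-of-squares with Enumeration.∃? scalars (λ g → ⊖ 1# ≟ 1# ⊗ (g ⊗ g))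
    ... | yes (g , eq) = g , 0# , trans (solve 1 (λ g → g :* g :+ con 0ℤ :* con 0ℤ := con 1ℤ :* (g :* g)) refl g) (sym eq)
    ... | no none with Enumeration.∃? (scalars ×ₑ scalars) (λ (α , β) → α ⊗ α ⊕ β ⊗ β ≟ ⊖ 1#)
    ...   | yes ((α , β) , eq) = α , β , eq
    ...   | no none₂ = ⊥-elim (1+n≢0 (trans (sym count) (∑-zero scalars λ s → ∑-zero scalars λ l →
              𝟙-no (⊖ 1# ≟ 1# ⊗ (s ⊗ s) ⊝ ⊖ 1# ⊗ (l ⊗ l)) λ eq → none₂ ((s , l) , sym (trans eq
                (solve 2 (λ s l → con 1ℤ :* (s :* s) :- (:- con 1ℤ) :* (l :* l) := s :* s :+ l :* l) refl s l))))))
      where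
      1+n≢0 : pos (q ℕ.+ 1) ≢ 0ℤ
      1+n≢0 eq with () ← trans (ℕₚ.+-comm 1 q) (ℤₚ.+-injective eq)
      count : ∑∑ (λ s l → 𝟙 (⊖ 1# ≟ 1# ⊗ (s ⊗ s) ⊝ ⊖ 1# ⊗ (l ⊗ l))) ≡ pos (q ℕ.+ 1)
      count = trans (nonsplit-form 1# (⊖ 1#) 1≢0 (⊖≢0 1≢0) (λ g eq → none (g , eq)) (λ r → 𝟙 (⊖ 1# ≟ r)))
        (trans (cong₂ (λ i j → (Q + 1ℤ) * i + - 1ℤ * (Q * j)) (∑-δ1 scalars _≟_ (⊖ 1#)) (𝟙-no (⊖ 1# ≟ 0#) (⊖≢0 1≢0)))
               (simplify Q))
        where
        simplify : ∀ i → (i + 1ℤ) * 1ℤ + - 1ℤ * (i * 0ℤ) ≡ i + 1ℤ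
        simplify = solve-∀

    -- Correlations over a ternary form

    -- Nonnegativity of (u - ε v)² gives 2 ε u v ≤ u² + v², and each of ∑ u² and ∑ v² is at most 2 C
    -- because squaring is at most two-to-one. Both signs ε are covered because the deviation of a
    -- binary form may be q or - q.
    ∑-square-pairs-≤ : ∀ ε → ε * ε ≡ 1ℤ → ∀ (c : K → ℤ) k b → k ≢ 0# →
      ε * ∑ₖ (λ x → c (k ⊗ (x ⊗ x)) * c (k ⊗ ((x ⊝ b) ⊗ (x ⊝ b)))) ≤ pos 2 * ∑ₖ (λ t → c t * c t)
    ∑-square-pairs-≤ ε ε²≡1 c k b k≢0 = ℤₚ.*-cancelˡ-≤-pos _ _ (pos 2) (begin
      pos 2 * (ε * ∑ₖ (λ x → u x * v x))                      ≡⟨ ℤₚ.*-assoc (pos 2) ε (∑ₖ (λ x → u x * v x)) ⟨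
      pos 2 * ε * ∑ₖ (λ x → u x * v x)                        ≡⟨ ∑-*ˡ scalars (pos 2 * ε) (λ x → u x * v x) ⟨
      ∑ₖ (λ x → pos 2 * ε * (u x * v x))                      ≤⟨ ∑-mono scalars (λ x → am-gm (u x) (v x)) ⟩
      ∑ₖ (λ x → u x * u x + v x * v x)                        ≡⟨ ∑-+ scalars (λ x → u x * u x) (λ x → v x * v x) ⟩
      ∑ₖ (λ x → u x * u x) + ∑ₖ (λ x → v x * v x)             ≡⟨ cong (∑ₖ (λ x → u x * u x) +_) (∑-shift (⊖ b) (λ x → u x * u x)) ⟩
      ∑ₖ (λ x → u x * u x) + ∑ₖ (λ x → u x * u x)             ≤⟨ ℤₚ.+-mono-≤ u²≤2C u²≤2C ⟩
      pos 2 * C + pos 2 * C                                   ≡⟨ double C ⟩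
      pos 2 * (pos 2 * C)                                     ∎)
      where
      open ℤₚ.≤-Reasoning
      C : ℤ
      C = ∑ₖ (λ t → c t * c t)
      u v : K → ℤ
      u x = c (k ⊗ (x ⊗ x))
      v x = u (x ⊝ b)
      double : ∀ i → pos 2 * i + pos 2 * i ≡ pos 2 * (pos 2 * i)
      double = solve-∀
      am-gm : ∀ i j → pos 2 * ε * (i * j) ≤ i * i + j * j
      am-gm i j = ℤₚ.0≤i-j⇒j≤i (subst (0ℤ ≤_)
        (trans (expand i j ε) (cong (λ z → i * i + z - pos 2 * ε * (i * j))
          (trans (cong (_* (j * j)) ε²≡1) (ℤₚ.*-identityˡ (j * j)))))
        (0≤i*i (i - ε * j)))
        where
        expand : ∀ i j e → (i - e * j) * (i - e * j) ≡ i * i + e * e * (j * j) - pos 2 * e * (i * j)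
        expand = solve-∀
      u²≤2C : ∑ₖ (λ x → u x * u x) ≤ pos 2 * C
      u²≤2C = subst (_≤ pos 2 * C) (∑-cong scalars λ x → cong (λ y → c y * c y) (+-identityʳ (k ⊗ (x ⊗ x))))
        (∑-squares-≤ k 0# k≢0 (λ t → c t * c t) (λ t → 0≤i*i (c t)))

    module Balanced (c : K → ℤ) (∑c≡0 : ∑ₖ c ≡ 0ℤ) where

      C : ℤ
      C = ∑ₖ (λ t → c t * c t)

      -- For fixed x the shifted argument x - k runs over the whole field, so the sum factors as (∑
      -- c)². It kills every contribution in which the shift is uniformly distributed.
      ∑-autocorrelation : ∑∑ (λ k x → c x * c (x ⊝ k)) ≡ 0ℤ
      ∑-autocorrelation = trans (∑-swap scalars scalars (λ k x → c x * c (x ⊝ k)))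
        (∑-zero scalars λ x → trans (∑-*ˡ scalars (c x) (λ k → c (x ⊝ k))) (trans
          (cong (c x *_) (trans (∑-affine (⊖ 1#) x (⊖≢0 1≢0)
            (λ k → solve 2 (λ x k → x :- k := (:- con 1ℤ) :* k :+ x) refl x k) c) ∑c≡0))
          (ℤₚ.*-zeroʳ (c x))))

      module _ (κ : K) (κ≢0 : κ ≢ 0#) where

        -- k is the difference of the two values of the form, A the first of them.
        A : K → K → K → K → K
        A τ k l s = κ ⊗ (s ⊗ s) ⊝ τ ⊗ (l ⊗ l) ⊕ (k ⊕ τ) ⊗ l

        -- In the difference k of the two arguments w has coefficient 1, so `offset` expresses w
        -- through k. Replacing t by s + t₀ l removes the mixed term in t and l that this creates.
        -- The resulting τ = w₀ + κ t₀² is the value of the form l w + κ t² at the displacement (1 ,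
        -- w₀ , t₀).
        normal-form : ∀ w₀ t₀ →
          ∑ₖ (λ t → ∑∑ (λ l w → c (l ⊗ w ⊕ κ ⊗ (t ⊗ t)) * c ((l ⊝ 1#) ⊗ (w ⊝ w₀) ⊕ κ ⊗ ((t ⊝ t₀) ⊗ (t ⊝ t₀)))))
          ≡ ∑ₖ (λ k → ∑∑ (λ l s → let x = A (w₀ ⊕ κ ⊗ (t₀ ⊗ t₀)) k l s in c x * c (x ⊝ k)))
        normal-form w₀ t₀ = begin
          ∑ₖ (λ t → ∑ₖ (λ l → ∑ₖ (λ w → P t l w)))
            ≡⟨ ∑-swap scalars scalars (λ t l → ∑ₖ (P t l)) ⟩
          ∑ₖ (λ l → ∑ₖ (λ t → ∑ₖ (λ w → P t l w)))
            ≡⟨ ∑-cong scalars (λ l → ∑-shift (t₀ ⊗ l) (λ t → ∑ₖ (P t l))) ⟨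
          ∑ₖ (λ l → ∑ₖ (λ s → ∑ₖ (λ w → P (s ⊕ t₀ ⊗ l) l w)))
            ≡⟨ ∑-cong scalars (λ l → ∑-cong scalars λ s → ∑-shift (offset l s) (P (s ⊕ t₀ ⊗ l) l)) ⟨
          ∑ₖ (λ l → ∑ₖ (λ s → ∑ₖ (λ k → P (s ⊕ t₀ ⊗ l) l (k ⊕ offset l s))))
            ≡⟨ ∑-cong scalars (λ l → ∑-cong scalars λ s → ∑-cong scalars λ k → cong₂ (λ x y → c x * c y) (first l s k) (second l s k)) ⟩
          ∑ₖ (λ l → ∑ₖ (λ s → ∑ₖ (λ k → c (A τ k l s) * c (A τ k l s ⊝ k))))
            ≡⟨ ∑-swap-inner scalars scalars scalars (λ l s k → c (A τ k l s) * c (A τ k l s ⊝ k)) ⟩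
          ∑ₖ (λ k → ∑ₖ (λ l → ∑ₖ (λ s → c (A τ k l s) * c (A τ k l s ⊝ k)))) ∎
          where
          open ≡-Reasoning
          τ : K
          τ = w₀ ⊕ κ ⊗ (t₀ ⊗ t₀)
          P : K → K → K → ℤ
          P t l w = c (l ⊗ w ⊕ κ ⊗ (t ⊗ t)) * c ((l ⊝ 1#) ⊗ (w ⊝ w₀) ⊕ κ ⊗ ((t ⊝ t₀) ⊗ (t ⊝ t₀)))
          offset : K → K → K
          offset l s = κ ⊗ (t₀ ⊗ t₀) ⊝ (l ⊝ 1#) ⊗ w₀ ⊝ (1# ⊕ 1#) ⊗ (κ ⊗ ((s ⊕ t₀ ⊗ l) ⊗ t₀))
          first : ∀ l s k → l ⊗ (k ⊕ offset l s) ⊕ κ ⊗ ((s ⊕ t₀ ⊗ l) ⊗ (s ⊕ t₀ ⊗ l)) ≡ A τ k l s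
          first l s k = solve 6 (λ κ w₀ t₀ l s k →
            l :* (k :+ (κ :* (t₀ :* t₀) :- (l :- con 1ℤ) :* w₀ :- (con 1ℤ :+ con 1ℤ) :* (κ :* ((s :+ t₀ :* l) :* t₀)))) :+ κ :* ((s :+ t₀ :* l) :* (s :+ t₀ :* l))
            := κ :* (s :* s) :- (w₀ :+ κ :* (t₀ :* t₀)) :* (l :* l) :+ (k :+ (w₀ :+ κ :* (t₀ :* t₀))) :* l) refl κ w₀ t₀ l s k
          second : ∀ l s k → (l ⊝ 1#) ⊗ (k ⊕ offset l s ⊝ w₀) ⊕ κ ⊗ ((s ⊕ t₀ ⊗ l ⊝ t₀) ⊗ (s ⊕ t₀ ⊗ l ⊝ t₀)) ≡ A τ k l s ⊝ k
          second l s k = solve 6 (λ κ w₀ t₀ l s k →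
            (l :- con 1ℤ) :* (k :+ (κ :* (t₀ :* t₀) :- (l :- con 1ℤ) :* w₀ :- (con 1ℤ :+ con 1ℤ) :* (κ :* ((s :+ t₀ :* l) :* t₀))) :- w₀) :+ κ :* ((s :+ t₀ :* l :- t₀) :* (s :+ t₀ :* l :- t₀))
            := κ :* (s :* s) :- (w₀ :+ κ :* (t₀ :* t₀)) :* (l :* l) :+ (k :+ (w₀ :+ κ :* (t₀ :* t₀))) :* l :- k) refl κ w₀ t₀ l s k

        -- With τ = 0 the first argument is κ s² + k l, a bijection in l for k ≠ 0, so s contributes
        -- only a factor q. All autocorrelations together vanish, leaving the discrepancy at k = 0,
        -- which is q (∑ c(κ s²)² - C); the negative part is dropped.
        isotropic-≤ : ∑ₖ (λ k → ∑∑ (λ l s → c (A 0# k l s) * c (A 0# k l s ⊝ k))) ≤ pos 2 * (Q * C)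
        isotropic-≤ = begin
          ∑ₖ f                                            ≡⟨ ∑-exceptional scalars _≟_ 0# f (λ k → Q * Γ k) generic ⟩
          ∑ₖ (λ k → Q * Γ k) + (f 0# - Q * Γ 0#)          ≡⟨ cong₂ _+_ (trans (∑-*ˡ scalars Q Γ) (cong (Q *_) ∑-autocorrelation))
                                                               (cong₂ (λ i j → i - Q * j) f0 Γ0) ⟩
          Q * 0ℤ + (Q * ∑ₖ (λ s → v s * v s) - Q * C)     ≡⟨ simplify Q (∑ₖ (λ s → v s * v s)) C ⟩
          Q * (∑ₖ (λ s → v s * v s) - C)                  ≤⟨ *-monoˡ-0≤ Q (+≤+ ℕ.z≤n) (ℤₚ.+-mono-≤ v²≤2C (ℤₚ.neg-mono-≤ 0≤C)) ⟩
          Q * (pos 2 * C - 0ℤ)                            ≡⟨ simplify₂ Q C ⟩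
          pos 2 * (Q * C)                                 ∎
          where
          open ℤₚ.≤-Reasoning
          0≤C : 0ℤ ≤ C
          0≤C = ∑-nonneg scalars λ t → 0≤i*i (c t)
          f Γ v : K → ℤ
          f k = ∑∑ (λ l s → c (A 0# k l s) * c (A 0# k l s ⊝ k))
          Γ k = ∑ₖ (λ x → c x * c (x ⊝ k))
          v s = c (κ ⊗ (s ⊗ s))
          simplify : ∀ i j k → i * 0ℤ + (i * j - i * k) ≡ i * (j - k)
          simplify = solve-∀
          simplify₂ : ∀ i k → i * (pos 2 * k - 0ℤ) ≡ pos 2 * (i * k)
          simplify₂ = solve-∀
          generic : ∀ k → 0# ≢ k → f k ≡ Q * Γ k
          generic k 0≢k = trans (∑-swap scalars scalars (λ l s → c (A 0# k l s) * c (A 0# k l s ⊝ k)))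
            (trans (∑-cong scalars λ s → ∑-affine k (κ ⊗ (s ⊗ s)) (0≢k ∘ sym)
              (λ l → solve 4 (λ κ s l k → κ :* (s :* s) :- con 0ℤ :* (l :* l) :+ (k :+ con 0ℤ) :* l := k :* l :+ κ :* (s :* s)) refl κ s l k)
              (λ x → c x * c (x ⊝ k))) (∑ₖ-const (Γ k)))
          f0 : f 0# ≡ Q * ∑ₖ (λ s → v s * v s)
          f0 = trans (∑-cong scalars λ l → ∑-cong scalars λ s → cong₂ (λ x y → c x * c y)
              (solve 3 (λ κ s l → κ :* (s :* s) :- con 0ℤ :* (l :* l) :+ (con 0ℤ :+ con 0ℤ) :* l := κ :* (s :* s)) refl κ s l)
              (solve 3 (λ κ s l → κ :* (s :* s) :- con 0ℤ :* (l :* l) :+ (con 0ℤ :+ con 0ℤ) :* l :- con 0ℤ := κ :* (s :* s)) refl κ s l))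
            (∑ₖ-const (∑ₖ (λ s → v s * v s)))
          Γ0 : Γ 0# ≡ C
          Γ0 = ∑-cong scalars λ x → cong (λ y → c x * c y) (solve 1 (λ x → x :- con 0ℤ := x) refl x)
          v²≤2C : ∑ₖ (λ s → v s * v s) ≤ pos 2 * C
          v²≤2C = subst (_≤ pos 2 * C) (∑-cong scalars λ x → cong (λ y → c y * c y) (+-identityʳ (κ ⊗ (x ⊗ x))))
            (∑-squares-≤ κ 0# κ≢0 (λ t → c t * c t) (λ t → 0≤i*i (c t)))

        -- Put k = 2τe - τ, so that completing the square needs no division.
        anisotropic-≤ : ∀ τ → τ ≢ 0# →
          ∑ₖ (λ k → ∑∑ (λ l s → c (A τ k l s) * c (A τ k l s ⊝ k))) ≤ pos 2 * (Q * C)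
        anisotropic-≤ τ τ≢0 with binary-form κ τ κ≢0 τ≢0
        ... | N , ε , ε²≡1 , counts = begin
          ∑ₖ (λ k → ∑∑ (f k))
            ≡⟨ ∑-affine 2τ (⊖ τ) 2τ≢0 (λ _ → refl) (λ k → ∑∑ (f k)) ⟨
          ∑ₖ (λ e → ∑∑ (λ l s → f (k e) l s))
            ≡⟨ ∑-cong scalars (λ e → ∑-shift e (λ l → ∑ₖ (f (k e) l))) ⟨
          ∑ₖ (λ e → ∑∑ (λ l s → f (k e) (l ⊕ e) s))
            ≡⟨ ∑-cong scalars (λ e → ∑-cong scalars λ l → ∑-cong scalars λ s → cong₂ (λ x y → c x * c y) (first e l s) (second e l s)) ⟩
          ∑ₖ (λ e → ∑∑ (λ l s → h e (κ ⊗ (s ⊗ s) ⊝ τ ⊗ (l ⊗ l))))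
            ≡⟨ ∑-cong scalars (λ e → trans (∑-swap scalars scalars (λ l s → h e (κ ⊗ (s ⊗ s) ⊝ τ ⊗ (l ⊗ l)))) (counts (h e))) ⟩
          ∑ₖ (λ e → N * ∑ₖ (h e) + ε * (Q * h e 0#))
            ≡⟨ ∑-cong scalars (λ e → cong (λ z → N * ∑ₖ (h e) + z) (sym (ℤₚ.*-assoc ε Q (h e 0#)))) ⟩
          ∑ₖ (λ e → N * ∑ₖ (h e) + ε * Q * h e 0#)
            ≡⟨ ∑-lin₂ scalars N (λ e → ∑ₖ (h e)) (ε * Q) (λ e → h e 0#) ⟩
          N * ∑ₖ (λ e → ∑ₖ (h e)) + ε * Q * ∑ₖ (λ e → h e 0#)
            ≡⟨ cong₂ (λ i j → N * i + ε * Q * j) total at-zero ⟩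
          N * 0ℤ + ε * Q * ∑ₖ pair
            ≡⟨ simplify N ε Q (∑ₖ pair) ⟩
          Q * (ε * ∑ₖ pair)
            ≤⟨ *-monoˡ-0≤ Q (+≤+ ℕ.z≤n) (∑-square-pairs-≤ ε ε²≡1 c τ 1# τ≢0) ⟩
          Q * (pos 2 * C)
            ≡⟨ commute Q C ⟩
          pos 2 * (Q * C) ∎
          where
          open ℤₚ.≤-Reasoning
          2τ : K
          2τ = (1# ⊕ 1#) ⊗ τ
          2τ≢0 : 2τ ≢ 0#
          2τ≢0 = ⊗≢0 2≢0 τ≢0
          f : K → K → K → ℤ
          f k l s = c (A τ k l s) * c (A τ k l s ⊝ k)
          k : K → K
          k e = 2τ ⊗ e ⊕ ⊖ τ
          h : K → K → ℤ
          h e r = c (r ⊕ τ ⊗ (e ⊗ e)) * c (r ⊕ τ ⊗ ((e ⊝ 1#) ⊗ (e ⊝ 1#)))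
          pair : K → ℤ
          pair e = c (τ ⊗ (e ⊗ e)) * c (τ ⊗ ((e ⊝ 1#) ⊗ (e ⊝ 1#)))
          simplify : ∀ n e q x → n * 0ℤ + e * q * x ≡ q * (e * x)
          simplify = solve-∀
          commute : ∀ i j → i * (pos 2 * j) ≡ pos 2 * (i * j)
          commute = solve-∀
          first : ∀ e l s → A τ (k e) (l ⊕ e) s ≡ κ ⊗ (s ⊗ s) ⊝ τ ⊗ (l ⊗ l) ⊕ τ ⊗ (e ⊗ e)
          first e l s = solve 5 (λ κ τ e l s →
            κ :* (s :* s) :- τ :* ((l :+ e) :* (l :+ e)) :+ ((con 1ℤ :+ con 1ℤ) :* τ :* e :+ (:- τ) :+ τ) :* (l :+ e)
            := κ :* (s :* s) :- τ :* (l :* l) :+ τ :* (e :* e)) refl κ τ e l s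
          second : ∀ e l s → A τ (k e) (l ⊕ e) s ⊝ k e ≡ κ ⊗ (s ⊗ s) ⊝ τ ⊗ (l ⊗ l) ⊕ τ ⊗ ((e ⊝ 1#) ⊗ (e ⊝ 1#))
          second e l s = solve 5 (λ κ τ e l s →
            κ :* (s :* s) :- τ :* ((l :+ e) :* (l :+ e)) :+ ((con 1ℤ :+ con 1ℤ) :* τ :* e :+ (:- τ) :+ τ) :* (l :+ e) :- ((con 1ℤ :+ con 1ℤ) :* τ :* e :+ (:- τ))
            := κ :* (s :* s) :- τ :* (l :* l) :+ τ :* ((e :- con 1ℤ) :* (e :- con 1ℤ))) refl κ τ e l s
          at-zero : ∑ₖ (λ e → h e 0#) ≡ ∑ₖ pair
          at-zero = ∑-cong scalars λ e → cong₂ (λ x y → c x * c y) (+-identityˡ _) (+-identityˡ _)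
          -- Shifting r by τ e² makes `∑ₖ (h e)` the autocorrelation at k e = τ e² - τ (e - 1)², and
          -- e ↦ k e is a bijection. Hence only the exceptional value 0 of the binary form
          -- contributes.
          total : ∑ₖ (λ e → ∑ₖ (h e)) ≡ 0ℤ
          total = trans (∑-cong scalars λ e → trans
              (∑-cong scalars λ r → cong (λ y → c (r ⊕ τ ⊗ (e ⊗ e)) * c y) (solve 3 (λ τ e r →
                r :+ τ :* ((e :- con 1ℤ) :* (e :- con 1ℤ)) := r :+ τ :* (e :* e) :- ((con 1ℤ :+ con 1ℤ) :* τ :* e :+ (:- τ))) refl τ e r))
              (∑-shift (τ ⊗ (e ⊗ e)) (λ x → c x * c (x ⊝ k e))))
            (trans (∑-affine 2τ (⊖ τ) 2τ≢0 (λ _ → refl) (λ k → ∑ₖ (λ x → c x * c (x ⊝ k)))) ∑-autocorrelation)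

        -- Whether the displacement (1 , w₀ , t₀) is isotropic decides the argument: the dependence
        -- on l is linear if τ = 0, and a square can be completed otherwise.
        ternary-≤ : ∀ w₀ t₀ →
          ∑ₖ (λ t → ∑∑ (λ l w → c (l ⊗ w ⊕ κ ⊗ (t ⊗ t)) * c ((l ⊝ 1#) ⊗ (w ⊝ w₀) ⊕ κ ⊗ ((t ⊝ t₀) ⊗ (t ⊝ t₀)))))
          ≤ pos 2 * (Q * C)
        ternary-≤ w₀ t₀ = subst (_≤ pos 2 * (Q * C)) (sym (normal-form w₀ t₀)) (bound (w₀ ⊕ κ ⊗ (t₀ ⊗ t₀)))
          where
          bound : ∀ τ → ∑ₖ (λ k → ∑∑ (λ l s → c (A τ k l s) * c (A τ k l s ⊝ k))) ≤ pos 2 * (Q * C)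
          bound τ with τ ≟ 0#
          ... | yes refl = isotropic-≤
          ... | no τ≢0   = anisotropic-≤ τ τ≢0

    -- Sums over hyperbolic spaces

    private variable
      ℓᴬ ℓᴮ : Level
      A : Set ℓᴬ
      B : Set ℓᴮ
      n : ℕ

    points : ∀ n → Enumeration (Space n)
    points = enumVec scalars

    ∑ᵥ : (Space n → ℤ) → ℤ
    ∑ᵥ {n} = ∑ (points n)

    Q^_ : ℕ → ℤ
    Q^ n = pos (q ℕ.^ n)

    Q^suc : ∀ n → Q * Q^ n ≡ Q^ suc n
    Q^suc n = sym (ℤₚ.pos-* q (q ℕ.^ n))

    ∑ᵥ-suc : (f : Space (suc n) → ℤ) → ∑ᵥ f ≡ ∑ₖ (λ x → ∑ᵥ (λ v → f (x ∷ v)))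
    ∑ᵥ-suc {n} = ∑-enumVec scalars n

    ∑ᵥ-const : ∀ n i → ∑ᵥ {n} (λ _ → i) ≡ Q^ n * i
    ∑ᵥ-const zero    i = trans (ℤₚ.+-identityʳ i) (sym (ℤₚ.*-identityˡ i))
    ∑ᵥ-const (suc n) i = trans (∑ᵥ-suc (λ _ → i)) (trans (∑-cong scalars λ _ → ∑ᵥ-const n i)
      (trans (∑ₖ-const (Q^ n * i)) (trans (sym (ℤₚ.*-assoc Q (Q^ n) i)) (cong (_* i) (Q^suc n)))))

    0ᵥ : Space n
    0ᵥ {n} = replicate n 0#

    _≟ᵥ_ : (u v : Space n) → Dec (u ≡ v)
    _≟ᵥ_ = ≡-dec _≟_

    infixl 6 _⊞_
    _⊞_ : Space n → Space n → Space n
    _⊞_ = zipWith _⊕_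

    infixr 7 _·_
    _·_ : K → Space n → Space n
    l · u = map (l ⊗_) u

    dot : Space n → Space n → K
    dot []      []      = 0#
    dot (x ∷ u) (y ∷ v) = x ⊗ y ⊕ dot u v

    dot-comm : (u v : Space n) → dot u v ≡ dot v u
    dot-comm []      []      = refl
    dot-comm (x ∷ u) (y ∷ v) = cong₂ _⊕_ (*-comm x y) (dot-comm u v)

    dot-0ˡ : (v : Space n) → dot 0ᵥ v ≡ 0#
    dot-0ˡ []      = refl
    dot-0ˡ (y ∷ v) = trans (cong₂ _⊕_ (zeroˡ y) (dot-0ˡ v)) (+-identityˡ 0#)

    dot-⊟ʳ : (u v w : Space n) → dot u (v ⊟ w) ≡ dot u v ⊝ dot u w
    dot-⊟ʳ []      []      []      = solve 0 (con 0ℤ := con 0ℤ :- con 0ℤ) refl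
    dot-⊟ʳ (x ∷ u) (y ∷ v) (z ∷ w) = trans (cong (x ⊗ (y ⊝ z) ⊕_) (dot-⊟ʳ u v w))
      (solve 5 (λ x y z s t → x :* (y :- z) :+ (s :- t) := (x :* y :+ s) :- (x :* z :+ t)) refl x y z (dot u v) (dot u w))

    dot-shearˡ : ∀ l (u w v : Space n) → dot (u ⊞ l · w) v ≡ dot u v ⊕ l ⊗ dot w v
    dot-shearˡ l []      []      []      = solve 1 (λ l → con 0ℤ := con 0ℤ :+ l :* con 0ℤ) refl l
    dot-shearˡ l (x ∷ u) (z ∷ w) (y ∷ v) = trans (cong ((x ⊕ l ⊗ z) ⊗ y ⊕_) (dot-shearˡ l u w v))
      (solve 6 (λ l x z y s t → (x :+ l :* z) :* y :+ (s :+ l :* t) := x :* y :+ s :+ l :* (z :* y :+ t)) refl l x z y (dot u v) (dot w v))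

    dot-⊟ˡ : (v w u : Space n) → dot (v ⊟ w) u ≡ dot v u ⊝ dot w u
    dot-⊟ˡ v w u = trans (dot-comm (v ⊟ w) u) (trans (dot-⊟ʳ u v w) (cong₂ _⊝_ (dot-comm u v) (dot-comm u w)))

    ∑ᵥ-shift : (w : Space n) (f : Space n → ℤ) → ∑ᵥ (λ u → f (u ⊞ w)) ≡ ∑ᵥ f
    ∑ᵥ-shift []      f = refl
    ∑ᵥ-shift (y ∷ w) f = begin
      ∑ᵥ (λ u → f (u ⊞ (y ∷ w)))                   ≡⟨ ∑ᵥ-suc (λ u → f (u ⊞ (y ∷ w))) ⟩
      ∑ₖ (λ x → ∑ᵥ (λ u → f (x ⊕ y ∷ u ⊞ w)))      ≡⟨ ∑-cong scalars (λ x → ∑ᵥ-shift w (λ u → f (x ⊕ y ∷ u))) ⟩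
      ∑ₖ (λ x → ∑ᵥ (λ u → f (x ⊕ y ∷ u)))          ≡⟨ ∑-shift y (λ x → ∑ᵥ (λ u → f (x ∷ u))) ⟩
      ∑ₖ (λ x → ∑ᵥ (λ u → f (x ∷ u)))              ≡⟨ ∑ᵥ-suc f ⟨
      ∑ᵥ f                                         ∎
      where open ≡-Reasoning

    -- At the first nonzero coordinate of u, the matching coordinate of v alone sweeps the field. N
    -- is existential, but chosen before h; its applications multiply it by a sum that is zero.
    dot-equidistributed : (u : Space n) → u ≢ 0ᵥ → ∃ λ N → (h : K → ℤ) → ∑ᵥ (λ v → h (dot u v)) ≡ N * ∑ₖ h
    dot-equidistributed [] u≢0 = ⊥-elim (u≢0 refl)
    dot-equidistributed {suc n} (p ∷ u) pu≢0 with p ≟ 0#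
    ... | no p≢0 = Q^ n , λ h → begin
      ∑ᵥ (λ v → h (dot (p ∷ u) v))                   ≡⟨ ∑ᵥ-suc (λ v → h (dot (p ∷ u) v)) ⟩
      ∑ₖ (λ y → ∑ᵥ (λ v → h (p ⊗ y ⊕ dot u v)))      ≡⟨ ∑-swap scalars (points n) (λ y v → h (p ⊗ y ⊕ dot u v)) ⟩
      ∑ᵥ (λ v → ∑ₖ (λ y → h (p ⊗ y ⊕ dot u v)))      ≡⟨ ∑-cong (points n) (λ v → ∑-affine p (dot u v) p≢0 (λ _ → refl) h) ⟩
      ∑ᵥ {n} (λ v → ∑ₖ h)                            ≡⟨ ∑ᵥ-const n (∑ₖ h) ⟩
      Q^ n * ∑ₖ h                                    ∎
      where open ≡-Reasoning
    ... | yes refl with dot-equidistributed u (pu≢0 ∘ cong (0# ∷_))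
    ...   | N , equidistributed = Q * N , λ h → begin
      ∑ᵥ (λ v → h (dot (0# ∷ u) v))                  ≡⟨ ∑ᵥ-suc (λ v → h (dot (0# ∷ u) v)) ⟩
      ∑ₖ (λ y → ∑ᵥ (λ v → h (0# ⊗ y ⊕ dot u v)))     ≡⟨ ∑-cong scalars (λ y → ∑-cong (points n) λ v → cong h (trans (cong (_⊕ dot u v) (zeroˡ y)) (+-identityˡ _))) ⟩
      ∑ₖ (λ y → ∑ᵥ (λ v → h (dot u v)))              ≡⟨ ∑-cong scalars (λ y → equidistributed h) ⟩
      ∑ₖ (λ y → N * ∑ₖ h)                            ≡⟨ ∑ₖ-const (N * ∑ₖ h) ⟩
      Q * (N * ∑ₖ h)                                 ≡⟨ ℤₚ.*-assoc Q N (∑ₖ h) ⟨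
      Q * N * ∑ₖ h                                   ∎
      where open ≡-Reasoning

    -- With x replaced by x - l w the arguments are x and x - w - e, and (x , w) ↦ (x , x - w - e)
    -- is a bijection of the plane.
    ∑-sheared : (H : K → K → ℤ) → ∑∑ H ≡ 0ℤ → ∀ l w₀ d →
      ∑∑ (λ x w → H (l ⊗ w ⊕ x) ((l ⊝ 1#) ⊗ (w ⊝ w₀) ⊕ (x ⊝ d))) ≡ 0ℤ
    ∑-sheared H ∑H≡0 l w₀ d = begin
      ∑∑ (λ x w → H (l ⊗ w ⊕ x) ((l ⊝ 1#) ⊗ (w ⊝ w₀) ⊕ (x ⊝ d)))
        ≡⟨ ∑-swap scalars scalars (λ x w → H (l ⊗ w ⊕ x) ((l ⊝ 1#) ⊗ (w ⊝ w₀) ⊕ (x ⊝ d))) ⟩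
      ∑∑ (λ w x → H (l ⊗ w ⊕ x) ((l ⊝ 1#) ⊗ (w ⊝ w₀) ⊕ (x ⊝ d)))
        ≡⟨ ∑-cong scalars (λ w → ∑-cong scalars λ x → cong₂ H
             (solve 3 (λ l w x → l :* w :+ x := x :+ l :* w) refl l w x)
             (solve 5 (λ l w x w₀ d → (l :- con 1ℤ) :* (w :- w₀) :+ (x :- d) :=
                x :+ l :* w :- w :- ((l :- con 1ℤ) :* w₀ :+ d)) refl l w x w₀ d)) ⟩
      ∑∑ (λ w x → H (x ⊕ l ⊗ w) (x ⊕ l ⊗ w ⊝ w ⊝ e))
        ≡⟨ ∑-cong scalars (λ w → ∑-shift (l ⊗ w) (λ x → H x (x ⊝ w ⊝ e))) ⟩
      ∑∑ (λ w x → H x (x ⊝ w ⊝ e))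
        ≡⟨ ∑-swap scalars scalars (λ w x → H x (x ⊝ w ⊝ e)) ⟩
      ∑∑ (λ x w → H x (x ⊝ w ⊝ e))
        ≡⟨ ∑-cong scalars (λ x → ∑-affine (⊖ 1#) (x ⊝ e) (⊖≢0 1≢0)
             (λ w → solve 3 (λ x w e → x :- w :- e := (:- con 1ℤ) :* w :+ (x :- e)) refl x w e) (H x)) ⟩
      ∑∑ H
        ≡⟨ ∑H≡0 ⟩
      0ℤ ∎
      where
      open ≡-Reasoning
      e : K
      e = (l ⊝ 1#) ⊗ w₀ ⊕ d

    -- H receives the values of the form u · v at a point and at its translate by (u₀ , v₀). The
    -- kernel is arbitrary because peeling off further coordinates translates both of its arguments.
    hyperbolicSum : (H : K → K → ℤ) (u₀ v₀ : Space n) → ℤ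
    hyperbolicSum H u₀ v₀ = ∑ᵥ (λ u → ∑ᵥ (λ v → H (dot u v) (dot (u ⊟ u₀) (v ⊟ v₀))))

    -- The restriction to u = l u₀ in the variables l and w = u₀ · v: there u · v = l w and (u - u₀)
    -- · (v - v₀) = (l - 1) (w - w₀).
    planeSum : (H : K → K → ℤ) (w₀ : K) → ℤ
    planeSum H w₀ = ∑∑ (λ l w → H (l ⊗ w) ((l ⊝ 1#) ⊗ (w ⊝ w₀)))

    hyperbolicSum-suc : (H : K → K → ℤ) (p r : K) (u₀ v₀ : Space n) →
      hyperbolicSum H (p ∷ u₀) (r ∷ v₀) ≡
      ∑ₖ (λ x → ∑ᵥ (λ u → ∑ₖ (λ y → ∑ᵥ (λ v → H (x ⊗ y ⊕ dot u v) ((x ⊝ p) ⊗ (y ⊝ r) ⊕ dot (u ⊟ u₀) (v ⊟ v₀))))))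
    hyperbolicSum-suc {n} H p r u₀ v₀ = trans
      (∑ᵥ-suc (λ u → ∑ᵥ (λ v → H (dot u v) (dot (u ⊟ (p ∷ u₀)) (v ⊟ (r ∷ v₀))))))
      (∑-cong scalars λ x → ∑-cong (points n) λ u → ∑ᵥ-suc (λ v → H (dot (x ∷ u) v) (dot ((x ∷ u) ⊟ (p ∷ u₀)) (v ⊟ (r ∷ v₀)))))

    -- Only the multiples u = l u₀ contribute.
    hyperbolicSum≡planeSum-head : (H : K → K → ℤ) → ∑∑ H ≡ 0ℤ → ∀ p r (u₀ v₀ : Space n) → p ≢ 0# →
      hyperbolicSum H (p ∷ u₀) (r ∷ v₀) ≡ Q^ n * planeSum H (dot (p ∷ u₀) (r ∷ v₀))
    hyperbolicSum≡planeSum-head {n} H ∑H≡0 p r u₀ v₀ p≢0 = begin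
      hyperbolicSum H (p ∷ u₀) (r ∷ v₀)
        ≡⟨ hyperbolicSum-suc H p r u₀ v₀ ⟩
      ∑ₖ (λ x → ∑ᵥ (λ u → ∑ₖ (λ y → ∑ᵥ (λ v → f x u y v))))
        -- Since p ≠ 0, the first coordinate p l fixes the multiple l, and after the shift by
        -- `l · u₀` the vector u measures the distance from that multiple. The coordinate y is then
        -- exchanged for w = p y + u₀ · v.
        ≡⟨ ∑-affine p 0# p≢0 (λ l → sym (+-identityʳ (p ⊗ l))) (λ x → ∑ᵥ (λ u → ∑ₖ (λ y → ∑ᵥ (λ v → f x u y v)))) ⟨
      ∑ₖ (λ l → ∑ᵥ (λ u → ∑ₖ (λ y → ∑ᵥ (λ v → f (p ⊗ l) u y v))))
        ≡⟨ ∑-cong scalars (λ l → ∑ᵥ-shift (l · u₀) (λ u → ∑ₖ (λ y → ∑ᵥ (λ v → f (p ⊗ l) u y v)))) ⟨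
      ∑ₖ (λ l → ∑ᵥ (λ u → ∑ₖ (λ y → ∑ᵥ (λ v → f (p ⊗ l) (u ⊞ l · u₀) y v))))
        ≡⟨ ∑-cong scalars (λ l → ∑-cong (points n) λ u → ∑-swap scalars (points n) (λ y v → f (p ⊗ l) (u ⊞ l · u₀) y v)) ⟩
      ∑ₖ (λ l → ∑ᵥ (λ u → ∑ᵥ (λ v → ∑ₖ (λ y → f (p ⊗ l) (u ⊞ l · u₀) y v))))
        ≡⟨ ∑-cong scalars (λ l → ∑-cong (points n) λ u → ∑-cong (points n) λ v → ∑-cong scalars λ y → cong₂ H (first l u v y) (second l u v y)) ⟩
      ∑ₖ (λ l → ∑ᵥ (λ u → ∑ᵥ (λ v → ∑ₖ (λ y → g u l v (p ⊗ y ⊕ dot u₀ v)))))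
        ≡⟨ ∑-cong scalars (λ l → ∑-cong (points n) λ u → ∑-cong (points n) λ v → ∑-affine p (dot u₀ v) p≢0 (λ _ → refl) (g u l v)) ⟩
      ∑ₖ (λ l → ∑ᵥ (λ u → ∑ᵥ (λ v → ∑ₖ (g u l v))))
        ≡⟨ ∑-swap scalars (points n) (λ l u → ∑ᵥ (λ v → ∑ₖ (g u l v))) ⟩
      ∑ᵥ (λ u → ∑ₖ (λ l → ∑ᵥ (λ v → ∑ₖ (g u l v))))
        ≡⟨ ∑-split (points n) _≟ᵥ_ 0ᵥ (λ u → ∑ₖ (λ l → ∑ᵥ (λ v → ∑ₖ (g u l v)))) generic ⟩
      ∑ₖ (λ l → ∑ᵥ (λ v → ∑ₖ (g 0ᵥ l v)))
        ≡⟨ ∑-cong scalars (λ l → trans (∑-cong (points n) λ v → ∑-cong scalars λ w → cong₂ H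
             (trans (cong (l ⊗ w ⊕_) (dot-0ˡ v)) (+-identityʳ _))
             (trans (cong ((l ⊝ 1#) ⊗ (w ⊝ w₀) ⊕_) (dot-0ˡ (v ⊟ v₀))) (+-identityʳ _)))
             (∑ᵥ-const n (∑ₖ (λ w → H (l ⊗ w) ((l ⊝ 1#) ⊗ (w ⊝ w₀)))))) ⟩
      ∑ₖ (λ l → Q^ n * ∑ₖ (λ w → H (l ⊗ w) ((l ⊝ 1#) ⊗ (w ⊝ w₀))))
        ≡⟨ ∑-*ˡ scalars (Q^ n) (λ l → ∑ₖ (λ w → H (l ⊗ w) ((l ⊝ 1#) ⊗ (w ⊝ w₀)))) ⟩
      Q^ n * planeSum H w₀ ∎
      where
      open ≡-Reasoning
      w₀ : K
      w₀ = dot (p ∷ u₀) (r ∷ v₀)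
      f : K → Space n → K → Space n → ℤ
      f x u y v = H (x ⊗ y ⊕ dot u v) ((x ⊝ p) ⊗ (y ⊝ r) ⊕ dot (u ⊟ u₀) (v ⊟ v₀))
      g : Space n → K → Space n → K → ℤ
      g u l v w = H (l ⊗ w ⊕ dot u v) ((l ⊝ 1#) ⊗ (w ⊝ w₀) ⊕ dot u (v ⊟ v₀))
      first : ∀ l u v y → p ⊗ l ⊗ y ⊕ dot (u ⊞ l · u₀) v ≡ l ⊗ (p ⊗ y ⊕ dot u₀ v) ⊕ dot u v
      first l u v y = trans (cong (p ⊗ l ⊗ y ⊕_) (dot-shearˡ l u u₀ v))
        (solve 5 (λ p l y s t → p :* l :* y :+ (s :+ l :* t) := l :* (p :* y :+ t) :+ s) refl p l y (dot u v) (dot u₀ v))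
      second : ∀ l u v y → (p ⊗ l ⊝ p) ⊗ (y ⊝ r) ⊕ dot (u ⊞ l · u₀ ⊟ u₀) (v ⊟ v₀) ≡
               (l ⊝ 1#) ⊗ (p ⊗ y ⊕ dot u₀ v ⊝ w₀) ⊕ dot u (v ⊟ v₀)
      second l u v y = trans (cong ((p ⊗ l ⊝ p) ⊗ (y ⊝ r) ⊕_) (trans (dot-⊟ˡ (u ⊞ l · u₀) u₀ (v ⊟ v₀))
          (trans (cong (_⊝ dot u₀ (v ⊟ v₀)) (dot-shearˡ l u u₀ (v ⊟ v₀)))
            (cong (λ z → dot u (v ⊟ v₀) ⊕ l ⊗ z ⊝ z) (dot-⊟ʳ u₀ v v₀)))))
        (solve 7 (λ p l y r s t z → (p :* l :- p) :* (y :- r) :+ (s :+ l :* (t :- z) :- (t :- z)) :=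
            (l :- con 1ℤ) :* (p :* y :+ t :- (p :* r :+ z)) :+ s) refl p l y r (dot u (v ⊟ v₀)) (dot u₀ v) (dot u₀ v₀))
      -- Off the line, u · v is equidistributed and can be replaced by a free variable beside w, so
      -- a sheared total of H appears.
      generic : ∀ u → 0ᵥ ≢ u → ∑ₖ (λ l → ∑ᵥ (λ v → ∑ₖ (g u l v))) ≡ 0ℤ
      generic u 0≢u with dot-equidistributed u (0≢u ∘ sym)
      ... | N , equidistributed = ∑-zero scalars λ l → begin
        ∑ᵥ (λ v → ∑ₖ (g u l v))
          ≡⟨ ∑-cong (points n) (λ v → ∑-cong scalars λ w →
               cong (λ z → H (l ⊗ w ⊕ dot u v) ((l ⊝ 1#) ⊗ (w ⊝ w₀) ⊕ z)) (dot-⊟ʳ u v v₀)) ⟩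
        ∑ᵥ (λ v → ∑ₖ (λ w → H (l ⊗ w ⊕ dot u v) ((l ⊝ 1#) ⊗ (w ⊝ w₀) ⊕ (dot u v ⊝ dot u v₀))))
          ≡⟨ equidistributed (λ x → ∑ₖ (λ w → H (l ⊗ w ⊕ x) ((l ⊝ 1#) ⊗ (w ⊝ w₀) ⊕ (x ⊝ dot u v₀)))) ⟩
        N * ∑∑ (λ x w → H (l ⊗ w ⊕ x) ((l ⊝ 1#) ⊗ (w ⊝ w₀) ⊕ (x ⊝ dot u v₀)))
          ≡⟨ cong (N *_) (∑-sheared H ∑H≡0 l w₀ (dot u v₀)) ⟩
        N * 0ℤ
          ≡⟨ ℤₚ.*-zeroʳ N ⟩
        0ℤ ∎

    ∑∑-shift : (H : K → K → ℤ) → ∀ x y → ∑∑ (λ b c → H (x ⊕ b) (y ⊕ c)) ≡ ∑∑ H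
    ∑∑-shift H x y = trans (∑-cong scalars λ b → shift′ y (H (x ⊕ b))) (shift′ x (λ b → ∑ₖ (H b)))
      where
      shift′ : ∀ x (h : K → ℤ) → ∑ₖ (λ b → h (x ⊕ b)) ≡ ∑ₖ h
      shift′ x = ∑-affine 1# x 1≢0 (λ b → solve 2 (λ x b → x :+ b := con 1ℤ :* b :+ x) refl x b)

    -- Induction to the first nonzero coordinate of u₀. If the leading one is zero, the leading
    -- coordinates x and y merely translate H, which preserves its total. For x ≠ 0 the product x y
    -- sweeps the field and the sheared sum vanishes; for x = 0 the kernel is independent of y,
    -- which supplies a factor q.
    hyperbolicSum≡planeSum : (H : K → K → ℤ) → ∑∑ H ≡ 0ℤ → (u₀ v₀ : Space (suc n)) → u₀ ≢ 0ᵥ →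
      hyperbolicSum H u₀ v₀ ≡ Q^ n * planeSum H (dot u₀ v₀)
    hyperbolicSum≡planeSum {n} H ∑H≡0 (p ∷ u₀) (r ∷ v₀) pu₀≢0 with p ≟ 0#
    ... | no p≢0 = hyperbolicSum≡planeSum-head H ∑H≡0 p r u₀ v₀ p≢0
    hyperbolicSum≡planeSum {zero}  H ∑H≡0 (p ∷ []) (r ∷ v₀) pu₀≢0 | yes refl = ⊥-elim (pu₀≢0 refl)
    hyperbolicSum≡planeSum {suc n} H ∑H≡0 (p ∷ u₀) (r ∷ v₀) pu₀≢0 | yes refl = begin
      hyperbolicSum H (0# ∷ u₀) (r ∷ v₀)
        ≡⟨ hyperbolicSum-suc H 0# r u₀ v₀ ⟩
      ∑ₖ (λ x → ∑ᵥ (λ u → ∑ₖ (λ y → ∑ᵥ (λ v → H (x ⊗ y ⊕ dot u v) ((x ⊝ 0#) ⊗ (y ⊝ r) ⊕ dot (u ⊟ u₀) (v ⊟ v₀))))))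
        ≡⟨ ∑-cong scalars (λ x → ∑-swap (points (suc n)) scalars
             (λ u y → ∑ᵥ (λ v → H (x ⊗ y ⊕ dot u v) ((x ⊝ 0#) ⊗ (y ⊝ r) ⊕ dot (u ⊟ u₀) (v ⊟ v₀))))) ⟩
      ∑∑ (λ x y → hyperbolicSum (H′ x y) u₀ v₀)
        ≡⟨ ∑-cong scalars (λ x → ∑-cong scalars λ y → hyperbolicSum≡planeSum (H′ x y)
             (trans (∑∑-shift H (x ⊗ y) ((x ⊝ 0#) ⊗ (y ⊝ r))) ∑H≡0) u₀ v₀ (pu₀≢0 ∘ cong (0# ∷_))) ⟩
      ∑∑ (λ x y → Q^ n * planeSum (H′ x y) w₀)
        ≡⟨ ∑-cong scalars (λ x → ∑-*ˡ scalars (Q^ n) (λ y → planeSum (H′ x y) w₀)) ⟩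
      ∑ₖ (λ x → Q^ n * ∑ₖ (λ y → planeSum (H′ x y) w₀))
        ≡⟨ ∑-*ˡ scalars (Q^ n) (λ x → ∑ₖ (λ y → planeSum (H′ x y) w₀)) ⟩
      Q^ n * ∑∑ (λ x y → planeSum (H′ x y) w₀)
        ≡⟨ cong (Q^ n *_) (∑-split scalars _≟_ 0# (λ x → ∑ₖ (λ y → planeSum (H′ x y) w₀)) generic) ⟩
      Q^ n * ∑ₖ (λ y → planeSum (H′ 0# y) w₀)
        ≡⟨ cong (Q^ n *_) (trans (∑-cong scalars λ y → ∑-cong scalars λ l → ∑-cong scalars λ w → cong₂ H
             (solve 3 (λ y l w → con 0ℤ :* y :+ l :* w := l :* w) refl y l w)
             (solve 5 (λ y r l w w₀ → (con 0ℤ :- con 0ℤ) :* (y :- r) :+ (l :- con 1ℤ) :* (w :- w₀) :=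
                (l :- con 1ℤ) :* (w :- (con 0ℤ :* r :+ w₀))) refl y r l w w₀))
             (∑ₖ-const (planeSum H (0# ⊗ r ⊕ w₀)))) ⟩
      Q^ n * (Q * planeSum H (0# ⊗ r ⊕ w₀))
        ≡⟨ trans (sym (ℤₚ.*-assoc (Q^ n) Q (planeSum H (0# ⊗ r ⊕ w₀))))
             (cong (_* planeSum H (0# ⊗ r ⊕ w₀)) (trans (ℤₚ.*-comm (Q^ n) Q) (Q^suc n))) ⟩
      Q^ suc n * planeSum H (0# ⊗ r ⊕ w₀) ∎
      where
      open ≡-Reasoning
      w₀ : K
      w₀ = dot u₀ v₀
      H′ : K → K → K → K → ℤ
      H′ x y b c = H (x ⊗ y ⊕ b) ((x ⊝ 0#) ⊗ (y ⊝ r) ⊕ c)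
      generic : ∀ x → 0# ≢ x → ∑ₖ (λ y → planeSum (H′ x y) w₀) ≡ 0ℤ
      generic x 0≢x = begin
        ∑ₖ (λ y → ∑∑ (λ l w → H′ x y (l ⊗ w) ((l ⊝ 1#) ⊗ (w ⊝ w₀))))
          ≡⟨ ∑-swap scalars scalars (λ y l → ∑ₖ (λ w → H′ x y (l ⊗ w) ((l ⊝ 1#) ⊗ (w ⊝ w₀)))) ⟩
        ∑ₖ (λ l → ∑∑ (λ y w → H′ x y (l ⊗ w) ((l ⊝ 1#) ⊗ (w ⊝ w₀))))
          ≡⟨ ∑-zero scalars (λ l → begin
               ∑∑ (λ y w → H′ x y (l ⊗ w) ((l ⊝ 1#) ⊗ (w ⊝ w₀)))
                 ≡⟨ ∑-cong scalars (λ y → ∑-cong scalars λ w → cong₂ H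
                      (solve 4 (λ x y l w → x :* y :+ l :* w := l :* w :+ x :* y) refl x y l w)
                      (solve 6 (λ x y r l w w₀ → (x :- con 0ℤ) :* (y :- r) :+ (l :- con 1ℤ) :* (w :- w₀) :=
                        (l :- con 1ℤ) :* (w :- w₀) :+ (x :* y :- x :* r)) refl x y r l w w₀)) ⟩
               ∑∑ (λ y w → H (l ⊗ w ⊕ x ⊗ y) ((l ⊝ 1#) ⊗ (w ⊝ w₀) ⊕ (x ⊗ y ⊝ x ⊗ r)))
                 ≡⟨ ∑-affine x 0# (0≢x ∘ sym) (λ y → sym (+-identityʳ (x ⊗ y)))
                      (λ z → ∑ₖ (λ w → H (l ⊗ w ⊕ z) ((l ⊝ 1#) ⊗ (w ⊝ w₀) ⊕ (z ⊝ x ⊗ r)))) ⟩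
               ∑∑ (λ z w → H (l ⊗ w ⊕ z) ((l ⊝ 1#) ⊗ (w ⊝ w₀) ⊕ (z ⊝ x ⊗ r)))
                 ≡⟨ ∑-sheared H ∑H≡0 l w₀ (x ⊗ r) ⟩
               0ℤ ∎) ⟩
        0ℤ ∎

    -- The isometry of ‖_‖ with u · v ± t²

    ⊟-0ʳ : (u : Space n) → u ⊟ 0ᵥ ≡ u
    ⊟-0ʳ []      = refl
    ⊟-0ʳ (x ∷ u) = cong₂ _∷_ (solve 1 (λ x → x :- con 0ℤ := x) refl x) (⊟-0ʳ u)

    Coordinates : ℕ → Set a
    Coordinates m = K × Space m × Space m

    form : ∀ {m} → K → Coordinates m → K
    form κ (t , u , v) = dot u v ⊕ κ ⊗ (t ⊗ t)

    infixl 6 _⊟ᶜ_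
    _⊟ᶜ_ : ∀ {m} → Coordinates m → Coordinates m → Coordinates m
    (t , u , v) ⊟ᶜ (t₀ , u₀ , v₀) = t ⊝ t₀ , u ⊟ u₀ , v ⊟ v₀

    0ᶜ : ∀ {m} → Coordinates m
    0ᶜ = 0# , 0ᵥ , 0ᵥ

    coordinates : ∀ m → Enumeration (Coordinates m)
    coordinates m = scalars ×ₑ (points m ×ₑ points m)

    module Correlation (c : K → ℤ) (∑c≡0 : ∑ₖ c ≡ 0ℤ) (κ : K) (κ≢0 : κ ≢ 0#) where
      open Balanced c ∑c≡0

      term : K → K → K → K → ℤ
      term t₀ t x y = c (x ⊕ κ ⊗ (t ⊗ t)) * c (y ⊕ κ ⊗ ((t ⊝ t₀) ⊗ (t ⊝ t₀)))

      ∑-term : ∀ t₀ t → ∑∑ (term t₀ t) ≡ 0ℤ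
      ∑-term t₀ t = ∑-zero scalars λ x → trans
        (∑-*ˡ scalars (c (x ⊕ κ ⊗ (t ⊗ t))) (λ y → c (y ⊕ κ ⊗ ((t ⊝ t₀) ⊗ (t ⊝ t₀)))))
        (trans (cong (c (x ⊕ κ ⊗ (t ⊗ t)) *_) (trans (∑-shift (κ ⊗ ((t ⊝ t₀) ⊗ (t ⊝ t₀))) c) ∑c≡0))
               (ℤₚ.*-zeroʳ (c (x ⊕ κ ⊗ (t ⊗ t)))))

      -- For each t the kernel has total zero, so the hyperbolic part collapses to a plane counted
      -- q^(m-1) times. With t restored this is a ternary space, whose bound supplies the remaining
      -- factor q.
      planar-≤ : ∀ {m} t₀ (u₀ v₀ : Space m) → u₀ ≢ 0ᵥ → ∑ₖ (λ t → hyperbolicSum (term t₀ t) u₀ v₀) ≤ pos 2 * (Q^ m * C)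
      planar-≤ {zero}  t₀ [] v₀ u₀≢0 = ⊥-elim (u₀≢0 refl)
      planar-≤ {suc n} t₀ u₀ v₀ u₀≢0 = begin
        ∑ₖ (λ t → hyperbolicSum (term t₀ t) u₀ v₀)
          ≡⟨ ∑-cong scalars (λ t → hyperbolicSum≡planeSum (term t₀ t) (∑-term t₀ t) u₀ v₀ u₀≢0) ⟩
        ∑ₖ (λ t → Q^ n * planeSum (term t₀ t) (dot u₀ v₀))
          ≡⟨ ∑-*ˡ scalars (Q^ n) (λ t → planeSum (term t₀ t) (dot u₀ v₀)) ⟩
        Q^ n * ∑ₖ (λ t → planeSum (term t₀ t) (dot u₀ v₀))
          ≤⟨ *-monoˡ-0≤ (Q^ n) (+≤+ ℕ.z≤n) (ternary-≤ κ κ≢0 (dot u₀ v₀) t₀) ⟩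
        Q^ n * (pos 2 * (Q * C))
          ≡⟨ reorder (Q^ n) Q C ⟩
        pos 2 * (Q * Q^ n * C)
          ≡⟨ cong (λ i → pos 2 * (i * C)) (Q^suc n) ⟩
        pos 2 * (Q^ suc n * C) ∎
        where
        open ℤₚ.≤-Reasoning
        reorder : ∀ i j k → i * (pos 2 * (j * k)) ≡ pos 2 * (j * i * k)
        reorder = solve-∀

      -- For a displacement along t alone both arguments contain the same u · v, so there is no
      -- plane to reduce to. For u ≠ 0 that value is free, and the difference 2 κ t₀ t - κ t₀² of
      -- the arguments sweeps the field with t, giving the full autocorrelation sum 0. Only u = 0
      -- remains, with q^m choices of v.
      axial-≤ : ∀ m t₀ → t₀ ≢ 0# → ∑ₖ (λ t → hyperbolicSum (term t₀ t) (0ᵥ {m}) 0ᵥ) ≤ pos 2 * (Q^ m * C)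
      axial-≤ m t₀ t₀≢0 = begin
        ∑ₖ (λ t → hyperbolicSum (term t₀ t) (0ᵥ {m}) 0ᵥ)
          ≡⟨ ∑-cong scalars (λ t → ∑-cong (points m) λ u → ∑-cong (points m) λ v →
               cong (term t₀ t (dot u v)) (cong₂ dot (⊟-0ʳ u) (⊟-0ʳ v))) ⟩
        ∑ₖ (λ t → ∑ᵥ {m} (λ u → ∑ᵥ (λ v → term t₀ t (dot u v) (dot u v))))
          ≡⟨ ∑-swap scalars (points m) (λ t u → ∑ᵥ (λ v → term t₀ t (dot u v) (dot u v))) ⟩
        ∑ᵥ {m} (λ u → ∑ₖ (λ t → ∑ᵥ (λ v → term t₀ t (dot u v) (dot u v))))
          ≡⟨ ∑-split (points m) _≟ᵥ_ 0ᵥ (λ u → ∑ₖ (λ t → ∑ᵥ (λ v → term t₀ t (dot u v) (dot u v)))) generic ⟩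
        ∑ₖ (λ t → ∑ᵥ {m} (λ v → term t₀ t (dot 0ᵥ v) (dot 0ᵥ v)))
          ≡⟨ ∑-cong scalars (λ t → trans (∑-cong (points m) λ v → cong₂ (λ x y → c x * c y)
               (trans (cong (_⊕ κ ⊗ (t ⊗ t)) (dot-0ˡ v)) (+-identityˡ _))
               (trans (cong (_⊕ κ ⊗ ((t ⊝ t₀) ⊗ (t ⊝ t₀))) (dot-0ˡ v)) (+-identityˡ _)))
               (∑ᵥ-const m (pair t))) ⟩
        ∑ₖ (λ t → Q^ m * pair t)
          ≡⟨ trans (∑-*ˡ scalars (Q^ m) pair) (cong (Q^ m *_) (sym (ℤₚ.*-identityˡ (∑ₖ pair)))) ⟩
        Q^ m * (1ℤ * ∑ₖ pair)
          ≤⟨ *-monoˡ-0≤ (Q^ m) (+≤+ ℕ.z≤n) (∑-square-pairs-≤ 1ℤ refl c κ t₀ κ≢0) ⟩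
        Q^ m * (pos 2 * C)
          ≡⟨ reorder (Q^ m) C ⟩
        pos 2 * (Q^ m * C) ∎
        where
        open ℤₚ.≤-Reasoning
        reorder : ∀ i j → i * (pos 2 * j) ≡ pos 2 * (i * j)
        reorder = solve-∀
        pair : K → ℤ
        pair t = c (κ ⊗ (t ⊗ t)) * c (κ ⊗ ((t ⊝ t₀) ⊗ (t ⊝ t₀)))
        slope : K
        slope = (1# ⊕ 1#) ⊗ (κ ⊗ t₀)
        diagonal : ∑∑ (λ t x → term t₀ t x x) ≡ 0ℤ
        diagonal = trans (∑-cong scalars λ t → trans
            (∑-cong scalars λ x → cong (λ y → c (x ⊕ κ ⊗ (t ⊗ t)) * c y)
              (solve 4 (λ κ t t₀ x → x :+ κ :* ((t :- t₀) :* (t :- t₀)) :=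
                x :+ κ :* (t :* t) :- ((con 1ℤ :+ con 1ℤ) :* (κ :* t₀) :* t :+ (:- (κ :* (t₀ :* t₀))))) refl κ t t₀ x))
            (∑-shift (κ ⊗ (t ⊗ t)) (λ x → c x * c (x ⊝ (slope ⊗ t ⊕ ⊖ (κ ⊗ (t₀ ⊗ t₀)))))))
          (trans (∑-affine slope (⊖ (κ ⊗ (t₀ ⊗ t₀))) (⊗≢0 2≢0 (⊗≢0 κ≢0 t₀≢0)) (λ _ → refl)
            (λ k → ∑ₖ (λ x → c x * c (x ⊝ k)))) ∑-autocorrelation)
        generic : ∀ (u : Space m) → 0ᵥ ≢ u → ∑ₖ (λ t → ∑ᵥ (λ v → term t₀ t (dot u v) (dot u v))) ≡ 0ℤ
        generic u 0≢u with dot-equidistributed u (0≢u ∘ sym)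
        ... | N , equidistributed = trans (∑-cong scalars λ t → equidistributed (λ x → term t₀ t x x))
          (trans (∑-*ˡ scalars N (λ t → ∑ₖ (λ x → term t₀ t x x))) (trans (cong (N *_) diagonal) (ℤₚ.*-zeroʳ N)))

      form-correlation-≤ : ∀ {m} (z : Coordinates m) → z ≢ 0ᶜ →
        ∑ (coordinates m) (λ y → c (form κ y) * c (form κ (y ⊟ᶜ z))) ≤ pos 2 * (Q^ m * C)
      form-correlation-≤ {m} (t₀ , u₀ , v₀) z≢0 = subst (_≤ pos 2 * (Q^ m * C)) (sym nested) bound
        where
        nested : ∑ (coordinates m) (λ y → c (form κ y) * c (form κ (y ⊟ᶜ (t₀ , u₀ , v₀)))) ≡
                 ∑ₖ (λ t → hyperbolicSum (term t₀ t) u₀ v₀)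
        nested = trans (∑-×ₑ scalars (points m ×ₑ points m) (λ y → c (form κ y) * c (form κ (y ⊟ᶜ (t₀ , u₀ , v₀)))))
          (∑-cong scalars λ t → ∑-×ₑ (points m) (points m) (λ y → c (form κ (t , y)) * c (form κ ((t , y) ⊟ᶜ (t₀ , u₀ , v₀)))))
        -- The form is symmetric in u and v, so v₀ ≠ 0 can take over the part of u₀ ≠ 0.
        exchange : ∀ t → hyperbolicSum (term t₀ t) v₀ u₀ ≡ hyperbolicSum (term t₀ t) u₀ v₀
        exchange t = trans (∑-swap (points m) (points m) (λ u v → term t₀ t (dot u v) (dot (u ⊟ v₀) (v ⊟ u₀))))
          (∑-cong (points m) λ u → ∑-cong (points m) λ v → cong₂ (term t₀ t) (dot-comm v u) (dot-comm (v ⊟ v₀) (u ⊟ u₀)))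
        bound : ∑ₖ (λ t → hyperbolicSum (term t₀ t) u₀ v₀) ≤ pos 2 * (Q^ m * C)
        bound with u₀ ≟ᵥ 0ᵥ | v₀ ≟ᵥ 0ᵥ
        ... | no u₀≢0  | _        = planar-≤ t₀ u₀ v₀ u₀≢0
        ... | yes _    | no v₀≢0  = subst (_≤ pos 2 * (Q^ m * C)) (∑-cong scalars exchange) (planar-≤ t₀ v₀ u₀ v₀≢0)
        ... | yes refl | yes refl = axial-≤ m t₀ (λ { refl → z≢0 refl })

    -- Linearity is recorded as compatibility with subtraction, which is what carries translates to
    -- translates.
    record Isometry (d m : ℕ) (κ : K) : Set a where
      field
        to       : Space d → Coordinates m
        from     : Coordinates m → Space d
        from∘to  : ∀ x → from (to x) ≡ x
        to∘from  : ∀ y → to (from y) ≡ y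
        to-⊟     : ∀ x y → to (x ⊟ y) ≡ to x ⊟ᶜ to y
        form-to  : ∀ x → ‖ x ‖ ≡ form κ (to x)

    cong₃ : ∀ {b} {B : Set b} {x x′ y y′ z z′} (f : K → K → K → B) → x ≡ x′ → y ≡ y′ → z ≡ z′ → f x y z ≡ f x′ y′ z′
    cong₃ f refl refl refl = refl

    -- x² + y² + κt² = uv - κt′² under an invertible linear substitution.
    record TernaryStep (κ : K) : Set a where
      field
        u v t   : K → K → K → K
        x y t⁻¹ : K → K → K → K
        x-uvt   : ∀ a b c → x (u a b c) (v a b c) (t a b c) ≡ a
        y-uvt   : ∀ a b c → y (u a b c) (v a b c) (t a b c) ≡ b
        t-uvt   : ∀ a b c → t⁻¹ (u a b c) (v a b c) (t a b c) ≡ c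
        u-xyt   : ∀ a b c → u (x a b c) (y a b c) (t⁻¹ a b c) ≡ a
        v-xyt   : ∀ a b c → v (x a b c) (y a b c) (t⁻¹ a b c) ≡ b
        t-xyt   : ∀ a b c → t (x a b c) (y a b c) (t⁻¹ a b c) ≡ c
        u-⊝     : ∀ a b c a′ b′ c′ → u (a ⊝ a′) (b ⊝ b′) (c ⊝ c′) ≡ u a b c ⊝ u a′ b′ c′
        v-⊝     : ∀ a b c a′ b′ c′ → v (a ⊝ a′) (b ⊝ b′) (c ⊝ c′) ≡ v a b c ⊝ v a′ b′ c′
        t-⊝     : ∀ a b c a′ b′ c′ → t (a ⊝ a′) (b ⊝ b′) (c ⊝ c′) ≡ t a b c ⊝ t a′ b′ c′
        form-uvt : ∀ a b c → a ⊗ a ⊕ (b ⊗ b ⊕ κ ⊗ (c ⊗ c)) ≡ u a b c ⊗ v a b c ⊕ ⊖ κ ⊗ (t a b c ⊗ t a b c)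

    -- The old coordinate t joins the two new ones in a ternary form, which splits into a hyperbolic
    -- pair and a new t. The coefficient of t² changes sign, so starting from 1 it alternates
    -- between 1 and - 1.
    extend : ∀ {d m κ} → TernaryStep κ → Isometry d m κ → Isometry (suc (suc d)) (suc m) (⊖ κ)
    extend {d} {m} {κ} step iso = record
      { to = to′ ; from = from′ ; from∘to = from∘to′ ; to∘from = to∘from′ ; to-⊟ = to-⊟′ ; form-to = form-to′ }
      where
      open TernaryStep step
      open Isometry iso
      enlarge : K → K → Coordinates m → Coordinates (suc m)
      enlarge a b (c , us , vs) = t a b c , u a b c ∷ us , v a b c ∷ vs
      to′ : Space (suc (suc d)) → Coordinates (suc m)
      to′ (a ∷ b ∷ xs) = enlarge a b (to xs)
      from′ : Coordinates (suc m) → Space (suc (suc d))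
      from′ (c , a ∷ us , b ∷ vs) = x a b c ∷ y a b c ∷ from (t⁻¹ a b c , us , vs)
      from-enlarge : ∀ a b y → from′ (enlarge a b y) ≡ a ∷ b ∷ from y
      from-enlarge a b (c , us , vs) = cong₃ (λ i j k → i ∷ j ∷ from (k , us , vs)) (x-uvt a b c) (y-uvt a b c) (t-uvt a b c)
      from∘to′ : ∀ xs → from′ (to′ xs) ≡ xs
      from∘to′ (a ∷ b ∷ xs) = trans (from-enlarge a b (to xs)) (cong (λ ys → a ∷ b ∷ ys) (from∘to xs))
      to∘from′ : ∀ y → to′ (from′ y) ≡ y
      to∘from′ (c , a ∷ us , b ∷ vs) = trans (cong (enlarge (x a b c) (y a b c)) (to∘from (t⁻¹ a b c , us , vs)))
        (cong₃ (λ i j k → k , i ∷ us , j ∷ vs) (u-xyt a b c) (v-xyt a b c) (t-xyt a b c))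
      enlarge-⊟ : ∀ a b y a′ b′ y′ → enlarge (a ⊝ a′) (b ⊝ b′) (y ⊟ᶜ y′) ≡ enlarge a b y ⊟ᶜ enlarge a′ b′ y′
      enlarge-⊟ a b (c , us , vs) a′ b′ (c′ , us′ , vs′) =
        cong₃ (λ i j k → k , i ∷ (us ⊟ us′) , j ∷ (vs ⊟ vs′)) (u-⊝ a b c a′ b′ c′) (v-⊝ a b c a′ b′ c′) (t-⊝ a b c a′ b′ c′)
      to-⊟′ : ∀ xs ys → to′ (xs ⊟ ys) ≡ to′ xs ⊟ᶜ to′ ys
      to-⊟′ (a ∷ b ∷ xs) (a′ ∷ b′ ∷ ys) = trans (cong (enlarge (a ⊝ a′) (b ⊝ b′)) (to-⊟ xs ys)) (enlarge-⊟ a b (to xs) a′ b′ (to ys))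
      form-enlarge : ∀ a b y → a ⊗ a ⊕ (b ⊗ b ⊕ form κ y) ≡ form (⊖ κ) (enlarge a b y)
      form-enlarge a b (c , us , vs) = trans
        (solve 4 (λ a b s z → a :+ (b :+ (s :+ z)) := s :+ (a :+ (b :+ z))) refl (a ⊗ a) (b ⊗ b) (dot us vs) (κ ⊗ (c ⊗ c)))
        (trans (cong (dot us vs ⊕_) (form-uvt a b c))
          (solve 3 (λ s p z → s :+ (p :+ z) := p :+ s :+ z) refl (dot us vs) (u a b c ⊗ v a b c) (⊖ κ ⊗ (t a b c ⊗ t a b c))))
      form-to′ : ∀ xs → ‖ xs ‖ ≡ form (⊖ κ) (to′ xs)
      form-to′ (a ∷ b ∷ xs) = trans (cong (λ z → a ⊗ a ⊕ (b ⊗ b ⊕ z)) (form-to xs)) (form-enlarge a b (to xs))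

    half : K
    half = proj₁ (inverse (1# ⊕ 1#) 2≢0)

    half-double : ∀ x → half ⊗ (x ⊕ x) ≡ x
    half-double x = trans (solve 2 (λ h x → h :* (x :+ x) := (con 1ℤ :+ con 1ℤ) :* h :* x) refl half x)
      (trans (cong (_⊗ x) (proj₂ (inverse (1# ⊕ 1#) 2≢0))) (*-identityˡ x))

    halve : ∀ {x y} → x ≡ y ⊕ y → half ⊗ x ≡ y
    halve {y = y} refl = half-double y

    -- x² + y² - t² = (x - t)(x + t) + y²
    step⁻ : TernaryStep (⊖ 1#)
    step⁻ = record
      { u = λ a b c → a ⊝ c ; v = λ a b c → a ⊕ c ; t = λ a b c → b
      ; x = λ a b c → half ⊗ (a ⊕ b) ; y = λ a b c → c ; t⁻¹ = λ a b c → half ⊗ (b ⊝ a)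
      ; x-uvt = λ a b c → halve (solve 2 (λ a c → (a :- c) :+ (a :+ c) := a :+ a) refl a c)
      ; y-uvt = λ a b c → refl
      ; t-uvt = λ a b c → halve (solve 2 (λ a c → (a :+ c) :- (a :- c) := c :+ c) refl a c)
      ; u-xyt = λ a b c → trans (solve 3 (λ h a b → h :* (a :+ b) :- h :* (b :- a) := h :* (a :+ a)) refl half a b) (half-double a)
      ; v-xyt = λ a b c → trans (solve 3 (λ h a b → h :* (a :+ b) :+ h :* (b :- a) := h :* (b :+ b)) refl half a b) (half-double b)
      ; t-xyt = λ a b c → refl
      ; u-⊝ = λ a b c a′ b′ c′ → solve 4 (λ a c a′ c′ → (a :- a′) :- (c :- c′) := (a :- c) :- (a′ :- c′)) refl a c a′ c′
      ; v-⊝ = λ a b c a′ b′ c′ → solve 4 (λ a c a′ c′ → (a :- a′) :+ (c :- c′) := (a :+ c) :- (a′ :+ c′)) refl a c a′ c′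
      ; t-⊝ = λ a b c a′ b′ c′ → refl
      ; form-uvt = solve 3 (λ a b c → a :* a :+ (b :* b :+ (:- con 1ℤ) :* (c :* c)) :=
                                     (a :- c) :* (a :+ c) :+ (:- (:- con 1ℤ)) :* (b :* b)) refl
      }

    -- With α² + β² = -1, the rotated coordinates X = αx + βy and Y = βx - αy satisfy x² + y² = -X² - Y²,
    -- so x² + y² + t² = (t - X)(t + X) - Y².
    step⁺ : TernaryStep 1#
    step⁺ with -1-sum-of-squares
    ... | α , β , α²+β²≡-1 = record
      { u = λ a b c → c ⊝ X a b ; v = λ a b c → c ⊕ X a b ; t = λ a b c → Y a b
      ; x = λ a b c → ⊖ X (half ⊗ (b ⊝ a)) c ; y = λ a b c → ⊖ Y (half ⊗ (b ⊝ a)) c ; t⁻¹ = λ a b c → half ⊗ (a ⊕ b)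
      ; x-uvt = λ a b c → trans (cong (λ z → ⊖ X z (Y a b)) (X-half a b c)) (X-rotated a b)
      ; y-uvt = λ a b c → trans (cong (λ z → ⊖ Y z (Y a b)) (X-half a b c)) (Y-rotated a b)
      ; t-uvt = λ a b c → halve (solve 2 (λ c x → (c :- x) :+ (c :+ x) := c :+ c) refl c (X a b))
      ; u-xyt = λ a b c → trans (cong (half ⊗ (a ⊕ b) ⊝_) (X-unrotated (half ⊗ (b ⊝ a)) c))
                  (trans (solve 3 (λ h a b → h :* (a :+ b) :- h :* (b :- a) := h :* (a :+ a)) refl half a b) (half-double a))
      ; v-xyt = λ a b c → trans (cong (half ⊗ (a ⊕ b) ⊕_) (X-unrotated (half ⊗ (b ⊝ a)) c))
                  (trans (solve 3 (λ h a b → h :* (a :+ b) :+ h :* (b :- a) := h :* (b :+ b)) refl half a b) (half-double b))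
      ; t-xyt = λ a b c → Y-unrotated (half ⊗ (b ⊝ a)) c
      ; u-⊝ = solve 8 (λ α β a b c a′ b′ c′ → (c :- c′) :- (α :* (a :- a′) :+ β :* (b :- b′)) :=
                (c :- (α :* a :+ β :* b)) :- (c′ :- (α :* a′ :+ β :* b′))) refl α β
      ; v-⊝ = solve 8 (λ α β a b c a′ b′ c′ → (c :- c′) :+ (α :* (a :- a′) :+ β :* (b :- b′)) :=
                (c :+ (α :* a :+ β :* b)) :- (c′ :+ (α :* a′ :+ β :* b′))) refl α β
      ; t-⊝ = solve 8 (λ α β a b c a′ b′ c′ → β :* (a :- a′) :- α :* (b :- b′) :=
                (β :* a :- α :* b) :- (β :* a′ :- α :* b′)) refl α β
      ; form-uvt = λ a b c → trans
          (solve 3 (λ a b c → a :* a :+ (b :* b :+ con 1ℤ :* (c :* c)) := c :* c :- (:- con 1ℤ) :* (a :* a :+ b :* b)) refl a b c)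
          (trans (cong (λ z → c ⊗ c ⊝ z ⊗ (a ⊗ a ⊕ b ⊗ b)) (sym α²+β²≡-1))
            (solve 5 (λ α β a b c → c :* c :- (α :* α :+ β :* β) :* (a :* a :+ b :* b) :=
              (c :- (α :* a :+ β :* b)) :* (c :+ (α :* a :+ β :* b)) :+ (:- con 1ℤ) :* ((β :* a :- α :* b) :* (β :* a :- α :* b))) refl α β a b c))
      }
      where
      X Y : K → K → K
      X a b = α ⊗ a ⊕ β ⊗ b
      Y a b = β ⊗ a ⊝ α ⊗ b
      X-half : ∀ a b c → half ⊗ ((c ⊕ X a b) ⊝ (c ⊝ X a b)) ≡ X a b
      X-half a b c = halve (solve 2 (λ c x → (c :+ x) :- (c :- x) := x :+ x) refl c (X a b))
      -- Applying (X , Y) twice multiplies by α² + β² = - 1, so its negative is its inverse.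
      by-norm : ∀ {z} x → z ≡ ⊖ (α ⊗ α ⊕ β ⊗ β) ⊗ x → z ≡ x
      by-norm x eq = trans eq (trans (cong (λ n → ⊖ n ⊗ x) α²+β²≡-1) (solve 1 (λ x → (:- (:- con 1ℤ)) :* x := x) refl x))
      X-rotated : ∀ a b → ⊖ X (X a b) (Y a b) ≡ a
      X-rotated a b = by-norm a (solve 4 (λ α β a b → :- (α :* (α :* a :+ β :* b) :+ β :* (β :* a :- α :* b)) :=
        (:- (α :* α :+ β :* β)) :* a) refl α β a b)
      Y-rotated : ∀ a b → ⊖ Y (X a b) (Y a b) ≡ b
      Y-rotated a b = by-norm b (solve 4 (λ α β a b → :- (β :* (α :* a :+ β :* b) :- α :* (β :* a :- α :* b)) :=
        (:- (α :* α :+ β :* β)) :* b) refl α β a b)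
      X-unrotated : ∀ a b → X (⊖ X a b) (⊖ Y a b) ≡ a
      X-unrotated a b = by-norm a (solve 4 (λ α β a b → α :* (:- (α :* a :+ β :* b)) :+ β :* (:- (β :* a :- α :* b)) :=
        (:- (α :* α :+ β :* β)) :* a) refl α β a b)
      Y-unrotated : ∀ a b → Y (⊖ X a b) (⊖ Y a b) ≡ b
      Y-unrotated a b = by-norm b (solve 4 (λ α β a b → β :* (:- (α :* a :+ β :* b)) :- α :* (:- (β :* a :- α :* b)) :=
        (:- (α :* α :+ β :* β)) :* b) refl α β a b)

    isometry₁ : Isometry 1 0 1#
    isometry₁ = record
      { to = λ { (x ∷ []) → x , [] , [] } ; from = λ { (t , [] , []) → t ∷ [] }
      ; from∘to = λ { (x ∷ []) → refl } ; to∘from = λ { (t , [] , []) → refl }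
      ; to-⊟ = λ { (x ∷ []) (y ∷ []) → refl }
      ; form-to = λ { (x ∷ []) → solve 1 (λ x → x :* x :+ con 0ℤ := con 0ℤ :+ con 1ℤ :* (x :* x)) refl x }
      }

    isometry : ∀ m → Isometry (suc (m ℕ.* 2)) m 1# ⊎ Isometry (suc (m ℕ.* 2)) m (⊖ 1#)
    isometry zero    = inj₁ isometry₁
    isometry (suc m) with isometry m
    ... | inj₁ iso = inj₂ (extend step⁺ iso)
    ... | inj₂ iso = inj₁ (subst (Isometry _ _) (solve 0 (:- (:- con 1ℤ) := con 1ℤ) refl) (extend step⁻ iso))

    -- Correlations of distances

    ⊟-self : (x : Space n) → x ⊟ x ≡ 0ᵥ
    ⊟-self []      = refl
    ⊟-self (a ∷ x) = cong₂ _∷_ (x≡y⇒x⊝y≡0 refl) (⊟-self x)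

    ⊟-involutive : (x y : Space n) → x ⊟ (x ⊟ y) ≡ y
    ⊟-involutive []      []      = refl
    ⊟-involutive (a ∷ x) (b ∷ y) = cong₂ _∷_ (solve 2 (λ a b → a :- (a :- b) := b) refl a b) (⊟-involutive x y)

    ⊟-rebase : (x x′ y : Space n) → x′ ⊟ y ≡ (x ⊟ y) ⊟ (x ⊟ x′)
    ⊟-rebase []      []        []      = refl
    ⊟-rebase (a ∷ x) (a′ ∷ x′) (b ∷ y) =
      cong₂ _∷_ (solve 3 (λ a a′ b → a′ :- b := (a :- b) :- (a :- a′)) refl a a′ b) (⊟-rebase x x′ y)

    module _ (c : K → ℤ) (∑c≡0 : ∑ₖ c ≡ 0ℤ) where
      open Balanced c ∑c≡0 using (C)

      -- Since x′ - y = (x - y) - (x - x′), the substitution of x - y for y leaves a translate by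
      -- the fixed nonzero vector x - x′, which the isometry carries over to coordinates.
      isometric-correlation-≤ : ∀ {d m κ} → κ ≢ 0# → Isometry d m κ → (x x′ : Space d) → x ≢ x′ →
        ∑ᵥ (λ y → c ‖ x ⊟ y ‖ * c ‖ x′ ⊟ y ‖) ≤ pos 2 * (Q^ m * C)
      isometric-correlation-≤ {d} {m} {κ} κ≢0 iso x x′ x≢x′ = subst (_≤ pos 2 * (Q^ m * C)) (sym transported)
        (Correlation.form-correlation-≤ c ∑c≡0 κ κ≢0 z z≢0)
        where
        open Isometry iso
        open ≡-Reasoning
        z : Coordinates m
        z = to (x ⊟ x′)
        to-injective : ∀ {y y′} → to y ≡ to y′ → y ≡ y′
        to-injective {y} {y′} eq = trans (sym (from∘to y)) (trans (cong from eq) (from∘to y′))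
        z≢0 : z ≢ 0ᶜ
        z≢0 z≡0 = x≢x′ (trans (sym (⊟-involutive x x)) (trans (cong (x ⊟_) (sym x⊟x′≡x⊟x)) (⊟-involutive x x′)))
          where
          x⊟x′≡x⊟x : x ⊟ x′ ≡ x ⊟ x
          x⊟x′≡x⊟x = to-injective (trans z≡0 (sym (trans (to-⊟ x x)
            (cong₂ _,_ (x≡y⇒x⊝y≡0 refl) (cong₂ _,_ (⊟-self _) (⊟-self _))))))
        g : Coordinates m → ℤ
        g y = c (form κ y) * c (form κ (y ⊟ᶜ z))
        transported : ∑ᵥ (λ y → c ‖ x ⊟ y ‖ * c ‖ x′ ⊟ y ‖) ≡ ∑ (coordinates m) g
        transported = trans
          (∑-cong (points d) λ y → cong₂ (λ s t → c s * c t) (form-to (x ⊟ y))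
            (trans (cong ‖_‖ (⊟-rebase x x′ y)) (trans (form-to ((x ⊟ y) ⊟ (x ⊟ x′))) (cong (form κ) (to-⊟ (x ⊟ y) (x ⊟ x′))))))
          (∑-reindex (points d) (coordinates m) (λ y → to (x ⊟ y)) (λ w → x ⊟ from w)
            (λ y → trans (cong (x ⊟_) (from∘to (x ⊟ y))) (⊟-involutive x y))
            (λ w → trans (cong to (⊟-involutive x (from w))) (to∘from w)) g)

      correlation-≤ : ∀ m (x x′ : Space (suc (m ℕ.* 2))) → x ≢ x′ →
        ∑ᵥ (λ y → c ‖ x ⊟ y ‖ * c ‖ x′ ⊟ y ‖) ≤ pos 2 * (Q^ m * C)
      correlation-≤ m with isometry m
      ... | inj₁ iso = isometric-correlation-≤ 1≢0 iso
      ... | inj₂ iso = isometric-correlation-≤ (⊖≢0 1≢0) iso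

    -- Once the other coordinates are fixed, the first one enters through a translated square, which
    -- is at most two-to-one. With h = c² this bounds the correlation for x = x′.
    ∑-distances-≤ : (h : K → ℤ) → (∀ t → 0ℤ ≤ h t) → (x : Space (suc n)) → ∑ᵥ (λ y → h ‖ x ⊟ y ‖) ≤ pos 2 * (Q^ n * ∑ₖ h)
    ∑-distances-≤ {n} h 0≤h (a ∷ x) = begin
      ∑ᵥ (λ y → h ‖ (a ∷ x) ⊟ y ‖)
        ≡⟨ ∑ᵥ-suc (λ y → h ‖ (a ∷ x) ⊟ y ‖) ⟩
      ∑ₖ (λ b → ∑ᵥ (λ y → h ((a ⊝ b) ⊗ (a ⊝ b) ⊕ ‖ x ⊟ y ‖)))
        ≡⟨ ∑-swap scalars (points n) (λ b y → h ((a ⊝ b) ⊗ (a ⊝ b) ⊕ ‖ x ⊟ y ‖)) ⟩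
      ∑ᵥ (λ y → ∑ₖ (λ b → h ((a ⊝ b) ⊗ (a ⊝ b) ⊕ ‖ x ⊟ y ‖)))
        ≡⟨ ∑-cong (points n) (λ y → ∑-affine (⊖ 1#) a (⊖≢0 1≢0)
             (λ b → solve 2 (λ a b → a :- b := (:- con 1ℤ) :* b :+ a) refl a b) (λ s → h (s ⊗ s ⊕ ‖ x ⊟ y ‖))) ⟩
      ∑ᵥ (λ y → ∑ₖ (λ s → h (s ⊗ s ⊕ ‖ x ⊟ y ‖)))
        ≡⟨ ∑-cong (points n) (λ y → ∑-cong scalars λ s → cong (λ z → h (z ⊕ ‖ x ⊟ y ‖)) (sym (*-identityˡ (s ⊗ s)))) ⟩
      ∑ᵥ (λ y → ∑ₖ (λ s → h (1# ⊗ (s ⊗ s) ⊕ ‖ x ⊟ y ‖)))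
        ≤⟨ ∑-mono (points n) (λ y → ∑-squares-≤ 1# ‖ x ⊟ y ‖ 1≢0 h 0≤h) ⟩
      ∑ᵥ {n} (λ y → pos 2 * ∑ₖ h)
        ≡⟨ ∑ᵥ-const n (pos 2 * ∑ₖ h) ⟩
      Q^ n * (pos 2 * ∑ₖ h)
        ≡⟨ reorder (Q^ n) (∑ₖ h) ⟩
      pos 2 * (Q^ n * ∑ₖ h) ∎
      where
      open ℤₚ.≤-Reasoning
      reorder : ∀ i j → i * (pos 2 * j) ≡ pos 2 * (i * j)
      reorder = solve-∀

    module _ (c : K → ℤ) (∑c≡0 : ∑ₖ c ≡ 0ℤ) (m : ℕ)
             (e : Space (suc (m ℕ.* 2)) → ℤ) (0≤e : ∀ x → 0ℤ ≤ e x) (e²≡e : ∀ x → e x * e x ≡ e x) where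
      open Balanced c ∑c≡0 using (C)

      -- Expanding the square gives correlations over pairs x , x′. As `off` is nonnegative it may
      -- be charged to all |E|² pairs, diagonal included, with `diag` added for the |E| pairs x =
      -- x′.
      gram-≤ : ∑ᵥ (λ y → ∑ᵥ (λ x → e x * c ‖ x ⊟ y ‖) * ∑ᵥ (λ x → e x * c ‖ x ⊟ y ‖)) ≤
               (pos 2 * (Q^ (m ℕ.* 2) * ∑ᵥ e) + pos 2 * (Q^ m * (∑ᵥ e * ∑ᵥ e))) * C
      gram-≤ = begin
        ∑ᵥ (λ y → ∑ᵥ (λ x → g x y) * ∑ᵥ (λ x → g x y))
          ≡⟨ ∑-cong 𝒫 (λ y → ∑-square 𝒫 (λ x → g x y)) ⟩
        ∑ᵥ (λ y → ∑ᵥ (λ x → ∑ᵥ (λ x′ → g x y * g x′ y)))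
          ≡⟨ ∑-swap-inner 𝒫 𝒫 𝒫 (λ x x′ y → g x y * g x′ y) ⟨
        ∑ᵥ (λ x → ∑ᵥ (λ x′ → ∑ᵥ (λ y → g x y * g x′ y)))
          ≡⟨ ∑-cong 𝒫 (λ x → ∑-cong 𝒫 λ x′ → trans
               (∑-cong 𝒫 λ y → factor (e x) (c ‖ x ⊟ y ‖) (e x′) (c ‖ x′ ⊟ y ‖)) (∑-*ˡ 𝒫 (e x * e x′) (R x x′))) ⟩
        ∑ᵥ (λ x → ∑ᵥ (λ x′ → e x * e x′ * ∑ᵥ (R x x′)))
          ≤⟨ ∑-mono 𝒫 (λ x → ∑-mono 𝒫 λ x′ → pointwise x x′) ⟩
        ∑ᵥ (λ x → ∑ᵥ (λ x′ → e x * off * e x′ + diag * (𝟙 (x ≟ᵥ x′) * (e x * e x′))))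
          ≡⟨ ∑-cong 𝒫 (λ x → trans (∑-lin₂ 𝒫 (e x * off) e diag (λ x′ → 𝟙 (x ≟ᵥ x′) * (e x * e x′)))
               (cong₂ (λ i j → i + diag * j) (swap₁₃ (e x) off (∑ᵥ e))
                 (trans (∑-δ 𝒫 _≟ᵥ_ x (λ x′ → e x * e x′)) (e²≡e x)))) ⟩
        ∑ᵥ (λ x → off * ∑ᵥ e * e x + diag * e x)
          ≡⟨ ∑-lin₂ 𝒫 (off * ∑ᵥ e) e diag e ⟩
        off * ∑ᵥ e * ∑ᵥ e + diag * ∑ᵥ e
          ≡⟨ collect (Q^ m) (Q^ (m ℕ.* 2)) C (∑ᵥ e) ⟩
        (pos 2 * (Q^ (m ℕ.* 2) * ∑ᵥ e) + pos 2 * (Q^ m * (∑ᵥ e * ∑ᵥ e))) * C ∎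
        where
        open ℤₚ.≤-Reasoning
        𝒫 : Enumeration (Space (suc (m ℕ.* 2)))
        𝒫 = points (suc (m ℕ.* 2))
        g : Space (suc (m ℕ.* 2)) → Space (suc (m ℕ.* 2)) → ℤ
        g x y = e x * c ‖ x ⊟ y ‖
        R : Space (suc (m ℕ.* 2)) → Space (suc (m ℕ.* 2)) → Space (suc (m ℕ.* 2)) → ℤ
        R x x′ y = c ‖ x ⊟ y ‖ * c ‖ x′ ⊟ y ‖
        off diag : ℤ
        off  = pos 2 * (Q^ m * C)
        diag = pos 2 * (Q^ (m ℕ.* 2) * C)
        0≤off : 0ℤ ≤ off
        0≤off = 0≤i*j {pos 2} (+≤+ ℕ.z≤n) (0≤i*j {Q^ m} (+≤+ ℕ.z≤n) (∑-nonneg scalars λ t → 0≤i*i (c t)))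
        factor : ∀ i j k l → i * j * (k * l) ≡ i * k * (j * l)
        factor = solve-∀
        swap₁₃ : ∀ i j k → i * j * k ≡ j * k * i
        swap₁₃ = solve-∀
        collect : ∀ i j k l → pos 2 * (i * k) * l * l + pos 2 * (j * k) * l ≡ (pos 2 * (j * l) + pos 2 * (i * (l * l))) * k
        collect = solve-∀
        pointwise : ∀ x x′ → e x * e x′ * ∑ᵥ (R x x′) ≤ e x * off * e x′ + diag * (𝟙 (x ≟ᵥ x′) * (e x * e x′))
        pointwise x x′ with x ≟ᵥ x′
        ... | no x≢x′  = subst (e x * e x′ * ∑ᵥ (R x x′) ≤_) (off-diagonal (e x) (e x′) off diag)
          (*-monoˡ-0≤ (e x * e x′) (0≤i*j (0≤e x) (0≤e x′)) (correlation-≤ c ∑c≡0 m x x′ x≢x′))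
          where
          off-diagonal : ∀ i j k l → i * j * k ≡ i * k * j + l * (0ℤ * (i * j))
          off-diagonal = solve-∀
        ... | yes refl = subst (e x * e x * ∑ᵥ (R x x) ≤_) (on-diagonal (e x) off diag)
          (*-monoˡ-0≤ (e x * e x) (0≤i*i (e x)) (ℤₚ.≤-trans (∑-distances-≤ (λ t → c t * c t) (λ t → 0≤i*i (c t)) x)
            (ℤₚ.≤-trans (ℤₚ.≤-reflexive (sym (ℤₚ.+-identityˡ diag))) (ℤₚ.+-monoˡ-≤ diag 0≤off))))
          where
          on-diagonal : ∀ i k l → i * i * (k + l) ≡ i * k * i + l * (1ℤ * (i * i))
          on-diagonal = solve-∀

    -- Deviation of a count from its mean

    module Deviation (ν : K → ℤ) where

      mean-free : K → ℤ
      mean-free t = Q * ν t - ∑ₖ ν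

      -- This is q² times the variance of ν.
      excess : ℤ
      excess = Q * ∑ₖ (λ t → ν t * ν t) - ∑ₖ ν * ∑ₖ ν

      ∑-mean-free : ∑ₖ mean-free ≡ 0ℤ
      ∑-mean-free = begin
        ∑ₖ (λ t → Q * ν t - ∑ₖ ν)                   ≡⟨ ∑-cong scalars (λ t → split Q (ν t) (∑ₖ ν)) ⟩
        ∑ₖ (λ t → Q * ν t + - ∑ₖ ν * 1ℤ)            ≡⟨ ∑-lin₂ scalars Q ν (- ∑ₖ ν) (λ _ → 1ℤ) ⟩
        Q * ∑ₖ ν + - ∑ₖ ν * ∑ₖ (λ _ → 1ℤ)           ≡⟨ cong (λ i → Q * ∑ₖ ν + - ∑ₖ ν * i) size-scalars ⟩
        Q * ∑ₖ ν + - ∑ₖ ν * Q                       ≡⟨ cancel Q (∑ₖ ν) ⟩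
        0ℤ                                          ∎
        where
        open ≡-Reasoning
        split : ∀ i j k → i * j - k ≡ i * j + - k * 1ℤ
        split = solve-∀
        cancel : ∀ i j → i * j + - j * i ≡ 0ℤ
        cancel = solve-∀

      ∑-ν-mean-free : ∑ₖ (λ t → ν t * mean-free t) ≡ excess
      ∑-ν-mean-free = begin
        ∑ₖ (λ t → ν t * mean-free t)                          ≡⟨ ∑-cong scalars (λ t → split Q (ν t) (∑ₖ ν)) ⟩
        ∑ₖ (λ t → Q * (ν t * ν t) + - ∑ₖ ν * ν t)             ≡⟨ ∑-lin₂ scalars Q (λ t → ν t * ν t) (- ∑ₖ ν) ν ⟩
        Q * ∑ₖ (λ t → ν t * ν t) + - ∑ₖ ν * ∑ₖ ν              ≡⟨ merge Q (∑ₖ (λ t → ν t * ν t)) (∑ₖ ν) ⟩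
        excess                                                ∎
        where
        open ≡-Reasoning
        split : ∀ i j k → j * (i * j - k) ≡ i * (j * j) + - k * j
        split = solve-∀
        merge : ∀ i j k → i * j + - k * k ≡ i * j - k * k
        merge = solve-∀

      ∑-mean-free² : ∑ₖ (λ t → mean-free t * mean-free t) ≡ Q * excess
      ∑-mean-free² = begin
        ∑ₖ (λ t → mean-free t * mean-free t)
          ≡⟨ ∑-cong scalars (λ t → split Q (ν t) (∑ₖ ν) (mean-free t)) ⟩
        ∑ₖ (λ t → Q * (ν t * mean-free t) + - ∑ₖ ν * mean-free t)
          ≡⟨ ∑-lin₂ scalars Q (λ t → ν t * mean-free t) (- ∑ₖ ν) mean-free ⟩
        Q * ∑ₖ (λ t → ν t * mean-free t) + - ∑ₖ ν * ∑ₖ mean-free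
          ≡⟨ cong₂ (λ i j → Q * i + - ∑ₖ ν * j) ∑-ν-mean-free ∑-mean-free ⟩
        Q * excess + - ∑ₖ ν * 0ℤ
          ≡⟨ drop Q excess (∑ₖ ν) ⟩
        Q * excess ∎
        where
        open ≡-Reasoning
        split : ∀ i j k l → (i * j - k) * l ≡ i * (j * l) + - k * l
        split = solve-∀
        drop : ∀ i j k → i * j + - k * 0ℤ ≡ i * j
        drop = solve-∀

    -- Upper bounds for q ∑ ν² - |E|²|F|²

    instance
      q-nonZero : ℕ.NonZero q
      q-nonZero = FiniteField.q-nonZero 𝔽
      Q-positive : ℤ.Positive Q
      Q-positive = ℤ.positive (ℤ.+<+ (ℕ.>-nonZero⁻¹ q))

    -- Chebyshev's second-moment argument: for uniform y, the events ℓ p y = s attached to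
    -- distinct p are pairwise independent once s is averaged over.
    incidence-bound : (P : Enumeration A) (_≟ₚ_ : DecidableEquality A) (Y : Enumeration B)
      (w : A → ℤ) (f : B → ℤ) → (∀ p → 0ℤ ≤ w p) → (∀ p → w p * w p ≡ w p) → (∀ y → f y * f y ≡ f y) →
      (ℓ : A → B → K) → (∀ p p′ → p ≢ p′ → Q * ∑ Y (λ y → 𝟙 (ℓ p y ≟ ℓ p′ y)) ≡ size Y) →
      let V = ∑ Y (λ y → f y * (Q * ∑ P (λ p → w p * 𝟙 (ℓ p y ≟ 0#)) - ∑ P w))
      in V * V ≤ ∑ Y f * (Q * (Q * (size Y * ∑ P w)))
    incidence-bound {A = A} {B = B} P _≟ₚ_ Y w f 0≤w w²≡w f²≡f ℓ independent = begin
      V * V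
        ≤⟨ cauchy-schwarz Y f dev ⟩
      ∑ Y (λ y → f y * f y) * ∑ Y (λ y → dev y * dev y)
        ≡⟨ cong (_* ∑ Y (λ y → dev y * dev y)) (∑-cong Y f²≡f) ⟩
      ∑ Y f * ∑ Y (λ y → dev y * dev y)
        ≤⟨ *-monoˡ-0≤ (∑ Y f) (∑-nonneg Y λ y → subst (0ℤ ≤_) (f²≡f y) (0≤i*i (f y))) second-moment ⟩
      ∑ Y f * (Q * (Q * (size Y * N))) ∎
      where
      open ℤₚ.≤-Reasoning
      N : ℤ
      N = ∑ P w
      cnt : B → K → ℤ
      cnt y s = ∑ P (λ p → w p * 𝟙 (ℓ p y ≟ s))
      dev : B → ℤ
      dev y = Q * cnt y 0# - N
      V : ℤ
      V = ∑ Y (λ y → f y * dev y)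
      ∑-cnt : ∀ y → ∑ₖ (cnt y) ≡ N
      ∑-cnt y = sym (trans (∑-cong P λ p → sym (ℤₚ.*-identityʳ (w p)))
        (trans (∑-weighted-fibres P scalars _≟_ w (λ p → ℓ p y) (λ _ → 1ℤ)) (∑-cong scalars λ s → ℤₚ.*-identityʳ (cnt y s))))
      collisions : B → ℤ
      collisions y = ∑ P (λ p → ∑ P (λ p′ → w p * w p′ * 𝟙 (ℓ p′ y ≟ ℓ p y)))
      ∑-cnt² : ∀ y → ∑ₖ (λ s → cnt y s * cnt y s) ≡ collisions y
      ∑-cnt² y = trans (sym (∑-weighted-fibres P scalars _≟_ w (λ p → ℓ p y) (cnt y)))
        (∑-cong P λ p → trans (sym (∑-*ˡ P (w p) (λ p′ → w p′ * 𝟙 (ℓ p′ y ≟ ℓ p y))))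
          (∑-cong P λ p′ → sym (ℤₚ.*-assoc (w p) (w p′) (𝟙 (ℓ p′ y ≟ ℓ p y)))))
      -- Only s = 0 occurs in `dev`; adding the squares for all other s completes the variance,
      -- which is determined by the number of collisions.
      dev²-≤ : ∀ y → dev y * dev y ≤ Q * (Q * collisions y - N * N)
      dev²-≤ y = subst₂ _≤_ (cong (λ i → (Q * cnt y 0# - i) * (Q * cnt y 0# - i)) (∑-cnt y))
        (trans ∑-mean-free² (cong₂ (λ i j → Q * (Q * i - j * j)) (∑-cnt² y) (∑-cnt y)))
        (term-≤-∑ scalars _≟_ (λ s → mean-free s * mean-free s) (λ s → 0≤i*i (mean-free s)) 0#)
        where open Deviation (cnt y)
      meetings : A → A → ℤ
      meetings p p′ = ∑ Y (λ y → 𝟙 (ℓ p′ y ≟ ℓ p y))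
      meetings-≤ : ∀ p p′ → w p * w p′ * (Q * meetings p p′) ≤ w p * size Y * w p′ + Q * size Y * (𝟙 (p ≟ₚ p′) * (w p * w p′))
      meetings-≤ p p′ with p ≟ₚ p′
      ... | no p≢p′ = ℤₚ.≤-reflexive (trans (cong (w p * w p′ *_) (independent p′ p (p≢p′ ∘ sym)))
                        (reorder (w p) (w p′) (size Y) Q))
        where
        reorder : ∀ i j k l → i * j * k ≡ i * k * j + l * k * (0ℤ * (i * j))
        reorder = solve-∀
      ... | yes refl = subst₂ _≤_
          (cong (λ i → w p * w p * (Q * i)) (sym (∑-cong Y λ y → 𝟙-yes (ℓ p y ≟ ℓ p y) refl)))
          (reorder (w p) (size Y) Q)
          (*-monoˡ-0≤ (w p * w p) (0≤i*i (w p)) (ℤₚ.≤-trans (ℤₚ.≤-reflexive (sym (ℤₚ.+-identityˡ (Q * size Y))))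
            (ℤₚ.+-monoˡ-≤ (Q * size Y) (∑-nonneg Y λ _ → +≤+ ℕ.z≤n))))
        where
        reorder : ∀ i k l → i * i * (k + l * k) ≡ i * k * i + l * k * (1ℤ * (i * i))
        reorder = solve-∀
      -- The part `size Y * (N * N)`, to which independence reduces distinct p and p′, will cancel
      -- the mean exactly. What survives is the contribution of p = p′.
      ∑-collisions : Q * ∑ Y collisions ≤ size Y * (N * N) + Q * (size Y * N)
      ∑-collisions = begin
        Q * ∑ Y collisions
          ≡⟨ cong (Q *_) (∑-swap-inner P P Y (λ p p′ y → w p * w p′ * 𝟙 (ℓ p′ y ≟ ℓ p y))) ⟨
        Q * ∑ P (λ p → ∑ P (λ p′ → ∑ Y (λ y → w p * w p′ * 𝟙 (ℓ p′ y ≟ ℓ p y))))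
          ≡⟨ cong (Q *_) (∑-cong P λ p → ∑-cong P λ p′ → ∑-*ˡ Y (w p * w p′) (λ y → 𝟙 (ℓ p′ y ≟ ℓ p y))) ⟩
        Q * ∑ P (λ p → ∑ P (λ p′ → w p * w p′ * meetings p p′))
          ≡⟨ trans (∑-cong P λ p → ∑-*ˡ P Q (λ p′ → w p * w p′ * meetings p p′))
               (∑-*ˡ P Q (λ p → ∑ P (λ p′ → w p * w p′ * meetings p p′))) ⟨
        ∑ P (λ p → ∑ P (λ p′ → Q * (w p * w p′ * meetings p p′)))
          ≡⟨ ∑-cong P (λ p → ∑-cong P λ p′ → left-comm Q (w p * w p′) (meetings p p′)) ⟩
        ∑ P (λ p → ∑ P (λ p′ → w p * w p′ * (Q * meetings p p′)))
          ≤⟨ ∑-mono P (λ p → ∑-mono P λ p′ → meetings-≤ p p′) ⟩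
        ∑ P (λ p → ∑ P (λ p′ → w p * size Y * w p′ + Q * size Y * (𝟙 (p ≟ₚ p′) * (w p * w p′))))
          ≡⟨ ∑-cong P (λ p → trans (∑-lin₂ P (w p * size Y) w (Q * size Y) (λ p′ → 𝟙 (p ≟ₚ p′) * (w p * w p′)))
               (cong₂ (λ i j → i + Q * size Y * j) (rotate (w p) (size Y) N)
                 (trans (∑-δ P _≟ₚ_ p (λ p′ → w p * w p′)) (w²≡w p)))) ⟩
        ∑ P (λ p → size Y * N * w p + Q * size Y * w p)
          ≡⟨ ∑-lin₂ P (size Y * N) w (Q * size Y) w ⟩
        size Y * N * N + Q * size Y * N
          ≡⟨ cong₂ _+_ (ℤₚ.*-assoc (size Y) N N) (ℤₚ.*-assoc Q (size Y) N) ⟩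
        size Y * (N * N) + Q * (size Y * N) ∎
        where
        left-comm : ∀ i j k → i * (j * k) ≡ j * (i * k)
        left-comm = solve-∀
        rotate : ∀ i j k → i * j * k ≡ j * k * i
        rotate = solve-∀
      second-moment : ∑ Y (λ y → dev y * dev y) ≤ Q * (Q * (size Y * N))
      second-moment = begin
        ∑ Y (λ y → dev y * dev y)
          ≤⟨ ∑-mono Y dev²-≤ ⟩
        ∑ Y (λ y → Q * (Q * collisions y - N * N))
          ≡⟨ ∑-*ˡ Y Q (λ y → Q * collisions y - N * N) ⟩
        Q * ∑ Y (λ y → Q * collisions y - N * N)
          ≡⟨ cong (Q *_) (trans (∑-cong Y λ y → split Q (collisions y) N)
               (trans (∑-lin₂ Y Q collisions (- (N * N)) (λ _ → 1ℤ)) (merge Q (∑ Y collisions) N (size Y)))) ⟩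
        Q * (Q * ∑ Y collisions - size Y * (N * N))
          ≤⟨ *-monoˡ-0≤ Q (+≤+ ℕ.z≤n) (ℤₚ.+-monoˡ-≤ (- (size Y * (N * N))) ∑-collisions) ⟩
        Q * (size Y * (N * N) + Q * (size Y * N) - size Y * (N * N))
          ≡⟨ cancel Q (size Y * (N * N)) (Q * (size Y * N)) ⟩
        Q * (Q * (size Y * N)) ∎
        where
        split : ∀ i j k → i * j - k * k ≡ i * j + - (k * k) * 1ℤ
        split = solve-∀
        merge : ∀ i j k l → i * j + - (k * k) * l ≡ i * j - l * (k * k)
        merge = solve-∀
        cancel : ∀ i j k → i * (j + k - j) ≡ i * k
        cancel = solve-∀

    -- The difference of two squared distances to y is affine in y.
    bisectors-equidistributed : (x x′ : Space n) → x ≢ x′ → ∀ r r′ →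
      Q * ∑ᵥ (λ y → 𝟙 (‖ x ⊟ y ‖ ⊝ r ≟ ‖ x′ ⊟ y ‖ ⊝ r′)) ≡ Q^ n
    bisectors-equidistributed [] [] x≢x′ = ⊥-elim (x≢x′ refl)
    bisectors-equidistributed {suc n} (i ∷ x) (i′ ∷ x′) ix≢ix′ r r′ with x ≟ᵥ x′
    ... | no x≢x′ = begin
      Q * ∑ᵥ (λ y → 𝟙 (‖ (i ∷ x) ⊟ y ‖ ⊝ r ≟ ‖ (i′ ∷ x′) ⊟ y ‖ ⊝ r′))
        ≡⟨ cong (Q *_) (∑ᵥ-suc (λ y → 𝟙 (‖ (i ∷ x) ⊟ y ‖ ⊝ r ≟ ‖ (i′ ∷ x′) ⊟ y ‖ ⊝ r′))) ⟩
      Q * ∑ₖ (λ j → ∑ᵥ (λ y → 𝟙 (sq (i ⊝ j) ⊕ ‖ x ⊟ y ‖ ⊝ r ≟ sq (i′ ⊝ j) ⊕ ‖ x′ ⊟ y ‖ ⊝ r′)))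
        -- The leading squares are absorbed into the offsets r and r′, so the induction can drop a
        -- coordinate.
        ≡⟨ cong (Q *_) (∑-cong scalars λ j → ∑-cong (points n) λ y → 𝟙-≡ (absorb (sq (i ⊝ j)) ‖ x ⊟ y ‖ r) (absorb (sq (i′ ⊝ j)) ‖ x′ ⊟ y ‖ r′)) ⟩
      Q * ∑ₖ (λ j → ∑ᵥ (λ y → 𝟙 (‖ x ⊟ y ‖ ⊝ (r ⊝ sq (i ⊝ j)) ≟ ‖ x′ ⊟ y ‖ ⊝ (r′ ⊝ sq (i′ ⊝ j)))))
        ≡⟨ ∑-*ˡ scalars Q (λ j → ∑ᵥ (λ y → 𝟙 (‖ x ⊟ y ‖ ⊝ (r ⊝ sq (i ⊝ j)) ≟ ‖ x′ ⊟ y ‖ ⊝ (r′ ⊝ sq (i′ ⊝ j))))) ⟨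
      ∑ₖ (λ j → Q * ∑ᵥ (λ y → 𝟙 (‖ x ⊟ y ‖ ⊝ (r ⊝ sq (i ⊝ j)) ≟ ‖ x′ ⊟ y ‖ ⊝ (r′ ⊝ sq (i′ ⊝ j)))))
        ≡⟨ ∑-cong scalars (λ j → bisectors-equidistributed x x′ x≢x′ (r ⊝ sq (i ⊝ j)) (r′ ⊝ sq (i′ ⊝ j))) ⟩
      ∑ₖ (λ j → Q^ n)
        ≡⟨ trans (∑ₖ-const (Q^ n)) (Q^suc n) ⟩
      Q^ suc n ∎
      where
      open ≡-Reasoning
      sq : K → K
      sq z = z ⊗ z
      𝟙-≡ : ∀ {s s′ t t′} → s ≡ s′ → t ≡ t′ → 𝟙 (s ≟ t) ≡ 𝟙 (s′ ≟ t′)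
      𝟙-≡ refl refl = refl
      absorb : ∀ s z r → s ⊕ z ⊝ r ≡ z ⊝ (r ⊝ s)
      absorb = solve 3 (λ s z r → s :+ z :- r := z :- (r :- s)) refl
    ... | yes refl = begin
      Q * ∑ᵥ (λ y → 𝟙 (‖ (i ∷ x) ⊟ y ‖ ⊝ r ≟ ‖ (i′ ∷ x) ⊟ y ‖ ⊝ r′))
        ≡⟨ cong (Q *_) (∑ᵥ-suc (λ y → 𝟙 (‖ (i ∷ x) ⊟ y ‖ ⊝ r ≟ ‖ (i′ ∷ x) ⊟ y ‖ ⊝ r′))) ⟩
      Q * ∑ₖ (λ j → ∑ᵥ (λ y → 𝟙 ((i ⊝ j) ⊗ (i ⊝ j) ⊕ ‖ x ⊟ y ‖ ⊝ r ≟ (i′ ⊝ j) ⊗ (i′ ⊝ j) ⊕ ‖ x ⊟ y ‖ ⊝ r′)))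
        ≡⟨ cong (Q *_) (∑-cong scalars λ j → ∑-cong (points n) λ y → 𝟙-cong (_ ≟ _) (0# ≟ gap j)
             (λ eq → sym (trans (sym (gap-≡ j ‖ x ⊟ y ‖)) (x≡y⇒x⊝y≡0 eq)))
             (λ eq → x⊝y≡0⇒x≡y _ _ (trans (gap-≡ j ‖ x ⊟ y ‖) (sym eq)))) ⟩
      Q * ∑ₖ (λ j → ∑ᵥ {n} (λ y → 𝟙 (0# ≟ gap j)))
        ≡⟨ cong (Q *_) (∑-cong scalars λ j → ∑ᵥ-const n (𝟙 (0# ≟ gap j))) ⟩
      Q * ∑ₖ (λ j → Q^ n * 𝟙 (0# ≟ gap j))
        ≡⟨ cong (Q *_) (∑-*ˡ scalars (Q^ n) (λ j → 𝟙 (0# ≟ gap j))) ⟩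
      Q * (Q^ n * ∑ₖ (λ j → 𝟙 (0# ≟ gap j)))
        ≡⟨ cong (λ z → Q * (Q^ n * z)) (trans
             (∑-affine slope intercept slope≢0 (λ _ → refl) (λ z → 𝟙 (0# ≟ z))) (∑-δ1 scalars _≟_ 0#)) ⟩
      Q * (Q^ n * 1ℤ)
        ≡⟨ trans (cong (Q *_) (ℤₚ.*-identityʳ (Q^ n))) (Q^suc n) ⟩
      Q^ suc n ∎
      where
      open ≡-Reasoning
      slope intercept : K
      slope = (1# ⊕ 1#) ⊗ (i′ ⊝ i)
      intercept = i ⊗ i ⊝ i′ ⊗ i′ ⊝ r ⊕ r′
      gap : K → K
      gap j = slope ⊗ j ⊕ intercept
      slope≢0 : slope ≢ 0#
      slope≢0 = ⊗≢0 2≢0 (λ eq → ix≢ix′ (cong (_∷ x) (sym (x⊝y≡0⇒x≡y i′ i eq))))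
      gap-≡ : ∀ j z → ((i ⊝ j) ⊗ (i ⊝ j) ⊕ z ⊝ r) ⊝ ((i′ ⊝ j) ⊗ (i′ ⊝ j) ⊕ z ⊝ r′) ≡ gap j
      gap-≡ j z = solve 6 (λ i i′ j z r r′ →
        ((i :- j) :* (i :- j) :+ z :- r) :- ((i′ :- j) :* (i′ :- j) :+ z :- r′) :=
        (con 1ℤ :+ con 1ℤ) :* (i′ :- i) :* j :+ (i :* i :- i′ :* i′ :- r :+ r′)) refl i i′ j z r r′

    module DistanceCounts {ℓ₁ ℓ₂ : Level} {d : ℕ} {E : Pred (Space d) ℓ₁} {F : Pred (Space d) ℓ₂}
                          (E? : Decidable E) (F? : Decidable F) where

      e f : Space d → ℤ
      e x = 𝟙 (E? x)
      f y = 𝟙 (F? y)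

      pairs : Enumeration (Space d × Space d)
      pairs = points d ×ₑ points d

      distance : Space d × Space d → K
      distance (x , y) = ‖ x ⊟ y ‖

      ν : K → ℤ
      ν t = ∑ pairs (λ (x , y) → e x * f y * 𝟙 (distance (x , y) ≟ t))

      open Deviation ν public

      ∑-ν : ∑ₖ ν ≡ ∑ᵥ e * ∑ᵥ f
      ∑-ν = trans (∑-cong scalars λ t → sym (ℤₚ.*-identityʳ (ν t))) (trans
        (sym (∑-weighted-fibres pairs scalars _≟_ (λ (x , y) → e x * f y) distance (λ _ → 1ℤ)))
        (trans (∑-cong pairs λ (x , y) → ℤₚ.*-identityʳ (e x * f y)) (∑-×ₑ-* (points d) (points d) e f)))

      0≤excess : 0ℤ ≤ excess
      0≤excess = ℤₚ.*-cancelˡ-≤-pos 0ℤ excess Q (subst₂ _≤_ (sym (ℤₚ.*-zeroʳ Q)) ∑-mean-free²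
        (∑-nonneg scalars λ t → 0≤i*i (mean-free t)))

      -- Writing the excess as a sum over y ∈ F, Cauchy-Schwarz bounds its square by |F| M ∑ c². As
      -- ∑ c² is again q times the excess, one factor of it cancels.
      gram-bound⇒excess-≤ : ∀ M → 0ℤ ≤ M →
        ∑ᵥ (λ y → ∑ᵥ (λ x → e x * mean-free ‖ x ⊟ y ‖) * ∑ᵥ (λ x → e x * mean-free ‖ x ⊟ y ‖)) ≤ M * ∑ₖ (λ t → mean-free t * mean-free t) →
        excess ≤ ∑ᵥ f * (M * Q)
      gram-bound⇒excess-≤ M 0≤M gram = v*v≤k*v⇒v≤k (0≤i*j 0≤∑f (0≤i*j 0≤M (+≤+ ℕ.z≤n))) 0≤excess (begin
        excess * excess
          ≡⟨ cong (λ i → i * i) (trans (sym ∑-ν-mean-free) as-sum-over-f) ⟩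
        ∑ᵥ (λ y → f y * g y) * ∑ᵥ (λ y → f y * g y)
          ≤⟨ cauchy-schwarz (points d) f g ⟩
        ∑ᵥ (λ y → f y * f y) * ∑ᵥ (λ y → g y * g y)
          ≡⟨ cong (_* ∑ᵥ (λ y → g y * g y)) (∑-cong (points d) λ y → 𝟙-idem (F? y)) ⟩
        ∑ᵥ f * ∑ᵥ (λ y → g y * g y)
          ≤⟨ *-monoˡ-0≤ (∑ᵥ f) 0≤∑f gram ⟩
        ∑ᵥ f * (M * ∑ₖ (λ t → mean-free t * mean-free t))
          ≡⟨ cong (λ i → ∑ᵥ f * (M * i)) ∑-mean-free² ⟩
        ∑ᵥ f * (M * (Q * excess))
          ≡⟨ reassociate (∑ᵥ f) M Q excess ⟩
        ∑ᵥ f * (M * Q) * excess ∎)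
        where
        open ℤₚ.≤-Reasoning
        0≤∑f : 0ℤ ≤ ∑ᵥ f
        0≤∑f = ∑-nonneg (points d) λ y → 0≤𝟙 (F? y)
        reassociate : ∀ i j k l → i * (j * (k * l)) ≡ i * (j * k) * l
        reassociate = solve-∀
        left-comm : ∀ i j k → i * j * k ≡ j * (i * k)
        left-comm = solve-∀
        g : Space d → ℤ
        g y = ∑ᵥ (λ x → e x * mean-free ‖ x ⊟ y ‖)
        as-sum-over-f : ∑ₖ (λ t → ν t * mean-free t) ≡ ∑ᵥ (λ y → f y * g y)
        as-sum-over-f = trans (sym (∑-weighted-fibres pairs scalars _≟_ (λ (x , y) → e x * f y) distance mean-free))
          (trans (∑-×ₑ (points d) (points d) (λ (x , y) → e x * f y * mean-free (distance (x , y))))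
            (trans (∑-swap (points d) (points d) (λ x y → e x * f y * mean-free ‖ x ⊟ y ‖))
              (∑-cong (points d) λ y → trans (∑-cong (points d) λ x → left-comm (e x) (f y) (mean-free ‖ x ⊟ y ‖))
                (∑-*ˡ (points d) (f y) (λ x → e x * mean-free ‖ x ⊟ y ‖)))))

      -- Zero exactly when (x , y) and (x′ , y′) are at the same distance, that is, when (x , x′)
      -- and (y , y′) are incident.
      gap : Space d × Space d → Space d × Space d → K
      gap (x , x′) (y , y′) = ‖ x ⊟ y ‖ ⊝ ‖ x′ ⊟ y′ ‖

      size-pairs : size pairs ≡ Q^ d * Q^ d
      size-pairs = trans (∑-×ₑ-* (points d) (points d) (λ _ → 1ℤ) (λ _ → 1ℤ)) (cong (λ i → i * i)
        (trans (∑ᵥ-const d 1ℤ) (ℤₚ.*-identityʳ (Q^ d))))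

      -- Distinct pairs differ in some component. With the y of the other component fixed, its
      -- distances are mere offsets and a bisector count remains; for the second component the sign
      -- is flipped first.
      gap-independent : ∀ p p′ → p ≢ p′ → Q * ∑ pairs (λ y → 𝟙 (gap p y ≟ gap p′ y)) ≡ size pairs
      gap-independent p@(x₁ , x₂) p′@(z₁ , z₂) p≢p′ = trans (trans
          (cong (Q *_) (∑-×ₑ (points d) (points d) (λ y → 𝟙 (gap p y ≟ gap p′ y)))) nested) (sym size-pairs)
        where
        open ≡-Reasoning
        nested : Q * ∑ᵥ (λ y₁ → ∑ᵥ (λ y₂ → 𝟙 (gap p (y₁ , y₂) ≟ gap p′ (y₁ , y₂)))) ≡ Q^ d * Q^ d
        nested with x₁ ≟ᵥ z₁
        ... | no x₁≢z₁ = begin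
          Q * ∑ᵥ (λ y₁ → ∑ᵥ (λ y₂ → 𝟙 (gap p (y₁ , y₂) ≟ gap p′ (y₁ , y₂))))
            ≡⟨ cong (Q *_) (∑-swap (points d) (points d) (λ y₁ y₂ → 𝟙 (gap p (y₁ , y₂) ≟ gap p′ (y₁ , y₂)))) ⟩
          Q * ∑ᵥ (λ y₂ → ∑ᵥ (λ y₁ → 𝟙 (gap p (y₁ , y₂) ≟ gap p′ (y₁ , y₂))))
            ≡⟨ ∑-*ˡ (points d) Q (λ y₂ → ∑ᵥ (λ y₁ → 𝟙 (gap p (y₁ , y₂) ≟ gap p′ (y₁ , y₂)))) ⟨
          ∑ᵥ (λ y₂ → Q * ∑ᵥ (λ y₁ → 𝟙 (gap p (y₁ , y₂) ≟ gap p′ (y₁ , y₂))))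
            ≡⟨ ∑-cong (points d) (λ y₂ → bisectors-equidistributed x₁ z₁ x₁≢z₁ ‖ x₂ ⊟ y₂ ‖ ‖ z₂ ⊟ y₂ ‖) ⟩
          ∑ᵥ {d} (λ y₂ → Q^ d)
            ≡⟨ ∑ᵥ-const d (Q^ d) ⟩
          Q^ d * Q^ d ∎
        ... | yes refl = begin
          Q * ∑ᵥ (λ y₁ → ∑ᵥ (λ y₂ → 𝟙 (gap p (y₁ , y₂) ≟ gap p′ (y₁ , y₂))))
            ≡⟨ cong (Q *_) (∑-cong (points d) λ y₁ → ∑-cong (points d) λ y₂ → 𝟙-cong (gap p (y₁ , y₂) ≟ gap p′ (y₁ , y₂))
                 (‖ x₂ ⊟ y₂ ‖ ⊝ ‖ x₁ ⊟ y₁ ‖ ≟ ‖ z₂ ⊟ y₂ ‖ ⊝ ‖ x₁ ⊟ y₁ ‖)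
                 (λ eq → trans (sym (flip ‖ x₁ ⊟ y₁ ‖ ‖ x₂ ⊟ y₂ ‖)) (trans (cong ⊖_ eq) (flip ‖ x₁ ⊟ y₁ ‖ ‖ z₂ ⊟ y₂ ‖)))
                 (λ eq → trans (sym (flip ‖ x₂ ⊟ y₂ ‖ ‖ x₁ ⊟ y₁ ‖)) (trans (cong ⊖_ eq) (flip ‖ z₂ ⊟ y₂ ‖ ‖ x₁ ⊟ y₁ ‖)))) ⟩
          Q * ∑ᵥ (λ y₁ → ∑ᵥ (λ y₂ → 𝟙 (‖ x₂ ⊟ y₂ ‖ ⊝ ‖ x₁ ⊟ y₁ ‖ ≟ ‖ z₂ ⊟ y₂ ‖ ⊝ ‖ x₁ ⊟ y₁ ‖)))
            ≡⟨ ∑-*ˡ (points d) Q (λ y₁ → ∑ᵥ (λ y₂ → 𝟙 (‖ x₂ ⊟ y₂ ‖ ⊝ ‖ x₁ ⊟ y₁ ‖ ≟ ‖ z₂ ⊟ y₂ ‖ ⊝ ‖ x₁ ⊟ y₁ ‖))) ⟨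
          ∑ᵥ (λ y₁ → Q * ∑ᵥ (λ y₂ → 𝟙 (‖ x₂ ⊟ y₂ ‖ ⊝ ‖ x₁ ⊟ y₁ ‖ ≟ ‖ z₂ ⊟ y₂ ‖ ⊝ ‖ x₁ ⊟ y₁ ‖)))
            ≡⟨ ∑-cong (points d) (λ y₁ → bisectors-equidistributed x₂ z₂ (p≢p′ ∘ cong (x₁ ,_)) ‖ x₁ ⊟ y₁ ‖ ‖ x₁ ⊟ y₁ ‖) ⟩
          ∑ᵥ {d} (λ y₁ → Q^ d)
            ≡⟨ ∑ᵥ-const d (Q^ d) ⟩
          Q^ d * Q^ d ∎
          where
          flip : ∀ s t → ⊖ (s ⊝ t) ≡ t ⊝ s
          flip = solve 2 (λ s t → :- (s :- t) := t :- s) refl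

      ee ff : Space d × Space d → ℤ
      ee (x , x′) = e x * e x′
      ff (y , y′) = f y * f y′

      -- The sum of squares counts quadruples with equal distances, grouped by (x , y) and (x′ ,
      -- y′). Transposing the grouping separates the points of E from those of F.
      ∑-ν²≡incidences : ∑ₖ (λ t → ν t * ν t) ≡ ∑ pairs (λ y → ff y * ∑ pairs (λ p → ee p * 𝟙 (gap p y ≟ 0#)))
      ∑-ν²≡incidences = begin
        ∑ₖ (λ t → ν t * ν t)
          ≡⟨ ∑-weighted-fibres pairs scalars _≟_ (λ (x , y) → e x * f y) distance ν ⟨
        ∑ pairs (λ (x , y) → e x * f y * ν (distance (x , y)))
          ≡⟨ ∑-cong pairs (λ (x , y) → sym (∑-*ˡ pairs (e x * f y) (λ (x′ , y′) → e x′ * f y′ * 𝟙 (‖ x′ ⊟ y′ ‖ ≟ ‖ x ⊟ y ‖)))) ⟩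
        ∑ pairs (λ p → ∑ pairs (λ p′ → quad (p , p′)))
          ≡⟨ ∑-×ₑ pairs pairs quad ⟨
        ∑ (pairs ×ₑ pairs) quad
          ≡⟨ ∑-reindex (pairs ×ₑ pairs) (pairs ×ₑ pairs) transpose transpose (λ _ → refl) (λ _ → refl) quad ⟨
        ∑ (pairs ×ₑ pairs) (λ z → quad (transpose z))
          ≡⟨ ∑-cong (pairs ×ₑ pairs) (λ ((x , x′) , (y , y′)) → trans
               (cong (λ i → e x * f y * (e x′ * f y′ * i)) (𝟙-cong (‖ x′ ⊟ y′ ‖ ≟ ‖ x ⊟ y ‖) (‖ x ⊟ y ‖ ⊝ ‖ x′ ⊟ y′ ‖ ≟ 0#)
                 (λ eq → x≡y⇒x⊝y≡0 (sym eq)) (λ eq → sym (x⊝y≡0⇒x≡y _ _ eq))))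
               (regroup (e x) (f y) (e x′) (f y′) (𝟙 (‖ x ⊟ y ‖ ⊝ ‖ x′ ⊟ y′ ‖ ≟ 0#)))) ⟩
        ∑ (pairs ×ₑ pairs) (λ (p , y) → ff y * (ee p * 𝟙 (gap p y ≟ 0#)))
          ≡⟨ ∑-×ₑ pairs pairs (λ (p , y) → ff y * (ee p * 𝟙 (gap p y ≟ 0#))) ⟩
        ∑ pairs (λ p → ∑ pairs (λ y → ff y * (ee p * 𝟙 (gap p y ≟ 0#))))
          ≡⟨ ∑-swap pairs pairs (λ p y → ff y * (ee p * 𝟙 (gap p y ≟ 0#))) ⟩
        ∑ pairs (λ y → ∑ pairs (λ p → ff y * (ee p * 𝟙 (gap p y ≟ 0#))))
          ≡⟨ ∑-cong pairs (λ y → ∑-*ˡ pairs (ff y) (λ p → ee p * 𝟙 (gap p y ≟ 0#))) ⟩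
        ∑ pairs (λ y → ff y * ∑ pairs (λ p → ee p * 𝟙 (gap p y ≟ 0#))) ∎
        where
        open ≡-Reasoning
        quad : (Space d × Space d) × (Space d × Space d) → ℤ
        quad ((x , y) , (x′ , y′)) = e x * f y * (e x′ * f y′ * 𝟙 (‖ x′ ⊟ y′ ‖ ≟ ‖ x ⊟ y ‖))
        transpose : (Space d × Space d) × (Space d × Space d) → (Space d × Space d) × (Space d × Space d)
        transpose ((x , x′) , (y , y′)) = (x , y) , (x′ , y′)
        regroup : ∀ i j k l m → i * j * (k * l * m) ≡ j * l * (i * k * m)
        regroup = solve-∀

      -- Because the incidence problem lives on pairs, its sizes are |E|², |F|² and q^(2d). The
      -- second-moment bound is therefore a perfect square and its root can be taken in the
      -- integers.
      excess-≤-independent : excess ≤ ∑ᵥ f * (Q^ d * ∑ᵥ e * Q)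
      excess-≤-independent = v*v≤k*k⇒v≤k (0≤i*j (∑-nonneg (points d) λ y → 0≤𝟙 (F? y)) (0≤i*j (0≤i*j {Q^ d} (+≤+ ℕ.z≤n) (∑-nonneg (points d) λ x → 0≤𝟙 (E? x))) (+≤+ ℕ.z≤n))) (begin
        excess * excess
          ≡⟨ cong (λ i → i * i) (sym V≡excess) ⟩
        V * V
          ≤⟨ incidence-bound pairs (×-≡-dec _≟ᵥ_ _≟ᵥ_) pairs ee ff (λ (x , x′) → 0≤i*j (0≤𝟙 (E? x)) (0≤𝟙 (E? x′)))
               (λ (x , x′) → idem (𝟙-idem (E? x)) (𝟙-idem (E? x′))) (λ (y , y′) → idem (𝟙-idem (F? y)) (𝟙-idem (F? y′))) gap gap-independent ⟩
        ∑ pairs ff * (Q * (Q * (size pairs * ∑ pairs ee)))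
          ≡⟨ cong₂ (λ i j → i * (Q * (Q * j))) ∑-ff (cong₂ _*_ size-pairs ∑-ee) ⟩
        ∑ᵥ f * ∑ᵥ f * (Q * (Q * (Q^ d * Q^ d * (∑ᵥ e * ∑ᵥ e))))
          ≡⟨ square (∑ᵥ f) Q (Q^ d) (∑ᵥ e) ⟩
        ∑ᵥ f * (Q^ d * ∑ᵥ e * Q) * (∑ᵥ f * (Q^ d * ∑ᵥ e * Q)) ∎)
        where
        open ℤₚ.≤-Reasoning
        square : ∀ i j k l → i * i * (j * (j * (k * k * (l * l)))) ≡ i * (k * l * j) * (i * (k * l * j))
        square = solve-∀
        idem : ∀ {i j} → i * i ≡ i → j * j ≡ j → i * j * (i * j) ≡ i * j
        idem {i} {j} i²≡i j²≡j = trans (interchange i j) (cong₂ _*_ i²≡i j²≡j)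
          where
          interchange : ∀ i j → i * j * (i * j) ≡ i * i * (j * j)
          interchange = solve-∀
        ∑-ee : ∑ pairs ee ≡ ∑ᵥ e * ∑ᵥ e
        ∑-ee = ∑-×ₑ-* (points d) (points d) e e
        ∑-ff : ∑ pairs ff ≡ ∑ᵥ f * ∑ᵥ f
        ∑-ff = ∑-×ₑ-* (points d) (points d) f f
        incidences : Space d × Space d → ℤ
        incidences y = ∑ pairs (λ p → ee p * 𝟙 (gap p y ≟ 0#))
        V : ℤ
        V = ∑ pairs (λ y → ff y * (Q * incidences y - ∑ pairs ee))
        split : ∀ i j k l → i * (j * k - l) ≡ j * (i * k) + - l * i
        split = solve-∀
        merge : ∀ i j k l → i * j + - (l * l) * (k * k) ≡ i * j - l * k * (l * k)
        merge = solve-∀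
        V≡excess : V ≡ excess
        V≡excess = trans (∑-cong pairs λ y → split (ff y) Q (incidences y) (∑ pairs ee))
          (trans (∑-lin₂ pairs Q (λ y → ff y * incidences y) (- ∑ pairs ee) ff)
          (trans (cong₂ (λ i j → Q * ∑ pairs (λ y → ff y * incidences y) + - i * j) ∑-ee ∑-ff)
          (trans (merge Q (∑ pairs (λ y → ff y * incidences y)) (∑ᵥ f) (∑ᵥ e))
                 (cong₂ (λ i j → Q * i - j * j) (sym ∑-ν²≡incidences) (sym ∑-ν)))))

    excess-≤-odd : ∀ {ℓ₁ ℓ₂} m {E : Pred (Space (suc (m ℕ.* 2))) ℓ₁} {F : Pred (Space (suc (m ℕ.* 2))) ℓ₂}
      (E? : Decidable E) (F? : Decidable F) (let open DistanceCounts E? F?) →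
      excess ≤ ∑ᵥ f * ((pos 2 * (Q^ (m ℕ.* 2) * ∑ᵥ e) + pos 2 * (Q^ m * (∑ᵥ e * ∑ᵥ e))) * Q)
    excess-≤-odd m E? F? = gram-bound⇒excess-≤ (pos 2 * (Q^ (m ℕ.* 2) * ∑ᵥ e) + pos 2 * (Q^ m * (∑ᵥ e * ∑ᵥ e))) 0≤M
      (gram-≤ mean-free ∑-mean-free m e (λ x → 0≤𝟙 (E? x)) (λ x → 𝟙-idem (E? x)))
      where
      open DistanceCounts E? F?
      0≤∑e : 0ℤ ≤ ∑ᵥ e
      0≤∑e = ∑-nonneg (points (suc (m ℕ.* 2))) λ x → 0≤𝟙 (E? x)
      0≤M : 0ℤ ≤ pos 2 * (Q^ (m ℕ.* 2) * ∑ᵥ e) + pos 2 * (Q^ m * (∑ᵥ e * ∑ᵥ e))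
      0≤M = ℤₚ.+-mono-≤ (0≤i*j {pos 2} (+≤+ ℕ.z≤n) (0≤i*j {Q^ (m ℕ.* 2)} (+≤+ ℕ.z≤n) 0≤∑e))
                        (0≤i*j {pos 2} (+≤+ ℕ.z≤n) (0≤i*j {Q^ m} (+≤+ ℕ.z≤n) (0≤i*i (∑ᵥ e))))

    -- Lower bounds for the distance set

    module _ {ℓ₁ ℓ₂ : Level} {d : ℕ} {E : Pred (Space d) ℓ₁} {F : Pred (Space d) ℓ₂}
             (E? : Decidable E) (F? : Decidable F) where
      open DistanceCounts E? F?

      ν-supported : ∀ t → ν t * 𝟙 (Δ? E? F? t) ≡ ν t
      ν-supported t = trans (sym (∑-*ʳ pairs (𝟙 (Δ? E? F? t)) (λ (x , y) → e x * f y * 𝟙 (‖ x ⊟ y ‖ ≟ t))))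
        (∑-cong pairs λ (x , y) → supported x y)
        where
        supported : ∀ x y → 𝟙 (E? x) * 𝟙 (F? y) * 𝟙 (‖ x ⊟ y ‖ ≟ t) * 𝟙 (Δ? E? F? t) ≡ 𝟙 (E? x) * 𝟙 (F? y) * 𝟙 (‖ x ⊟ y ‖ ≟ t)
        supported x y with E? x | F? y | ‖ x ⊟ y ‖ ≟ t
        ... | no _   | _      | _      = refl
        ... | yes _  | no _   | _      = refl
        ... | yes _  | yes _  | no _   = refl
        ... | yes Ex | yes Fy | yes eq = cong (1ℤ *_) (𝟙-yes (Δ? E? F? t) (x , y , Ex , Fy , sym eq))

      support-≤ : ∑ₖ ν * ∑ₖ ν ≤ ∑ₖ (λ t → ν t * ν t) * pos (#Δ E? F?)
      support-≤ = subst₂ _≤_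
        (cong (λ i → i * i) (∑-cong scalars ν-supported))
        (cong (∑ₖ (λ t → ν t * ν t) *_) (trans (∑-cong scalars λ t → 𝟙-idem (Δ? E? F? t)) (∑-𝟙 scalars (Δ? E? F?))))
        (cauchy-schwarz scalars ν (λ t → 𝟙 (Δ? E? F? t)))

      -- Let N = |E||F|, D = |Δ| and I = ∑ ν², so N² ≤ I D. Then 2 q N² ≤ 2 D q I = 2 D (q I - N²) +
      -- 2 D N². If 2 D ≤ q, the last term is at most q N² and can be absorbed, leaving q N² ≤ 2 D
      -- |F| M q. A factor q and a factor |F| cancel.
      dichotomy : ∀ M → excess ≤ ∑ᵥ f * (pos M * Q) → 1 ℕ.≤ #pts F? →
        q ℕ.≤ 2 ℕ.* #Δ E? F? ⊎ #pts E? ℕ.* #pts E? ℕ.* #pts F? ℕ.≤ 2 ℕ.* #Δ E? F? ℕ.* M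
      dichotomy M excess≤ 1≤#F with ℕₚ.≤-total q (2 ℕ.* #Δ E? F?)
      ... | inj₁ q≤2D = inj₁ q≤2D
      ... | inj₂ 2D≤q = inj₂ (ℤₚ.drop‿+≤+ (subst₂ _≤_ ℕ-left ℕ-right
          (ℤₚ.*-cancelʳ-≤-pos (x * x * y) (pos 2 * D * pos M) y {{ℤ.positive (ℤ.+<+ 1≤#F)}}
            (ℤₚ.*-cancelʳ-≤-pos (x * x * y * y) (pos 2 * D * pos M * y) Q (begin
        x * x * y * y * Q                        ≡⟨ regroup x y Q ⟩
        Q * (N * N) + Q * (N * N) - Q * (N * N)  ≤⟨ ℤₚ.+-monoˡ-≤ (- (Q * (N * N))) (begin
          Q * (N * N) + Q * (N * N)              ≡⟨ double Q (N * N) ⟩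
          pos 2 * Q * (N * N)                    ≤⟨ *-monoˡ-0≤ (pos 2 * Q) (0≤i*j {pos 2} {Q} (+≤+ ℕ.z≤n) (+≤+ ℕ.z≤n))
                                                      (subst (λ i → i * i ≤ I * D) N≡ support-≤) ⟩
          pos 2 * Q * (I * D)                    ≡⟨ introduce Q I D N ⟩
          pos 2 * D * (Q * I - N * N) + pos 2 * D * (N * N)
                                                 ≤⟨ ℤₚ.+-mono-≤
                                                      (*-monoˡ-0≤ (pos 2 * D) (0≤i*j {pos 2} {D} (+≤+ ℕ.z≤n) (+≤+ ℕ.z≤n)) excess≤′)
                                                      (*-monoʳ-0≤ (N * N) (0≤i*i N) 2D≤Q) ⟩
          pos 2 * D * (y * (pos M * Q)) + Q * (N * N) ∎) ⟩
        pos 2 * D * (y * (pos M * Q)) + Q * (N * N) - Q * (N * N)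
                                                 ≡⟨ finish D y (pos M) Q (N * N) ⟩
        pos 2 * D * pos M * y * Q ∎)))))
        where
        open ℤₚ.≤-Reasoning
        x y N I D : ℤ
        x = pos (#pts E?)
        y = pos (#pts F?)
        N = x * y
        I = ∑ₖ (λ t → ν t * ν t)
        D = pos (#Δ E? F?)
        N≡ : ∑ₖ ν ≡ N
        N≡ = trans ∑-ν (cong₂ _*_ (∑-𝟙 (points d) E?) (∑-𝟙 (points d) F?))
        excess≤′ : Q * I - N * N ≤ y * (pos M * Q)
        excess≤′ = subst₂ (λ i j → Q * I - i * i ≤ j * (pos M * Q)) N≡ (∑-𝟙 (points d) F?) excess≤
        2D≤Q : pos 2 * D ≤ Q
        2D≤Q = subst (_≤ Q) (ℤₚ.pos-* 2 (#Δ E? F?)) (+≤+ 2D≤q)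
        ℕ-left : x * x * y ≡ pos (#pts E? ℕ.* #pts E? ℕ.* #pts F?)
        ℕ-left = sym (trans (ℤₚ.pos-* (#pts E? ℕ.* #pts E?) (#pts F?)) (cong (_* y) (ℤₚ.pos-* (#pts E?) (#pts E?))))
        ℕ-right : pos 2 * D * pos M ≡ pos (2 ℕ.* #Δ E? F? ℕ.* M)
        ℕ-right = sym (trans (ℤₚ.pos-* (2 ℕ.* #Δ E? F?) M) (cong (_* pos M) (ℤₚ.pos-* 2 (#Δ E? F?))))
        regroup : ∀ i j k → i * i * j * j * k ≡ k * (i * j * (i * j)) + k * (i * j * (i * j)) - k * (i * j * (i * j))
        regroup = solve-∀
        double : ∀ i j → i * j + i * j ≡ pos 2 * i * j
        double = solve-∀
        introduce : ∀ i j k l → pos 2 * i * (j * k) ≡ pos 2 * k * (i * j - l * l) + pos 2 * k * (l * l)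
        introduce = solve-∀
        finish : ∀ i j k l m → pos 2 * i * (j * (k * l)) + l * m - l * m ≡ pos 2 * i * k * j * l
        finish = solve-∀

      dichotomy-independent : 1 ℕ.≤ #pts F? →
        q ℕ.≤ 2 ℕ.* #Δ E? F? ⊎ #pts E? ℕ.* #pts E? ℕ.* #pts F? ℕ.≤ 2 ℕ.* #Δ E? F? ℕ.* (q ℕ.^ d ℕ.* #pts E?)
      dichotomy-independent = dichotomy (q ℕ.^ d ℕ.* #pts E?)
        (subst (λ i → excess ≤ ∑ᵥ f * (i * Q))
          (trans (cong (Q^ d *_) (∑-𝟙 (points d) E?)) (sym (ℤₚ.pos-* (q ℕ.^ d) (#pts E?)))) excess-≤-independent)

    dichotomy-odd : ∀ {ℓ₁ ℓ₂} {d} m → d ≡ suc (m ℕ.* 2) → {E : Pred (Space d) ℓ₁} {F : Pred (Space d) ℓ₂}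
      (E? : Decidable E) (F? : Decidable F) → 1 ℕ.≤ #pts F? →
      q ℕ.≤ 2 ℕ.* #Δ E? F? ⊎ #pts E? ℕ.* #pts E? ℕ.* #pts F? ℕ.≤
        2 ℕ.* #Δ E? F? ℕ.* (2 ℕ.* (q ℕ.^ (m ℕ.* 2) ℕ.* #pts E?) ℕ.+ 2 ℕ.* (q ℕ.^ m ℕ.* (#pts E? ℕ.* #pts E?)))
    dichotomy-odd m refl E? F? = dichotomy E? F?
      (2 ℕ.* (q ℕ.^ (m ℕ.* 2) ℕ.* #E) ℕ.+ 2 ℕ.* (q ℕ.^ m ℕ.* (#E ℕ.* #E)))
      (subst (λ i → excess ≤ ∑ᵥ f * (i * Q)) M≡ (excess-≤-odd m E? F?))
      where
      open DistanceCounts E? F?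
      #E : ℕ
      #E = #pts E?
      ∑e≡ : ∑ᵥ e ≡ pos #E
      ∑e≡ = ∑-𝟙 (points (suc (m ℕ.* 2))) E?
      M≡ : pos 2 * (Q^ (m ℕ.* 2) * ∑ᵥ e) + pos 2 * (Q^ m * (∑ᵥ e * ∑ᵥ e)) ≡
           pos (2 ℕ.* (q ℕ.^ (m ℕ.* 2) ℕ.* #E) ℕ.+ 2 ℕ.* (q ℕ.^ m ℕ.* (#E ℕ.* #E)))
      M≡ = trans (cong (λ i → pos 2 * (Q^ (m ℕ.* 2) * i) + pos 2 * (Q^ m * (i * i))) ∑e≡) (sym (cong₂ _+_
        (trans (ℤₚ.pos-* 2 (q ℕ.^ (m ℕ.* 2) ℕ.* #E)) (cong (pos 2 *_) (ℤₚ.pos-* (q ℕ.^ (m ℕ.* 2)) #E)))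
        (trans (ℤₚ.pos-* 2 (q ℕ.^ m ℕ.* (#E ℕ.* #E))) (cong (pos 2 *_) (trans (ℤₚ.pos-* (q ℕ.^ m) (#E ℕ.* #E)) (cong (Q^ m *_) (ℤₚ.pos-* #E #E)))))))

open import Data.Integer using (+_; +≤+)
open import Data.List.Membership.Propositional.Properties using (∈-filter⁺; ∈-length)
open import Data.Nat using (_+_; _*_; _∸_; _^_; _≤_; _<_; NonZero; >-nonZero; s≤s)
open import Data.Nat.DivMod using (_/_; _%_; m*n/n≡m; m≡m%n+[m/n]*n; m%n<n)
open import Data.Nat.Primality using (Prime; prime⇒irreducible; prime[2]; euclidsLemma)
open import Data.Nat.Properties using (*-identityʳ; *-comm; *-monoʳ-≤; *-monoˡ-≤; +-monoʳ-≤; +-monoˡ-≤; *-cancelʳ-≤; <⇒≤; ^-*-assoc; m*n≢0; m^n≢0; module ≤-Reasoning)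
open import Data.Nat.Tactic.RingSolver using (solve-∀)
open import Data.Rational as ℚ using (_⊓_)
import Data.Rational.Properties as ℚₚ
open import Data.Rational.Unnormalised using (mkℚᵘ; *≤*)
import Data.Rational.Unnormalised.Properties as ℚᵘₚ

-- Arithmetic of the three regimes

n≤D*k⇒n/k≤D/1 : ∀ n D k .{{_ : NonZero k}} → n ≤ D * k → (+ n ℚ./ k) ℚ.≤ (+ D ℚ./ 1)
n≤D*k⇒n/k≤D/1 n D (suc k) n≤Dk = ℚₚ.toℚᵘ-cancel-≤
  (ℚᵘₚ.≤-respˡ-≃ (ℚᵘₚ.≃-sym (ℚₚ.toℚᵘ-fromℚᵘ (mkℚᵘ (+ n) k)))
  (ℚᵘₚ.≤-respʳ-≃ (ℚᵘₚ.≃-sym (ℚₚ.toℚᵘ-fromℚᵘ (mkℚᵘ (+ D) 0)))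
  (*≤* (subst₂ ℤ._≤_ (sym (ℤₚ.*-identityʳ (+ n))) (ℤₚ.pos-* D (suc k)) (+≤+ n≤Dk)))))

2∤p^n : ∀ {p} → Prime p → p ≢ 2 → ∀ n → ¬ (2 ∣ p ^ n)
2∤p^n pp p≢2 zero    2∣1 with () ← ∣1⇒≡1 2∣1
2∤p^n {p} pp p≢2 (suc n) 2∣p*p^n with euclidsLemma p (p ^ n) prime[2] 2∣p*p^n
... | inj₂ 2∣p^n = 2∤p^n pp p≢2 n 2∣p^n
... | inj₁ 2∣p with prime⇒irreducible pp 2∣p
...   | inj₂ 2≡p = p≢2 (sym 2≡p)

odd : ∀ d → ¬ (2 ∣ d) → ∃ λ m → d ≡ suc (m * 2)
odd d 2∤d with d % 2 | m≡m%n+[m/n]*n d 2 | m%n<n d 2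
... | 0 | d≡ | _ = ⊥-elim (2∤d (divides (d / 2) d≡))
... | 1 | d≡ | _ = d / 2 , d≡
... | suc (suc _) | _ | s≤s (s≤s ())

satisfiable⇒1≤∣∣ : ∀ {a p} {A : Set a} (S : Enumeration A) {P : Pred A p} (P? : Decidable P) →
  Satisfiable P → 1 ≤ Enumeration.∣_∣ S P?
satisfiable⇒1≤∣∣ S P? (x , Px) = ∈-length (∈-filter⁺ P? (Enumeration.complete S x) Px)

-- x = ∣E∣, y = ∣F∣, B = q^m.
small-E : ∀ x y D B → 1 ≤ x → x < B → x * x * y ≤ 2 * D * (2 * (B * B * x) + 2 * (B * (x * x))) → x * y ≤ D * (8 * (B * B))
small-E x y D B 1≤x x<B h = *-cancelʳ-≤ (x * y) (D * (8 * (B * B))) x {{>-nonZero 1≤x}} (begin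
  x * y * x                                          ≡⟨ swap x y ⟩
  x * x * y                                          ≤⟨ h ⟩
  -- Below the balance point the diagonal summand dominates; raising the other one to it gives 2 (2
  -- + 2) = 8.
  2 * D * (2 * (B * B * x) + 2 * (B * (x * x)))      ≤⟨ *-monoʳ-≤ (2 * D) (+-monoʳ-≤ (2 * (B * B * x)) (*-monoʳ-≤ 2 (*-monoʳ-≤ B (*-monoˡ-≤ x (<⇒≤ x<B))))) ⟩
  2 * D * (2 * (B * B * x) + 2 * (B * (B * x)))      ≡⟨ collect D B x ⟩
  D * (8 * (B * B)) * x                              ∎)
  where
  open ≤-Reasoning
  swap : ∀ x y → x * y * x ≡ x * x * y
  swap = solve-∀
  collect : ∀ D B x → 2 * D * (2 * (B * B * x) + 2 * (B * (B * x))) ≡ D * (8 * (B * B)) * x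
  collect = solve-∀

medium-E : ∀ x y D B → 1 ≤ x → B ≤ x → x * x * y ≤ 2 * D * (2 * (B * B * x) + 2 * (B * (x * x))) → y ≤ D * (8 * B)
medium-E x y D B 1≤x B≤x h = *-cancelʳ-≤ y (D * (8 * B)) (x * x) {{m*n≢0 x x {{>-nonZero 1≤x}} {{>-nonZero 1≤x}}}} (begin
  y * (x * x)                                        ≡⟨ *-comm y (x * x) ⟩
  x * x * y                                          ≤⟨ h ⟩
  -- From the balance point on the off-diagonal summand dominates, and x² cancels, so the bound no
  -- longer depends on |E|.
  2 * D * (2 * (B * B * x) + 2 * (B * (x * x)))      ≤⟨ *-monoʳ-≤ (2 * D) (+-monoˡ-≤ (2 * (B * (x * x))) (*-monoʳ-≤ 2 (*-monoˡ-≤ x (*-monoʳ-≤ B B≤x)))) ⟩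
  2 * D * (2 * (B * x * x) + 2 * (B * (x * x)))      ≡⟨ collect D B x ⟩
  D * (8 * B) * (x * x)                              ∎)
  where
  open ≤-Reasoning
  collect : ∀ D B x → 2 * D * (2 * (B * x * x) + 2 * (B * (x * x))) ≡ D * (8 * B) * (x * x)
  collect = solve-∀

large-E : ∀ x y D A → 1 ≤ x → x * x * y ≤ 2 * D * (A * x) → x * y ≤ D * (2 * A)
large-E x y D A 1≤x h = *-cancelʳ-≤ (x * y) (D * (2 * A)) x {{>-nonZero 1≤x}} (begin
  x * y * x           ≡⟨ swap x y ⟩
  x * x * y           ≤⟨ h ⟩
  2 * D * (A * x)     ≡⟨ collect D A x ⟩
  D * (2 * A) * x     ∎)
  where
  open ≤-Reasoning
  swap : ∀ x y → x * y * x ≡ x * x * y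
  swap = solve-∀
  collect : ∀ D A x → 2 * D * (A * x) ≡ D * (2 * A) * x
  collect = solve-∀

module _ {a : Level} {q : ℕ} (𝔽 : FiniteField a q) where

  open DistanceSets 𝔽

  ⊓-≤ : ∀ D n c k .{{_ : NonZero c}} → q ≤ 2 * D ⊎ n ≤ D * (c * q ^ k) →
        ((+ q ℚ./ 2) ⊓ (n /[ c ·q^ k ])) ℚ.≤ (+ D ℚ./ 1)
  ⊓-≤ D n c k (inj₁ q≤2D) = ℚₚ.≤-trans (ℚₚ.p⊓q≤p (+ q ℚ./ 2) (n /[ c ·q^ k ]))
    (n≤D*k⇒n/k≤D/1 q D 2 (subst (q ≤_) (*-comm 2 D) q≤2D))
  ⊓-≤ D n c k {{c≢0}} (inj₂ n≤Dcq^k) = ℚₚ.≤-trans (ℚₚ.p⊓q≤q (+ q ℚ./ 2) (n /[ c ·q^ k ]))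
    (n≤D*k⇒n/k≤D/1 n D (c * q ^ k) {{m*n≢0 c (q ^ k) {{c≢0}} {{m^n≢0 q k {{FiniteField.q-nonZero 𝔽}}}}}} n≤Dcq^k)

  three-regimes : ∀ d m → d ≡ suc (m * 2) → ∀ x y D → 1 ≤ x →
    (q ≤ 2 * D ⊎ x * x * y ≤ 2 * D * (2 * (q ^ (m * 2) * x) + 2 * (q ^ m * (x * x)))) →
    (q ≤ 2 * D ⊎ x * x * y ≤ 2 * D * (q ^ d * x)) →
    (1 ≤ x → x < q ^ ((d ∸ 1) / 2) → ((+ q ℚ./ 2) ⊓ ((x * y) /[ 8 ·q^ d ∸ 1 ])) ℚ.≤ (+ D ℚ./ 1))
    × (q ^ ((d ∸ 1) / 2) ≤ x → x < q ^ ((d + 1) / 2) → ((+ q ℚ./ 2) ⊓ (y /[ 8 ·q^ (d ∸ 1) / 2 ])) ℚ.≤ (+ D ℚ./ 1))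
    × (q ^ ((d + 1) / 2) ≤ x → x ≤ q ^ d → ((+ q ℚ./ 2) ⊓ ((x * y) /[ 2 ·q^ d ])) ℚ.≤ (+ D ℚ./ 1))
  three-regimes _ m refl x y D 1≤x odd-bound independent-bound =
      (λ _ x<q^m → ⊓-≤ D (x * y) 8 (m * 2) (map₂ (λ h → subst (λ A → x * y ≤ D * (8 * A)) (sym A≡B*B)
        (small-E x y D (q ^ m) 1≤x (subst (λ k → x < q ^ k) m≡ x<q^m) (with-squares h))) odd-bound))
    , (λ q^m≤x _ → ⊓-≤ D y 8 (m * 2 / 2) (map₂ (λ h → subst (λ k → y ≤ D * (8 * q ^ k)) (sym m≡)
        (medium-E x y D (q ^ m) 1≤x (subst (λ k → q ^ k ≤ x) m≡ q^m≤x) (with-squares h))) odd-bound))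
    , (λ _ _ → ⊓-≤ D (x * y) 2 (suc (m * 2)) (map₂ (large-E x y D (q ^ suc (m * 2)) 1≤x) independent-bound))
    where
    m≡ : m * 2 / 2 ≡ m
    m≡ = m*n/n≡m m 2
    A≡B*B : q ^ (m * 2) ≡ q ^ m * q ^ m
    A≡B*B = trans (sym (^-*-assoc q m 2)) (cong (q ^ m *_) (*-identityʳ (q ^ m)))
    with-squares : x * x * y ≤ 2 * D * (2 * (q ^ (m * 2) * x) + 2 * (q ^ m * (x * x))) →
                   x * x * y ≤ 2 * D * (2 * (q ^ m * q ^ m * x) + 2 * (q ^ m * (x * x)))
    with-squares = subst (λ A → x * x * y ≤ 2 * D * (2 * (A * x) + 2 * (q ^ m * (x * x)))) A≡B*B

mainTheorem1 : ∀ {a ℓ₁ ℓ₂ : Level} (q : ℕ) →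
    (∃ λ p → ∃ λ n → Prime p × p ≢ 2 × 1 ≤ n × q ≡ p ^ n) →
    (𝔽 : FiniteField a q) (let open DistanceSets 𝔽) →
    (d : ℕ) → 3 ≤ d → ¬ (2 ∣ d) →
    (E : Pred (Space d) ℓ₁) (E? : Decidable E) →
    (F : Pred (Space d) ℓ₂) (F? : Decidable F) →
    Satisfiable E → Satisfiable F →
    (1 ≤ #pts E? → #pts E? < q ^ ((d ∸ 1) / 2) →
    ((+ q ℚ./ 2) ⊓ ((#pts E? * #pts F?) /[ 8 ·q^ d ∸ 1 ])) ℚ.≤ (+ #Δ E? F? ℚ./ 1))
    × (q ^ ((d ∸ 1) / 2) ≤ #pts E? → #pts E? < q ^ ((d + 1) / 2) →
    ((+ q ℚ./ 2) ⊓ (#pts F? /[ 8 ·q^ (d ∸ 1) / 2 ])) ℚ.≤ (+ #Δ E? F? ℚ./ 1))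
    × (q ^ ((d + 1) / 2) ≤ #pts E? → #pts E? ≤ q ^ d →
    ((+ q ℚ./ 2) ⊓ ((#pts E? * #pts F?) /[ 2 ·q^ d ])) ℚ.≤ (+ #Δ E? F? ℚ./ 1))
mainTheorem1 q (p , n , p-prime , p≢2 , _ , q≡p^n) 𝔽 d _ 2∤d E E? F F? E-inhabited F-inhabited =
  three-regimes 𝔽 d m d≡ (#pts E?) (#pts F?) (#Δ E? F?)
    (satisfiable⇒1≤∣∣ (FiniteField.points 𝔽 d) E? E-inhabited)
    (dichotomy-odd m d≡ E? F? 1≤#F) (dichotomy-independent E? F? 1≤#F)
  where
  open DistanceSets 𝔽
  open FieldSums 𝔽
  2≢0 : 1# ⊕ 1# ≢ 0#
  2≢0 = 1+1≢0 (subst (λ k → ¬ (2 ∣ k)) (sym q≡p^n) (2∤p^n p-prime p≢2 n))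
  open OddCharacteristic 2≢0
  m : ℕ
  m = proj₁ (odd d 2∤d)
  d≡ : d ≡ suc (m * 2)
  d≡ = proj₂ (odd d 2∤d)
  1≤#F : 1 ≤ #pts F?
  1≤#F = satisfiable⇒1≤∣∣ (FiniteField.points 𝔽 d) F? F-inhabited
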